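{- Let $(F,\mathrm{Frob})\in\mathcal{S}$, let $A\subseteq F$ and let $r(x,y)$ be a complete quantifier-free $\mathcal{L}_\sigma$-type over $A$. Suppose the following conjecture holds: for every $(F',\mathrm{Frob})\in\mathcal{S}$, every countable $A'\subseteq F'$ and every complete quantifier-free $\mathcal{L}_\sigma$-type $p(x)$ over $A'$, $\pmb{\delta}_{F'}(p(x))=\dim_{rk}(p(x))$. Then $\pmb{\delta}_F(\exists y\, r(x,y))=\dim_{rk}(\exists y\, r(x,y))$.
   Context: $\mathbb{P}$ = primes, $\mathrm{Frob}_p:x\mapsto x^p$, $\mathcal{L}_\sigma$ = language of rings plus unary $\sigma$. For a parameter-free $\mathcal{L}_\sigma$-formula $\varphi$ and prime $p$, $\varphi_p$ replaces each $\sigma(t)$ by $t^p$. For each ring formula $\psi(x,y)$, $|x|=n$, fix $C_\psi>0$ and finite $D_\psi\subseteq\{0,..,n\}\times\mathbb{R}^{>0}$ such that for all finite fields $\mathbb{F}_q$ and $a$ with $\psi(\mathbb{F}_q^n,a)\ne\emptyset$ some $(d,\mu)\in D_\psi$ has $\big||\psi(\mathbb{F}_q^n,a)|-\mu q^d\big|\le C_\psi q^{d-1/2}$; $E_\psi=\{\mu:(d,\mu)\in D_\psi\}$; $N^p_\varphi=\max\{\mu,1/\mu,2\log_p(2C_{\varphi_p}/\mu):\mu\in E_{\varphi_p}\}$; $f(\ell,p)=\max\{N^p_\varphi:|\varphi|\le \ell\}$. $\mathcal{S}$ = ultraproducts $\prod_{p\in\mathbb{P}}(\mathbb{F}_{p^{k_p}},\mathrm{Frob}_p)/\mathcal{U}$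 with $\mathcal{U}$ non-principal and $k_p\ge f(p,p)$. $\pmb{\delta}_F(D)=\mathrm{st}(\log|D|/\log|F|)$ for definable $D$ (nonstandard cardinalities); for a partial type $\pi$, $\pmb{\delta}_F(\pi)=\inf\{\pmb{\delta}_F(\varphi):\pi\models\varphi\}$. Let $(\tilde F,\mathrm{Frob})=\prod_p(\tilde{\mathbb{F}}_p,\mathrm{Frob}_p)/\mathcal{U}$ (a model of ACFA containing $(F,\mathrm{Frob})$). In a difference field, a tuple $a$ is transformally independent over a difference subfield $E$ if no nonzero difference polynomial over $E$ vanishes on it; the transformal transcendence degree of $a$ over $E$ is the maximal length of a transformally independent subtuple. For a tuple $a$ and set $A$, $\dim_{rk}(a/A)$ is the transformal transcendence degree of $a$ over the difference field generated by $A$ (equivalently the $k$ with $\mathrm{SU}(a/A)=\omega k+m$ in ACFA); for a partial type $\pi$ over $A$, $\dim_{rk}(\pi)=\max\{\dim_{rk}(a/A): a\models\pi\}$, realizations taken in a saturated elementary extension of $(\tilde F,\mathrm{Frob})$. $\exists y\,r(x,y)$ denotes the partial type $\{\exists y\bigwedge\Phi:\Phi\subseteq r \text{ finite}\}$. -}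

module Defs where

open import Level using (0ℓ)
open import Algebra.Bundles using (CommutativeRing)
open import Algebra.Bundles.Raw using (RawRing)
open import Algebra.Morphism.Structures using (IsRingMonomorphism)
import Algebra.Definitions.RawSemiring as RawSemiringDefs
open import Data.Empty using (⊥)
open import Data.Fin.Base using (Fin; toℕ)
open import Data.List.Base as List using (List; []; _∷_)
open import Data.List.Membership.Propositional using (_∈_)
import Data.List.Membership.Setoid as SetoidMembership
open import Data.List.Relation.Unary.All using (All)
open import Data.List.Relation.Unary.Any using (Any)
open import Data.List.Relation.Unary.Unique.Propositional using (Unique)
import Data.List.Relation.Unary.Unique.Setoid as SetoidUnique
open import Data.Nat.Base as ℕ using (ℕ; zero; suc)
open import Data.Nat.Primality using (Prime)
open import Data.Product.Base using (Σ; Σ-syntax; ∃; ∃-syntax; _×_; _,_; proj₁; proj₂)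
open import Data.Refinement.Base using (Refinement; value)
open import Data.Sum.Base using (_⊎_)
open import Data.Unit.Base using (⊤; tt)
open import Data.Vec.Base as Vec using (Vec; []; _∷_; _++_; lookup)
import Data.Vec.Relation.Binary.Pointwise.Inductive as Pointwise
open import Function.Base using (_∘_)
open import Function.Bundles using (_⇔_)
open import Relation.Binary.Bundles using (Setoid)
open import Relation.Binary.PropositionalEquality using (_≡_; _≢_)
open import Relation.Binary.Structures using (IsTotalOrder)
open import Relation.Nullary.Negation using (¬_)
open import Relation.Unary using (Pred; ∁; _∩_)

-- The real numbers, as a Dedekind-complete ordered field.  All models are
-- uniquely isomorphic as ordered fields; √ is determined on x ≥ 0 and ⁻¹ on
-- x ≉ 0 (elsewhere their values are junk).  The function log is a logarithm to
-- some base > 1, junk outside x > 0.  The base is left open because logarithms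
-- are only used through the ratios log x / log y.

record Reals : Set₁ where
  field
    commutativeRing : CommutativeRing 0ℓ 0ℓ
  open CommutativeRing commutativeRing public
    renaming (Carrier to ℝ)
  open RawSemiringDefs (RawRing.rawSemiring rawRing) public
    using (_^_) renaming (_×_ to _×ₙ_)
  infix 4 _≤_ _<_
  field
    _≤_          : ℝ → ℝ → Set
    isTotalOrder : IsTotalOrder _≈_ _≤_
  _<_ : ℝ → ℝ → Set
  x < y = x ≤ y × ¬ (x ≈ y)
  infix 9 _⁻¹
  field
    0≉1      : ¬ (0# ≈ 1#)
    +-mono-≤ : ∀ {x y} z → x ≤ y → (x + z) ≤ (y + z)
    *-nonneg : ∀ {x y} → 0# ≤ x → 0# ≤ y → 0# ≤ (x * y)
    _⁻¹      : ℝ → ℝ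
    ⁻¹-inverse : ∀ {x} → ¬ (x ≈ 0#) → (x * x ⁻¹) ≈ 1#
    sup : (S : Pred ℝ 0ℓ) → ∃ S → (∃[ u ] (∀ x → S x → x ≤ u)) →
          ∃[ s ] ((∀ x → S x → x ≤ s) × (∀ u → (∀ x → S x → x ≤ u) → s ≤ u))
    √_       : ℝ → ℝ
    √-nonneg : ∀ {x} → 0# ≤ x → 0# ≤ √ x
    √-square : ∀ {x} → 0# ≤ x → (√ x * √ x) ≈ x
    log      : ℝ → ℝ
    log-cong : ∀ {x y} → x ≈ y → log x ≈ log y
    log-mono : ∀ {x y} → 0# < x → x < y → log x < log y
    log-*    : ∀ {x y} → 0# < x → 0# < y → log (x * y) ≈ (log x + log y)

  fromℕ : ℕ → ℝ
  fromℕ n = n ×ₙ 1#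

  infixl 7 _÷_
  _÷_ : ℝ → ℝ → ℝ
  x ÷ y = x * y ⁻¹

  ∣_∣≤_ : ℝ → ℝ → Set
  ∣ x ∣≤ c = x ≤ c × (- x) ≤ c

  data ℝ₋∞ : Set where
    -∞  : ℝ₋∞
    fin : ℝ → ℝ₋∞

  _≤₋∞_ : ℝ₋∞ → ℝ₋∞ → Set
  -∞    ≤₋∞ _     = ⊤
  fin _ ≤₋∞ -∞    = ⊥
  fin x ≤₋∞ fin y = x ≤ y

  IsInf : Pred ℝ₋∞ 0ℓ → ℝ₋∞ → Set
  IsInf S g = (∀ d → S d → g ≤₋∞ d) × (∀ h → (∀ d → S d → h ≤₋∞ d) → h ≤₋∞ g)

-- First-order syntax in the language ℒ-ring of rings and its expansion ℒσ by a
-- unary function symbol σ.  C is a type of constant symbols, used for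
-- parameters; variables are de Bruijn indices.

data Language : Set where
  ℒ-ring ℒσ : Language

infixl 7 _⊗_
infixl 6 _⊕_
infix  4 _≐_

data Term (C : Set) : Language → ℕ → Set where
  var     : ∀ {L n} → Fin n → Term C L n
  con     : ∀ {L n} → C → Term C L n
  𝟘 𝟙     : ∀ {L n} → Term C L n
  _⊕_ _⊗_ : ∀ {L n} → Term C L n → Term C L n → Term C L n
  ⊝_      : ∀ {L n} → Term C L n → Term C L n
  σ       : ∀ {n} → Term C ℒσ n → Term C ℒσ n

data Formula (C : Set) (L : Language) : ℕ → Set where
  _≐_     : ∀ {n} → Term C L n → Term C L n → Formula C L n
  neg     : ∀ {n} → Formula C L n → Formula C L n
  _∧_ _∨_ : ∀ {n} → Formula C L n → Formula C L n → Formula C L n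
  ex all  : ∀ {n} → Formula C L (suc n) → Formula C L n

⋀ : ∀ {L C n} → List (Formula C L n) → Formula C L n
⋀ = List.foldr _∧_ (𝟘 ≐ 𝟘)

-- Quantifies the first m of the m + n free variables.
ex^ : ∀ {L C} m {n} → Formula C L (m ℕ.+ n) → Formula C L n
ex^ zero    φ = φ
ex^ (suc m) φ = ex^ m (ex φ)

QuantifierFree : ∀ {L C n} → Formula C L n → Set
QuantifierFree (_ ≐ _) = ⊤
QuantifierFree (neg φ) = QuantifierFree φ
QuantifierFree (φ ∧ ψ) = QuantifierFree φ × QuantifierFree ψ
QuantifierFree (φ ∨ ψ) = QuantifierFree φ × QuantifierFree ψ
QuantifierFree (ex _)  = ⊥
QuantifierFree (all _) = ⊥

termSize : ∀ {L C n} → Term C L n → ℕ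
termSize (var _) = 1
termSize (con _) = 1
termSize 𝟘       = 1
termSize 𝟙       = 1
termSize (s ⊕ t) = suc (termSize s ℕ.+ termSize t)
termSize (s ⊗ t) = suc (termSize s ℕ.+ termSize t)
termSize (⊝ t)   = suc (termSize t)
termSize (σ t)   = suc (termSize t)

size : ∀ {L C n} → Formula C L n → ℕ
size (s ≐ t) = suc (termSize s ℕ.+ termSize t)
size (neg φ) = suc (size φ)
size (φ ∧ ψ) = suc (size φ ℕ.+ size ψ)
size (φ ∨ ψ) = suc (size φ ℕ.+ size ψ)
size (ex φ)  = suc (size φ)
size (all φ) = suc (size φ)

-- The length of φ(x,y) counts the displayed variables x, y as well as the
-- symbols of φ, so that only finitely many φ(x,y) have length ≤ ℓ.
len : ∀ {L C} n m → Formula C L (n ℕ.+ m) → ℕ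
len n m φ = n ℕ.+ m ℕ.+ size φ

_^ₜ_ : ∀ {L C n} → Term C L n → ℕ → Term C L n
t ^ₜ zero  = 𝟙
t ^ₜ suc k = t ⊗ (t ^ₜ k)

substTerm : ∀ {C n} → ℕ → Term C ℒσ n → Term C ℒ-ring n
substTerm p (var i) = var i
substTerm p (con c) = con c
substTerm p 𝟘       = 𝟘
substTerm p 𝟙       = 𝟙
substTerm p (s ⊕ t) = substTerm p s ⊕ substTerm p t
substTerm p (s ⊗ t) = substTerm p s ⊗ substTerm p t
substTerm p (⊝ t)   = ⊝ substTerm p t
substTerm p (σ t)   = substTerm p t ^ₜ p

-- φ ⟨ p ⟩ is φ_p: every σ(t) is replaced by t^p.
_⟨_⟩ : ∀ {C n} → Formula C ℒσ n → ℕ → Formula C ℒ-ring n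
(s ≐ t) ⟨ p ⟩ = substTerm p s ≐ substTerm p t
(neg φ) ⟨ p ⟩ = neg (φ ⟨ p ⟩)
(φ ∧ ψ) ⟨ p ⟩ = (φ ⟨ p ⟩) ∧ (ψ ⟨ p ⟩)
(φ ∨ ψ) ⟨ p ⟩ = (φ ⟨ p ⟩) ∨ (ψ ⟨ p ⟩)
(ex φ)  ⟨ p ⟩ = ex (φ ⟨ p ⟩)
(all φ) ⟨ p ⟩ = all (φ ⟨ p ⟩)

-- Structures carry their own equality ≈, which interprets ≐.  No axioms are
-- imposed on ≈: its being a congruence is first-order, hence inherited by
-- ultraproducts of fields and by their elementary extensions.

UnaryOp : Language → Set → Set
UnaryOp ℒ-ring X = ⊤
UnaryOp ℒσ X = X → X

record Structure (L : Language) : Set₁ where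
  field
    rawRing : RawRing 0ℓ 0ℓ
  open RawRing rawRing public
  open RawSemiringDefs rawSemiring public using (_^_)
  field
    unary : UnaryOp L Carrier

open Structure using () renaming (Carrier to Dom)

eval : ∀ {L C n} (S : Structure L) → (C → Dom S) → Vec (Dom S) n →
       Term C L n → Dom S
eval S ι v (var i) = lookup v i
eval S ι v (con c) = ι c
eval S ι v 𝟘       = Structure.0# S
eval S ι v 𝟙       = Structure.1# S
eval S ι v (s ⊕ t) = Structure._+_ S (eval S ι v s) (eval S ι v t)
eval S ι v (s ⊗ t) = Structure._*_ S (eval S ι v s) (eval S ι v t)
eval S ι v (⊝ t)   = Structure.-_ S (eval S ι v t)
eval S ι v (σ t)   = Structure.unary S (eval S ι v t)

Sat : ∀ {L C n} (S : Structure L) → (C → Dom S) →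
      Formula C L n → Vec (Dom S) n → Set
Sat S ι (s ≐ t) v = Structure._≈_ S (eval S ι v s) (eval S ι v t)
Sat S ι (neg φ) v = ¬ Sat S ι φ v
Sat S ι (φ ∧ ψ) v = Sat S ι φ v × Sat S ι ψ v
Sat S ι (φ ∨ ψ) v = Sat S ι φ v ⊎ Sat S ι ψ v
Sat S ι (ex φ)  v = Σ[ a ∈ Dom S ] Sat S ι φ (a ∷ v)
Sat S ι (all φ) v = (a : Dom S) → Sat S ι φ (a ∷ v)

noParams : {X : Set} → ⊥ → X
noParams ()

PartialType : Set → ℕ → Set₁
PartialType C n = Pred (Formula C ℒσ n) 0ℓ

module _ {C : Set} (S : Structure ℒσ) (ι : C → Dom S) where

  _Realizes_ : ∀ {n} → Vec (Dom S) n → PartialType C n → Set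
  v Realizes π = ∀ φ → π φ → Sat S ι φ v

  FinitelySatisfiable : ∀ {n} → PartialType C n → Set
  FinitelySatisfiable π =
    ∀ Φ → All π Φ → ∃[ v ] All (λ φ → Sat S ι φ v) Φ

  -- π entails φ modulo the elementary diagram of S, i.e. some finite part of π
  -- does; φ may have parameters anywhere in S.
  _⊫_ : ∀ {n} → PartialType C n → Formula (Dom S) ℒσ n → Set
  π ⊫ φ = ∃[ Φ ] (All π Φ ×
    (∀ v → All (λ θ → Sat S ι θ v) Φ → Sat S (λ a → a) φ v))

  record IsCompleteQFType {n} (r : PartialType C n) : Set where
    field
      quantifierFree : ∀ φ → r φ → QuantifierFree φ
      complete       : ∀ φ → QuantifierFree φ → r φ ⊎ r (neg φ)
      consistent     : FinitelySatisfiable r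

-- ∃y r(x,y), where y is the tuple of the first m variables.
∃y : ∀ {C} m {n} → PartialType C (m ℕ.+ n) → PartialType C n
∃y m r φ = ∃[ Φ ] (All r Φ × (φ ≡ ex^ m (⋀ Φ)))

HasCard : (S : Setoid 0ℓ 0ℓ) → Pred (Setoid.Carrier S) 0ℓ → ℕ → Set
HasCard S P N = Σ[ xs ∈ List (Setoid.Carrier S) ]
  (List.length xs ≡ N × SetoidUnique.Unique S xs × All P xs ×
   (∀ x → P x → SetoidMembership._∈_ S x xs))

record Field : Set₁ where
  field
    commutativeRing : CommutativeRing 0ℓ 0ℓ
  open CommutativeRing commutativeRing public
  open RawSemiringDefs (RawRing.rawSemiring rawRing) public
    using (_^_) renaming (_×_ to _×ₙ_)
  field
    0≉1     : ¬ (0# ≈ 1#)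
    inverse : ∀ x → ¬ (x ≈ 0#) → ∃[ y ] ((x * y) ≈ 1#)

  ringStructure : Structure ℒ-ring
  ringStructure = record { rawRing = rawRing ; unary = tt }

  Frob : ℕ → Structure ℒσ
  Frob p = record { rawRing = rawRing ; unary = λ x → x ^ p }

  tuples : ℕ → Setoid 0ℓ 0ℓ
  tuples = Pointwise.setoid setoid

  -- The monic polynomial X^d + c_{d-1} X^{d-1} + … + c_0.
  monic : List Carrier → Carrier → Carrier
  monic cs x = List.foldr (λ c v → c + x * v) 1# cs

record FiniteField : Set₁ where
  field
    fld    : Field
    q      : ℕ
    isSize : HasCard (Field.setoid fld) (λ _ → ⊤) q
  open Field fld public

record AlgebraicClosureOf𝔽 (p : ℕ) : Set₁ where
  field
    fld : Field
  open Field fld public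
  field
    characteristic : (p ×ₙ 1#) ≈ 0#
    algClosed      : ∀ c cs → ∃[ x ] (monic (c ∷ cs) x ≈ 0#)
    algebraic      : ∀ x → ∃[ cs ] (monic (List.map (_×ₙ 1#) cs) x ≈ 0#)

-- A choice of the constants C_ψ and D_ψ in the theorem of Chatzidakis, van den
-- Dries and Macintyre on definable sets in finite fields.
record CountingConstants (𝓡 : Reals) : Set₁ where
  open Reals 𝓡
  qᴿ : FiniteField → ℝ
  qᴿ K = fromℕ (FiniteField.q K)
  field
    C    : ∀ n m → Formula ⊥ ℒ-ring (n ℕ.+ m) → ℝ
    D    : ∀ n m → Formula ⊥ ℒ-ring (n ℕ.+ m) → List (Fin (suc n) × ℝ)
    C-pos : ∀ n m ψ → 0# < C n m ψ
    D-pos : ∀ n m ψ {d μ} → (d , μ) ∈ D n m ψ → 0# < μ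
    estimate : ∀ n m ψ (K : FiniteField) (a : Vec (FiniteField.Carrier K) m) N →
      HasCard (FiniteField.tuples K n)
              (λ v → Sat (FiniteField.ringStructure K) noParams ψ (v ++ a)) N →
      N ≢ 0 →
      ∃[ d ] ∃[ μ ] ((d , μ) ∈ D n m ψ ×
        (∣ fromℕ N - μ * qᴿ K ^ toℕ d ∣≤ (C n m ψ * (qᴿ K ^ toℕ d ÷ √ qᴿ K))))

-- The primality proof is irrelevant, so a prime is a single point of ℙ.
ℙ : Set
ℙ = Refinement ℕ Prime

record NonPrincipalUltrafilter : Set₁ where
  field
    Large        : Pred ℙ 0ℓ → Set
    large-⊤      : Large (λ _ → ⊤)
    large-⊥      : ¬ Large (λ _ → ⊥)
    large-∩      : ∀ {P Q} → Large P → Large Q → Large (P ∩ Q)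
    large-⊆      : ∀ {P Q : Pred ℙ 0ℓ} → (∀ p → P p → Q p) → Large P → Large Q
    ultra        : ∀ P → Large P ⊎ Large (∁ P)
    nonPrincipal : ∀ p → ¬ Large (_≡ p)

ultraproduct : NonPrincipalUltrafilter → (ℙ → Structure ℒσ) → Structure ℒσ
ultraproduct U S = record
  { rawRing = record
    { Carrier = ∀ p → Dom (S p)
    ; _≈_ = λ x y → Large (λ p → Structure._≈_ (S p) (x p) (y p))
    ; _+_ = λ x y p → Structure._+_ (S p) (x p) (y p)
    ; _*_ = λ x y p → Structure._*_ (S p) (x p) (y p)
    ; -_  = λ x p → Structure.-_ (S p) (x p)
    ; 0#  = λ p → Structure.0# (S p)
    ; 1#  = λ p → Structure.1# (S p)
    }
  ; unary = λ x p → Structure.unary (S p) (x p)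
  }
  where open NonPrincipalUltrafilter U

module _ (𝓡 : Reals) (cdm : CountingConstants 𝓡) where
  open Reals 𝓡
  open CountingConstants cdm

  -- N^p_φ ≤ K, for φ = φ(x,y) with |x| = n and |y| = m.
  N^_⟨_,_,_⟩≤_ : ℕ → ∀ n m → Formula ⊥ ℒσ (n ℕ.+ m) → ℝ → Set
  N^ p ⟨ n , m , φ ⟩≤ K = ∀ {d μ} → (d , μ) ∈ D n m (φ ⟨ p ⟩) →
    μ ≤ K × μ ⁻¹ ≤ K ×
    (fromℕ 2 * (log (fromℕ 2 * C n m (φ ⟨ p ⟩) ÷ μ) ÷ log (fromℕ p))) ≤ K

  -- f(ℓ,p) ≤ K
  f⟨_,_⟩≤_ : ℕ → ℕ → ℝ → Set
  f⟨ ℓ , p ⟩≤ K = ∀ n m φ → len n m φ ℕ.≤ ℓ → N^ p ⟨ n , m , φ ⟩≤ K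

  -- A member of the class 𝒮, presented together with the fields 𝔽_{p^k_p}, the
  -- algebraic closures 𝔽̃_p, and embeddings of the former into the latter.
  record 𝒮 : Set₁ where
    field
      U     : NonPrincipalUltrafilter
      k     : ℙ → ℕ
      𝔽     : ℙ → FiniteField
      𝔽̃     : ∀ p → AlgebraicClosureOf𝔽 (value p)
      size𝔽 : ∀ p → FiniteField.q (𝔽 p) ≡ value p ℕ.^ k p
      emb   : ∀ p → FiniteField.Carrier (𝔽 p) → AlgebraicClosureOf𝔽.Carrier (𝔽̃ p)
      emb-mono : ∀ p → IsRingMonomorphism (FiniteField.rawRing (𝔽 p))
                                          (AlgebraicClosureOf𝔽.rawRing (𝔽̃ p)) (emb p)
      k-large  : ∀ p → f⟨ value p , value p ⟩≤ fromℕ (k p)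

    open NonPrincipalUltrafilter U public

    factor : ℙ → Structure ℒσ
    factor p = FiniteField.Frob (𝔽 p) (value p)

    F : Structure ℒσ
    F = ultraproduct U factor

    F̃ : Structure ℒσ
    F̃ = ultraproduct U (λ p → AlgebraicClosureOf𝔽.Frob (𝔽̃ p) (value p))

    inclusion : Dom F → Dom F̃
    inclusion a p = emb p (a p)

    -- The nonstandard cardinality of φ(Fⁿ) is the class of N in ℕ^ℙ/U.
    HasNonstandardCard : ∀ {n} → Formula (Dom F) ℒσ n → (ℙ → ℕ) → Set
    HasNonstandardCard {n} φ N =
      ∀ p → HasCard (FiniteField.tuples (𝔽 p) n)
                    (Sat (factor p) (λ c → c p) φ) (N p)

    -- r is the standard part of the class of x in ℝ^ℙ/U.
    IsStandardPart : (ℙ → ℝ) → ℝ → Set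
    IsStandardPart x r = ∀ ε → 0# < ε → Large (λ p → ∣ x p - r ∣≤ ε)

    IsδFormula : ∀ {n} → Formula (Dom F) ℒσ n → ℝ₋∞ → Set
    IsδFormula φ -∞      = ∃[ N ] (HasNonstandardCard φ N × Large (λ p → N p ≡ 0))
    IsδFormula φ (fin r) = ∃[ N ] (HasNonstandardCard φ N × Large (λ p → N p ≢ 0) ×
      IsStandardPart (λ p → log (fromℕ (N p)) ÷ log (fromℕ (FiniteField.q (𝔽 p)))) r)

    Isδ : ∀ {C n} → (C → Dom F) → PartialType C n → ℝ₋∞ → Set
    Isδ ι π = IsInf (λ d → ∃[ φ ] (_⊫_ F ι π φ × IsδFormula φ d))

-- The difference subfield generated by the range of g.  Closing under σ⁻¹ as
-- well would not affect transformal independence: apply a power of σ to an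
-- annihilating polynomial.
data Generated (S : Structure ℒσ) {X : Set} (g : X → Dom S) :
    Dom S → Set where
  gen  : ∀ x → Generated S g (g x)
  zero : Generated S g (Structure.0# S)
  one  : Generated S g (Structure.1# S)
  add  : ∀ {a b} → Generated S g a → Generated S g b →
         Generated S g (Structure._+_ S a b)
  mul  : ∀ {a b} → Generated S g a → Generated S g b →
         Generated S g (Structure._*_ S a b)
  neg  : ∀ {a} → Generated S g a → Generated S g (Structure.-_ S a)
  inv  : ∀ {a b} → Generated S g a →
         Structure._≈_ S (Structure._*_ S a b) (Structure.1# S) → Generated S g b
  app  : ∀ {a} → Generated S g a → Generated S g (Structure.unary S a)
  resp : ∀ {a b} → Generated S g a → Structure._≈_ S a b → Generated S g b

module _ (S : Structure ℒσ) where
  open Structure S hiding (Carrier)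

  -- A difference monomial ∏ᵢ ∏_{j<N} σʲ(Xᵢ)^eᵢⱼ is its exponent matrix e.
  Monomial : ℕ → ℕ → Set
  Monomial l N = Vec (Vec ℕ N) l

  evalMonomial : ∀ {l N} → Vec (Dom S) l → Monomial l N → Dom S
  evalMonomial {N = N} a e = product (Vec.zipWith
    (λ x es → product (Vec.zipWith _^_ (Vec.iterate unary x N) es)) a e)
    where
    product : ∀ {n} → Vec (Dom S) n → Dom S
    product = Vec.foldr′ _*_ 1#

  evalPolynomial : ∀ {l N} → Vec (Dom S) l → List (Dom S × Monomial l N) → Dom S
  evalPolynomial a = List.foldr (λ (c , e) s → c * evalMonomial a e + s) 0#

  -- A difference polynomial is a list of terms with pairwise distinct monomials,
  -- so it is nonzero exactly when some coefficient is.
  TransformallyIndependent : Pred (Dom S) 0ℓ → ∀ {l} → Vec (Dom S) l → Set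
  TransformallyIndependent E {l} a =
    ∀ N (P : List (Dom S × Monomial l N)) → Unique (List.map proj₂ P) →
    All (E ∘ proj₁) P → Any (λ t → ¬ (proj₁ t ≈ 0#)) P →
    ¬ (evalPolynomial a P ≈ 0#)

  -- The index vector may repeat entries, but then the subtuple is dependent.
  IsTransformalTrdeg : Pred (Dom S) 0ℓ → ∀ {n} → Vec (Dom S) n → ℕ → Set
  IsTransformalTrdeg E {n} a d =
    (Σ[ i ∈ Vec (Fin n) d ] TransformallyIndependent E (Vec.map (lookup a) i)) ×
    (∀ l (i : Vec (Fin n) l) →
       TransformallyIndependent E (Vec.map (lookup a) i) → l ℕ.≤ d)

  IsDimRk : ∀ {C n} → (C → Dom S) → PartialType C n → ℕ → Set
  IsDimRk {n = n} ι π d =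
    (Σ[ a ∈ Vec (Dom S) n ]
      ((_Realizes_ S ι a π) × IsTransformalTrdeg (Generated S ι) a d)) ×
    (∀ (a : Vec (Dom S) n) e → _Realizes_ S ι a π →
       IsTransformalTrdeg (Generated S ι) a e → e ℕ.≤ d)

-- An |S|⁺-saturated elementary extension of S: the range of b is an arbitrary
-- parameter set of size at most |S|.
record SaturatedExtension (S : Structure ℒσ) : Set₁ where
  field
    M          : Structure ℒσ
    j          : Dom S → Dom M
    elementary : ∀ {n} (φ : Formula ⊥ ℒσ n) v →
                 Sat S noParams φ v ⇔ Sat M noParams φ (Vec.map j v)
    saturated  : ∀ (b : Dom S → Dom M) {n} (π : PartialType (Dom S) n) →
                 FinitelySatisfiable M b π → ∃[ v ] (_Realizes_ M b v π)

module _ {𝓡 : Reals} {cdm : CountingConstants 𝓡} (𝓕 : 𝒮 𝓡 cdm) where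
  open 𝒮 𝓕 using (F; F̃; inclusion; Isδ)
  open Reals 𝓡 using (fin; fromℕ)

  Subset : Set₁
  Subset = Pred (Dom F) 0ℓ

  Countable : Subset → Set
  Countable A = Σ[ e ∈ (ℕ → Dom F) ]
    (∀ a → A a → ∃[ i ] Structure._≈_ F (e i) a)

  TypeOver : Subset → ℕ → Set₁
  TypeOver A = PartialType (∃ A)

  IsCompleteQFTypeOver : (A : Subset) → ∀ {n} → TypeOver A n → Set
  IsCompleteQFTypeOver A = IsCompleteQFType F proj₁

  -- δ_F(π) = dim_rk(π): the two invariants exist and agree, where dim_rk may be
  -- computed in any saturated extension of F̃.
  δ≡dimRk : (A : Subset) → ∀ {n} → TypeOver A n → Set₁
  δ≡dimRk A π = (E : SaturatedExtension F̃) →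
    ∃[ d ] (IsDimRk (M E) (λ (a : ∃ A) → j E (inclusion (proj₁ a))) π d ×
            Isδ proj₁ π (fin (fromℕ d)))
    where open SaturatedExtension using (M; j)

-- Realize r by (b , a) in the saturated extension M.  Let a_K be a maximal independent subtuple
-- of a, of length d, and b_I one of b over A a_K, of length e.  Independence of a subtuple depends
-- only on its quantifier-free type, so d = dim_rk(∃y r) and e + d ≤ dim_rk(r).  Every other
-- coordinate satisfies a nontrivial difference equation over a_K, respectively over b_I a_K; in
-- 𝔽_q with σ = Frob_p it is a polynomial equation of degree < p^N, and p^N is q^o(1) since k_p → ∞:
-- the formula x = a₁ ∨ … ∨ x = aₙ forces measures ≥ n - 1, so f(p,p) is unbounded.
-- Counting over x_K gives a formula implied by ∃y r with at most q^(d+o(1)) points.  Conversely, let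
-- φ be implied by ∃y r, hence by ∃y T with T in r bounding the number of points over (y_I , x).  By
-- the conjecture for the restriction of r to the finitely many parameters of T, T has at least
-- q^(e+d-o(1)) points; at most q^(e+o(1)) of them lie over each x, so φ has at least q^(d-o(1)).

module Submission where

open import Defs
open import Level using (Lift; lift; 0ℓ) renaming (suc to lsuc)
open import Axiom.ExcludedMiddle using (ExcludedMiddle)
open import Algebra.Bundles using (CommutativeRing)
open import Algebra.Morphism.Structures using (IsRingMonomorphism)
import Algebra.Properties.Ring as Ringₚ
import Algebra.Properties.Semiring.Mult as Multₚ
import Algebra.Solver.Ring.NaturalCoefficients.Default as SemiringSolver
open import Algebra.Structures using (IsCommutativeRing)
open import Data.Empty using (⊥; ⊥-elim)
open import Data.Fin.Base as Fin using (Fin; zero; suc; toℕ; _↑ˡ_; _↑ʳ_)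
import Data.Fin.Properties as Finₚ
open import Data.List.Base as List using (List; []; _∷_; length)
open import Data.List.Membership.Propositional using (_∈_; find; lose)
open import Data.List.Membership.Propositional.Properties using (∈-lookup)
import Data.List.Membership.Setoid as SetoidMembership
import Data.List.Membership.Setoid.Properties as Membershipₚ
import Data.List.Properties as Listₚ
open import Data.List.Relation.Unary.All as All using (All; []; _∷_)
import Data.List.Relation.Unary.All.Properties as Allₚ
open import Data.List.Relation.Unary.AllPairs using ([]; _∷_)
open import Data.List.Relation.Unary.Any as Any using (Any; here; there)
import Data.List.Relation.Unary.Any.Properties as Anyₚ
import Data.List.Relation.Unary.Unique.DecSetoid.Properties as UniqueDec
open import Data.List.Relation.Unary.Unique.Propositional using () renaming (Unique to Unique≡)
import Data.List.Relation.Unary.Unique.Setoid as SetoidUnique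
import Data.List.Relation.Unary.Unique.Setoid.Properties as Uniqueₚ
open import Data.Nat.Base as ℕ using (ℕ; zero; suc; z≤n; s≤s; NonZero)
import Data.Nat.DivMod as DivMod
import Data.Nat.Properties as ℕₚ
open import Data.Product.Base as Product using (Σ-syntax; ∃; ∃-syntax; _×_; _,_; proj₁; proj₂; map₁)
open import Data.Refinement.Base using (value)
open import Data.Refinement.Properties using (value-injective)
open import Data.Sum.Base as Sum using (_⊎_; inj₁; inj₂)
open import Data.Unit.Base using (⊤; tt)
open import Data.Vec.Base as Vec using (Vec; []; _∷_; _++_; lookup)
import Data.Vec.Properties as Vecₚ
open import Data.Vec.Relation.Binary.Pointwise.Inductive as Pointwise using (Pointwise; []; _∷_)
open import Data.Vec.Relation.Unary.All as VecAll using ([]; _∷_)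
open import Function.Base using (_∘_; id)
open import Function.Bundles using (_⇔_; mk⇔; Equivalence)
open import Relation.Binary.Bundles using (DecSetoid; Poset; Setoid)
open import Relation.Binary.PropositionalEquality as ≡ using (_≡_; _≢_)
import Relation.Binary.Reasoning.PartialOrder as PosetReasoning
import Relation.Binary.Reasoning.Setoid as SetoidReasoning
open import Relation.Binary.Structures using (IsTotalOrder)
open import Relation.Nullary using (¬_; Dec; yes; no)
open import Relation.Unary using (Pred; ∁)
open Equivalence using (to; from)
open Structure using () renaming (Carrier to Dom)

-- The conjecture speaks of quantifier-free types over countable sets, whereas `∃y r` has
-- quantifiers and A is arbitrary. Counting removes the quantifiers: passing from T to φ costs at
-- most e in the exponent. Cutting A down to the parameters of T is harmless because a smaller set
-- only makes more subtuples independent, so e + d stays a lower bound for the rank. The rank is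
-- read in an extension of F̃ and the count takes place in 𝔽_q. The link is that a dependence, once
-- denominators are cleared, is a quantifier-free formula over the parameters and so belongs to r.
-- The bound p^N comes from σ^j(x) = x^(p^j): a monomial in x, σ(x), ..., σ^(N-1)(x) becomes the
-- power of x whose base-p digits are its exponents. For p above all exponents of a fixed
-- polynomial, distinct monomials give distinct powers, so a nonvanishing coefficient survives. That
-- f(p,p) is unbounded rests on the test formula containing no σ: it is its own φ_p, so its
-- constants do not vary with p, and p exceeds its length for almost all p.

LEM : Set₁
LEM = {P : Set} → Dec P

lowerLEM : ExcludedMiddle (lsuc 0ℓ) → LEM
lowerLEM em {P} with em {Lift (lsuc 0ℓ) P}
... | yes p = yes (Lift.lower p)
... | no ¬p = no (λ p → ¬p (lift p))

-- Excluded middle and lists without repetition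

module Classical (em : LEM) where

  byContradiction : {P : Set} → ¬ ¬ P → P
  byContradiction {P} ¬¬p with em {P}
  ... | yes p = p
  ... | no ¬p = ⊥-elim (¬¬p ¬p)

  maximum : (P : ℕ → Set) → P 0 → ∀ B → (∀ l → P l → l ℕ.≤ B) →
            ∃[ d ] (P d × (∀ l → P l → l ℕ.≤ d))
  maximum P P0 zero    bound = 0 , P0 , bound
  maximum P P0 (suc B) bound with em {P (suc B)}
  ... | yes PB = suc B , PB , bound
  ... | no ¬PB = maximum P P0 B λ l Pl →
    ℕ.s≤s⁻¹ (ℕₚ.≤∧≢⇒< (bound l Pl) λ { ≡.refl → ¬PB Pl })

module Listings (S : Setoid 0ℓ 0ℓ) where
  open Setoid S using (_≈_) renaming (sym to ≈-sym; trans to ≈-trans)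
  open SetoidUnique S using (Unique)
  open SetoidMembership S using () renaming (_∈_ to _∈ₛ_)

  Unique-lookup-injective : ∀ {xs} → Unique xs → ∀ i j →
    List.lookup xs i ≈ List.lookup xs j → i ≡ j
  Unique-lookup-injective (_ ∷ _)  zero    zero    _  = ≡.refl
  Unique-lookup-injective (x∉ ∷ _) zero    (suc j) eq =
    ⊥-elim (All.lookup x∉ (∈-lookup j) eq)
  Unique-lookup-injective (x∉ ∷ _) (suc i) zero    eq =
    ⊥-elim (All.lookup x∉ (∈-lookup i) (≈-sym eq))
  Unique-lookup-injective (_ ∷ u)  (suc i) (suc j) eq =
    ≡.cong suc (Unique-lookup-injective u i j eq)

  -- Pigeonhole: sending a position of `xs` to a position of `ys` with an equal entry is injective.
  Unique∧⊆⇒length≤ : ∀ {xs ys} → Unique xs → All (_∈ₛ ys) xs → length xs ℕ.≤ length ys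
  Unique∧⊆⇒length≤ {xs} {ys} u xs⊆ys = Finₚ.injective⇒≤ {f = f} λ {i} {j} fi≡fj →
    Unique-lookup-injective u i j (≈-trans (lookup-f i)
      (≡.subst (λ k → List.lookup ys k ≈ List.lookup xs j) (≡.sym fi≡fj) (≈-sym (lookup-f j))))
    where
    member : ∀ i → List.lookup xs i ∈ₛ ys
    member i = All.lookup xs⊆ys (∈-lookup i)
    f : Fin (length xs) → Fin (length ys)
    f i = Any.index (member i)
    lookup-f : ∀ i → List.lookup xs i ≈ List.lookup ys (f i)
    lookup-f i = Anyₚ.lookup-index (member i)

-- Coverings of subsets of a setoid by finite lists

-- The list may repeat entries and leave `P`, so upper bounds compose along maps and fibers without
-- any counting of duplicates; `card≤cover` turns them into bounds on cardinalities.
Cover : (S : Setoid 0ℓ 0ℓ) → Pred (Setoid.Carrier S) 0ℓ → ℕ → Set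
Cover S P B = ∃[ xs ] (length xs ℕ.≤ B × (∀ x → P x → SetoidMembership._∈_ S x xs))

Respectful : (S : Setoid 0ℓ 0ℓ) → Pred (Setoid.Carrier S) 0ℓ → Set
Respectful S P = ∀ {x y} → Setoid._≈_ S x y → P x → P y

HasCard⇒Cover : ∀ {S P N} → HasCard S P N → Cover S P N
HasCard⇒Cover (xs , len , _ , _ , listed) = xs , ℕₚ.≤-reflexive len , listed

card≤cover : ∀ {S P N B} → HasCard S P N → Cover S P B → N ℕ.≤ B
card≤cover {S} (xs , ≡.refl , u , Pxs , _) (ys , len , ⊆ys) =
  ℕₚ.≤-trans (Listings.Unique∧⊆⇒length≤ S u (All.map (λ {x} → ⊆ys x) Pxs)) len

cover-⊆ : ∀ {S P Q B} → (∀ x → P x → Q x) → Cover S Q B → Cover S P B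
cover-⊆ P⊆Q (xs , len , listed) = xs , len , λ x Px → listed x (P⊆Q x Px)

cover-≤ : ∀ {S P B B′} → B ℕ.≤ B′ → Cover S P B → Cover S P B′
cover-≤ B≤B′ (xs , len , listed) = xs , ℕₚ.≤-trans len B≤B′ , listed

length-concatMap-≤ : ∀ {A B : Set} (f : A → List B) b → (∀ x → length (f x) ℕ.≤ b) →
  ∀ xs → length (List.concatMap f xs) ℕ.≤ length xs ℕ.* b
length-concatMap-≤ f b bound []       = z≤n
length-concatMap-≤ f b bound (x ∷ xs) =
  ≡.subst (ℕ._≤ (b ℕ.+ length xs ℕ.* b)) (≡.sym (Listₚ.length-++ (f x)))
    (ℕₚ.+-mono-≤ (bound x) (length-concatMap-≤ f b bound xs))

-- The list covering `Q` contains v only up to ≈, so z has to lie in the fiber over every v′ ≈ v.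
cover-fibers : ∀ {S T : Setoid 0ℓ 0ℓ} {Q R A B} {P : Setoid.Carrier S → Pred (Setoid.Carrier T) 0ℓ} →
  Cover S Q A → (∀ v → Cover T (P v) B) →
  (∀ z → R z → ∃[ v ] (Q v × (∀ v′ → Setoid._≈_ S v v′ → P v′ z))) →
  Cover T R (A ℕ.* B)
cover-fibers {A = A} {B} (xs , len , listed) fibers split =
  List.concatMap (λ v → proj₁ (fibers v)) xs ,
  ℕₚ.≤-trans (length-concatMap-≤ _ B (λ v → proj₁ (proj₂ (fibers v))) xs) (ℕₚ.*-monoˡ-≤ B len) ,
  λ z Rz → let v , Qv , Pz = split z Rz in
    Anyₚ.concatMap⁺ _ (Any.map (λ {v′} v≈v′ → proj₂ (proj₂ (fibers v′)) z (Pz v′ v≈v′)) (listed v Qv))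

cover-map : ∀ {S T : Setoid 0ℓ 0ℓ} {P B} (f : Setoid.Carrier S → Setoid.Carrier T) →
  (∀ {x y} → Setoid._≈_ S x y → Setoid._≈_ T (f x) (f y)) →
  Cover S P B → Cover T (λ z → ∃[ x ] (P x × Setoid._≈_ T z (f x))) B
cover-map {T = T} f f-cong (xs , len , listed) =
  List.map f xs , ≡.subst (ℕ._≤ _) (≡.sym (Listₚ.length-map f xs)) len ,
  λ { z (x , Px , z≈fx) → Anyₚ.map⁺ (Any.map (λ x≈ → Setoid.trans T z≈fx (f-cong x≈)) (listed x Px)) }

cover-vec : ∀ {S : Setoid 0ℓ 0ℓ} {B} n {P : Fin n → Pred (Setoid.Carrier S) 0ℓ} →
  (∀ j → Cover S (P j) B) →
  Cover (Pointwise.setoid S n) (λ v → ∀ j → P j (lookup v j)) (B ℕ.^ n)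
cover-vec zero    covers = List.[ [] ] , s≤s z≤n , λ { [] _ → here [] }
cover-vec {S} {B} (suc n) {P} covers =
  cover-fibers {S} {Pointwise.setoid S (suc n)} (covers zero)
    (λ x → cover-map {Pointwise.setoid S n} {Pointwise.setoid S (suc n)}
             {P = λ v → ∀ j → P (suc j) (lookup v j)}
             (x ∷_) (Setoid.refl S ∷_) (cover-vec {S} n (covers ∘ suc)))
    λ { (x ∷ v) Pv → x , Pv zero , λ x′ x≈x′ →
          v , Pv ∘ suc , x≈x′ ∷ Pointwise.refl (Setoid.refl S) }

module FiniteSets (em : LEM) where

  -- By excluded middle equality and `P` are decidable, so a list of everything can be deduplicated
  -- and filtered.
  hasCard : ∀ {S : Setoid 0ℓ 0ℓ} {P : Pred (Setoid.Carrier S) 0ℓ} {A} →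
    Respectful S P → Cover S (λ _ → ⊤) A → ∃[ N ] HasCard S P N
  hasCard {S} {P} P-resp (xs , _ , listed) =
    length zs , zs , ≡.refl , Uniqueₚ.filter⁺ S P? (UniqueDec.deduplicate-! DS xs) ,
    Allₚ.all-filter P? ys ,
    λ x Px → Membershipₚ.∈-filter⁺ S P? P-resp
      (Membershipₚ.∈-deduplicate⁺ S _≟_ (λ c≈b c≈a → Setoid.trans S c≈a (Setoid.sym S c≈b)) (listed x tt)) Px
    where
    DS : DecSetoid 0ℓ 0ℓ
    DS = record { isDecEquivalence = record
      { isEquivalence = Setoid.isEquivalence S ; _≟_ = λ _ _ → em } }
    open DecSetoid DS using (_≟_)
    P? : ∀ x → Dec (P x)
    P? x = em
    ys = List.deduplicate _≟_ xs
    zs = List.filter P? ys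

  -- Suited to roots of polynomials, where division by X - r bounds the length of any list of
  -- distinct roots.
  cover-byUnique : ∀ {S : Setoid 0ℓ 0ℓ} {P : Pred (Setoid.Carrier S) 0ℓ} {B A} →
    Respectful S P → Cover S (λ _ → ⊤) A →
    (∀ xs → SetoidUnique.Unique S xs → All P xs → length xs ℕ.≤ B) → Cover S P B
  cover-byUnique {S} P-resp cover bound with hasCard {S} P-resp cover
  ... | N , zs , len , u , Pzs , listed = zs , bound zs u Pzs , listed

-- Roots of polynomials over a field

module RootBound (K : Field) where
  open Field K
  open SetoidReasoning setoid
  open SemiringSolver commutativeSemiring using (solve; _:+_; _:*_; _:=_)
  open SetoidUnique setoid using (Unique)
  open Ringₚ ring using (x∙y⁻¹≈ε⇒x≈y; -‿distribˡ-*)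

  *-cancel-≉0 : ∀ {x y} → ¬ (x ≈ 0#) → (x * y) ≈ 0# → y ≈ 0#
  *-cancel-≉0 {x} {y} x≉0 xy≈0 = begin
    y            ≈⟨ *-identityˡ y ⟨
    1# * y       ≈⟨ *-congʳ (proj₂ (inverse x x≉0)) ⟨
    (x * z) * y  ≈⟨ solve 3 (λ x y z → (x :* z) :* y := z :* (x :* y)) refl x y z ⟩
    z * (x * y)  ≈⟨ *-congˡ xy≈0 ⟩
    z * 0#       ≈⟨ zeroʳ z ⟩
    0#           ∎
    where z = proj₁ (inverse x x≉0)

  -- Horner's scheme, constant coefficient first.
  dense : List Carrier → Carrier → Carrier
  dense cs x = List.foldr (λ c v → c + x * v) 0# cs

  -- Synthetic division: quotient r cs is the quotient of c ∷ cs by X - r, for any c.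
  quotient : Carrier → List Carrier → List Carrier
  quotient r []       = []
  quotient r (c ∷ cs) = dense (c ∷ cs) r ∷ quotient r cs

  length-quotient : ∀ r cs → length (quotient r cs) ≡ length cs
  length-quotient r []       = ≡.refl
  length-quotient r (c ∷ cs) = ≡.cong suc (length-quotient r cs)

  -- This is p(x) - p(r) = (x - r) q(x), rearranged without subtraction so that it can be handled by
  -- the semiring solver.
  dense-quotient : ∀ r c cs x →
    (dense (c ∷ cs) x + r * dense (quotient r cs) x) ≈
    (dense (c ∷ cs) r + x * dense (quotient r cs) x)
  dense-quotient r c [] x =
    solve 4 (λ c x r o → (c :+ x :* o) :+ r :* o := (c :+ r :* o) :+ x :* o) refl c x r 0#
  dense-quotient r c (c′ ∷ cs) x = begin
    (c + x * px) + r * (pr + x * q)  ≈⟨ solve 6 (λ c x px r pr q →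
      (c :+ x :* px) :+ r :* (pr :+ x :* q) := (c :+ x :* (px :+ r :* q)) :+ r :* pr) refl c x px r pr q ⟩
    (c + x * (px + r * q)) + r * pr  ≈⟨ +-congʳ (+-congˡ (*-congˡ (dense-quotient r c′ cs x))) ⟩
    (c + x * (pr + x * q)) + r * pr  ≈⟨ solve 5 (λ c x r pr q →
      (c :+ x :* (pr :+ x :* q)) :+ r :* pr := (c :+ r :* pr) :+ x :* (pr :+ x :* q)) refl c x r pr q ⟩
    (c + r * pr) + x * (pr + x * q)  ∎
    where
    px = dense (c′ ∷ cs) x
    pr = dense (c′ ∷ cs) r
    q  = dense (quotient r cs) x

  root-quotient : ∀ {r x} c cs → ¬ (r ≈ x) →
    dense (c ∷ cs) r ≈ 0# → dense (c ∷ cs) x ≈ 0# → dense (quotient r cs) x ≈ 0#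
  root-quotient {r} {x} c cs r≉x pr≈0 px≈0 =
    *-cancel-≉0 (r≉x ∘ x∙y⁻¹≈ε⇒x≈y r x) (begin
      (r + - x) * q             ≈⟨ distribʳ q r (- x) ⟩
      r * q + - x * q           ≈⟨ +-congʳ (+-identityˡ (r * q)) ⟨
      (0# + r * q) + - x * q    ≈⟨ +-congʳ (+-congʳ px≈0) ⟨
      (dense (c ∷ cs) x + r * q) + - x * q ≈⟨ +-congʳ (dense-quotient r c cs x) ⟩
      (dense (c ∷ cs) r + x * q) + - x * q ≈⟨ +-congʳ (trans (+-congʳ pr≈0) (+-identityˡ (x * q))) ⟩
      x * q + - x * q           ≈⟨ +-congˡ (-‿distribˡ-* x q) ⟨
      x * q + - (x * q)         ≈⟨ -‿inverseʳ (x * q) ⟩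
      0#                        ∎)
    where q = dense (quotient r cs) x

  -- The first coefficient of the quotient is the value at r of the tail `cs`. If it is 0, then p(r)
  -- = 0 leaves c = 0, and the tail has r as a root again.
  quotient-zero : ∀ r c cs → dense (c ∷ cs) r ≈ 0# →
    All (_≈ 0#) (quotient r cs) → All (_≈ 0#) (c ∷ cs)
  quotient-zero r c [] pr≈0 _ =
    trans (sym (trans (+-congˡ (zeroʳ r)) (+-identityʳ c))) pr≈0 ∷ []
  quotient-zero r c (c′ ∷ cs) pr≈0 (qr≈0 ∷ q≈0) =
    (begin
      c                            ≈⟨ trans (+-congˡ (zeroʳ r)) (+-identityʳ c) ⟨
      c + r * 0#                   ≈⟨ +-congˡ (*-congˡ qr≈0) ⟨
      c + r * dense (c′ ∷ cs) r    ≈⟨ pr≈0 ⟩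
      0#                           ∎) ∷ quotient-zero r c′ cs qr≈0 q≈0

  -- Dividing off one root removes one coefficient, and the quotient still vanishes at the other
  -- roots.
  dense-zero : ∀ cs {rs} → Unique rs → All (λ r → dense cs r ≈ 0#) rs →
    length cs ℕ.≤ length rs → All (_≈ 0#) cs
  dense-zero []       _ _ _ = []
  dense-zero (c ∷ cs) {r ∷ rs} (r∉ ∷ u) (pr≈0 ∷ prs≈0) (s≤s len) =
    quotient-zero r c cs pr≈0 (dense-zero (quotient r cs) u
      (All.zipWith (λ (r≉x , px≈0) → root-quotient c cs r≉x pr≈0 px≈0) (r∉ , prs≈0))
      (≡.subst (ℕ._≤ length rs) (≡.sym (length-quotient r cs)) len))

  -- Exponents may repeat: specializing all variables but one of a difference polynomial makes
  -- different terms share a power. Hence `coefficient` adds up all terms with the given exponent.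
  sparse : List (Carrier × ℕ) → Carrier → Carrier
  sparse ts x = List.foldr (λ (c , e) s → c * x ^ e + s) 0# ts

  coefficient : ℕ → List (Carrier × ℕ) → Carrier
  coefficient k []             = 0#
  coefficient k ((c , e) ∷ ts) with e ℕₚ.≟ k
  ... | yes _ = c + coefficient k ts
  ... | no  _ = coefficient k ts

  private
    addAt : ℕ → Carrier → List Carrier → List Carrier
    addAt zero    c []       = c ∷ []
    addAt zero    c (d ∷ ds) = (c + d) ∷ ds
    addAt (suc e) c []       = 0# ∷ addAt e c []
    addAt (suc e) c (d ∷ ds) = d ∷ addAt e c ds

    nth : ℕ → List Carrier → Carrier
    nth _       []       = 0#
    nth zero    (c ∷ _)  = c
    nth (suc k) (_ ∷ cs) = nth k cs

    dense-addAt : ∀ e c ds x → dense (addAt e c ds) x ≈ (c * x ^ e + dense ds x)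
    dense-addAt zero c [] x = +-cong (sym (*-identityʳ c)) (zeroʳ x)
    dense-addAt zero c (d ∷ ds) x = trans (+-assoc c d _) (+-congʳ (sym (*-identityʳ c)))
    dense-addAt (suc e) c [] x = begin
      0# + x * dense (addAt e c []) x  ≈⟨ +-congˡ (*-congˡ (dense-addAt e c [] x)) ⟩
      0# + x * (c * x ^ e + 0#)        ≈⟨ +-identityˡ _ ⟩
      x * (c * x ^ e + 0#)             ≈⟨ *-congˡ (+-identityʳ _) ⟩
      x * (c * x ^ e)                  ≈⟨ solve 3 (λ x c y → x :* (c :* y) := c :* (x :* y)) refl x c (x ^ e) ⟩
      c * (x * x ^ e)                  ≈⟨ +-identityʳ _ ⟨
      c * (x * x ^ e) + 0#             ∎
    dense-addAt (suc e) c (d ∷ ds) x = begin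
      d + x * dense (addAt e c ds) x         ≈⟨ +-congˡ (*-congˡ (dense-addAt e c ds x)) ⟩
      d + x * (c * x ^ e + dense ds x)       ≈⟨ solve 5 (λ d x c y s →
        d :+ x :* (c :* y :+ s) := c :* (x :* y) :+ (d :+ x :* s)) refl d x c (x ^ e) (dense ds x) ⟩
      c * (x * x ^ e) + (d + x * dense ds x) ∎

    length-addAt : ∀ {B} e c ds → e ℕ.< B → length ds ℕ.≤ B → length (addAt e c ds) ℕ.≤ B
    length-addAt zero    c []       (s≤s e<B) len       = s≤s z≤n
    length-addAt zero    c (d ∷ ds) e<B       len       = len
    length-addAt (suc e) c []       (s≤s e<B) len       = s≤s (length-addAt e c [] e<B z≤n)
    length-addAt (suc e) c (d ∷ ds) (s≤s e<B) (s≤s len) = s≤s (length-addAt e c ds e<B len)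

    nth-addAt-≡ : ∀ e c ds → nth e (addAt e c ds) ≈ (c + nth e ds)
    nth-addAt-≡ zero    c []       = sym (+-identityʳ c)
    nth-addAt-≡ zero    c (d ∷ ds) = refl
    nth-addAt-≡ (suc e) c []       = trans (nth-addAt-≡ e c []) refl
    nth-addAt-≡ (suc e) c (d ∷ ds) = nth-addAt-≡ e c ds

    nth-addAt-≢ : ∀ e k c ds → ¬ (e ≡ k) → nth k (addAt e c ds) ≈ nth k ds
    nth-addAt-≢ zero    zero    c ds       e≢k = ⊥-elim (e≢k ≡.refl)
    nth-addAt-≢ zero    (suc k) c []       e≢k = refl
    nth-addAt-≢ zero    (suc k) c (d ∷ ds) e≢k = refl
    nth-addAt-≢ (suc e) zero    c []       e≢k = refl
    nth-addAt-≢ (suc e) zero    c (d ∷ ds) e≢k = refl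
    nth-addAt-≢ (suc e) (suc k) c []       e≢k = nth-addAt-≢ e k c [] (e≢k ∘ ≡.cong suc)
    nth-addAt-≢ (suc e) (suc k) c (d ∷ ds) e≢k = nth-addAt-≢ e k c ds (e≢k ∘ ≡.cong suc)

    toDense : List (Carrier × ℕ) → List Carrier
    toDense = List.foldr (λ (c , e) → addAt e c) []

    dense-toDense : ∀ ts x → dense (toDense ts) x ≈ sparse ts x
    dense-toDense []             x = refl
    dense-toDense ((c , e) ∷ ts) x =
      trans (dense-addAt e c (toDense ts) x) (+-congˡ (dense-toDense ts x))

    length-toDense : ∀ {B ts} → All (λ t → proj₂ t ℕ.< B) ts → length (toDense ts) ℕ.≤ B
    length-toDense []          = z≤n
    length-toDense (e<B ∷ es<B) = length-addAt _ _ _ e<B (length-toDense es<B)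

    nth-toDense : ∀ k ts → nth k (toDense ts) ≈ coefficient k ts
    nth-toDense k []             = refl
    nth-toDense k ((c , e) ∷ ts) with e ℕₚ.≟ k
    ... | yes ≡.refl = trans (nth-addAt-≡ e c (toDense ts)) (+-congˡ (nth-toDense e ts))
    ... | no  e≢k = trans (nth-addAt-≢ e k c (toDense ts) e≢k) (nth-toDense k ts)

    nth-zero : ∀ k {cs} → All (_≈ 0#) cs → nth k cs ≈ 0#
    nth-zero k       []           = refl
    nth-zero zero    (c≈0 ∷ _)    = c≈0
    nth-zero (suc k) (_ ∷ cs≈0)   = nth-zero k cs≈0

  sparse-roots : ∀ {B ts k rs} → All (λ t → proj₂ t ℕ.< B) ts → ¬ (coefficient k ts ≈ 0#) →
    Unique rs → All (λ r → sparse ts r ≈ 0#) rs → length rs ℕ.≤ B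
  sparse-roots {B} {ts} {k} {rs} es<B ck≉0 u roots with length (toDense ts) ℕₚ.≤? length rs
  ... | yes len = ⊥-elim (ck≉0 (trans (sym (nth-toDense k ts)) (nth-zero k
    (dense-zero (toDense ts) u (All.map (λ {r} eq → trans (dense-toDense ts r) eq) roots) len))))
  ... | no  len = ℕₚ.≤-trans (ℕₚ.<⇒≤ (ℕₚ.≰⇒> len)) (length-toDense es<B)

-- Difference polynomials and transformal dependence

-- The type `Monomial`, freed from the structure that it takes as an argument, so that one
-- polynomial can be evaluated in several structures.
Exponents : ℕ → ℕ → Set
Exponents l N = Vec (Vec ℕ N) l

wk : ∀ {C L n} → Term C L 0 → Term C L n
wk (con c) = con c
wk 𝟘       = 𝟘
wk 𝟙       = 𝟙
wk (s ⊕ t) = wk s ⊕ wk t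
wk (s ⊗ t) = wk s ⊗ wk t
wk (⊝ t)   = ⊝ wk t
wk (σ t)   = σ (wk t)

monomialTerm : ∀ {C k l N} → Vec (Term C ℒσ k) l → Exponents l N → Term C ℒσ k
monomialTerm {N = N} xs e = Vec.foldr′ _⊗_ 𝟙
  (Vec.zipWith (λ x es → Vec.foldr′ _⊗_ 𝟙 (Vec.zipWith _^ₜ_ (Vec.iterate σ x N) es)) xs e)

-- Coefficients are closed terms in the parameters: the same polynomial can be read in the saturated
-- extension and in every 𝔽_q.
DiffPoly : Set → ℕ → ℕ → Set
DiffPoly C l N = List (Term C ℒσ 0 × Exponents l N)

polynomialTerm : ∀ {C k l N} → Vec (Term C ℒσ k) l → DiffPoly C l N → Term C ℒσ k
polynomialTerm xs = List.foldr (λ (c , e) s → wk c ⊗ monomialTerm xs e ⊕ s) 𝟘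

-- The coefficient of X₀^f in a difference polynomial in X₀, X₁, …, Xₗ.
slice : ∀ {X : Set} {l N} → Vec ℕ N → List (X × Exponents (suc l) N) → List (X × Exponents l N)
slice f []                = []
slice f ((c , g ∷ e) ∷ P) with Vecₚ.≡-dec ℕₚ._≟_ g f
... | yes _ = (c , e) ∷ slice f P
... | no  _ = slice f P

module _ {X : Set} {l N : ℕ} where

  ∈-slice : ∀ {f c e} {P : List (X × Exponents (suc l) N)} →
    (c , f ∷ e) ∈ P → (c , e) ∈ slice f P
  ∈-slice {f} (here ≡.refl) with Vecₚ.≡-dec ℕₚ._≟_ f f
  ... | yes _   = here ≡.refl
  ... | no f≢f = ⊥-elim (f≢f ≡.refl)
  ∈-slice {f} {P = (_ , g ∷ _) ∷ _} (there c∈P) with Vecₚ.≡-dec ℕₚ._≟_ g f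
  ... | yes _ = there (∈-slice c∈P)
  ... | no  _ = ∈-slice c∈P

  slice-≢ : ∀ {f e} (P : List (X × Exponents (suc l) N)) →
    All (f ∷ e ≢_) (List.map proj₂ P) → All (e ≢_) (List.map proj₂ (slice f P))
  slice-≢     []                _           = []
  slice-≢ {f} ((_ , g ∷ _) ∷ P) (fe≢ ∷ fes≢) with Vecₚ.≡-dec ℕₚ._≟_ g f
  ... | yes ≡.refl = fe≢ ∘ ≡.cong (f ∷_) ∷ slice-≢ P fes≢
  ... | no  _      = slice-≢ P fes≢

  slice-unique : ∀ {f} (P : List (X × Exponents (suc l) N)) →
    Unique≡ (List.map proj₂ P) → Unique≡ (List.map proj₂ (slice f P))
  slice-unique     []                _        = []
  slice-unique {f} ((_ , g ∷ _) ∷ P) (fe≢ ∷ u) with Vecₚ.≡-dec ℕₚ._≟_ g f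
  ... | yes ≡.refl = slice-≢ P fe≢ ∷ slice-unique P u
  ... | no  _      = slice-unique P u

slice-map₁ : ∀ {X Y : Set} {l N} (h : X → Y) f (P : List (X × Exponents (suc l) N)) →
  slice f (List.map (map₁ h) P) ≡ List.map (map₁ h) (slice f P)
slice-map₁ h f []                = ≡.refl
slice-map₁ h f ((_ , g ∷ _) ∷ P) with Vecₚ.≡-dec ℕₚ._≟_ g f
... | yes _ = ≡.cong (_ ∷_) (slice-map₁ h f P)
... | no  _ = slice-map₁ h f P

module Evaluation (S : Structure ℒσ) {C : Set} (ι : C → Dom S) where
  open Structure S hiding (Carrier)

  value₀ : Term C ℒσ 0 → Dom S
  value₀ = eval S ι []

  coefficients : ∀ {l N} → DiffPoly C l N → List (Dom S × Exponents l N)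
  coefficients = List.map (map₁ value₀)

  eval-wk : ∀ {n} (v : Vec (Dom S) n) t → eval S ι v (wk t) ≡ value₀ t
  eval-wk v (con c) = ≡.refl
  eval-wk v 𝟘       = ≡.refl
  eval-wk v 𝟙       = ≡.refl
  eval-wk v (s ⊕ t) = ≡.cong₂ _+_ (eval-wk v s) (eval-wk v t)
  eval-wk v (s ⊗ t) = ≡.cong₂ _*_ (eval-wk v s) (eval-wk v t)
  eval-wk v (⊝ t)   = ≡.cong -_ (eval-wk v t)
  eval-wk v (σ t)   = ≡.cong unary (eval-wk v t)

  module _ {k} (v : Vec (Dom S) k) where

    eval-^ₜ : ∀ t n → eval S ι v (t ^ₜ n) ≡ eval S ι v t ^ n
    eval-^ₜ t zero    = ≡.refl
    eval-^ₜ t (suc n) = ≡.cong (eval S ι v t *_) (eval-^ₜ t n)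

    eval-powers : ∀ {N} t (es : Vec ℕ N) →
      eval S ι v (Vec.foldr′ _⊗_ 𝟙 (Vec.zipWith _^ₜ_ (Vec.iterate σ t N) es)) ≡
      Vec.foldr′ _*_ 1# (Vec.zipWith _^_ (Vec.iterate unary (eval S ι v t) N) es)
    eval-powers t []       = ≡.refl
    eval-powers t (e ∷ es) = ≡.cong₂ _*_ (eval-^ₜ t e) (eval-powers (σ t) es)

    eval-monomialTerm : ∀ {l N} (xs : Vec (Term C ℒσ k) l) (e : Exponents l N) →
      eval S ι v (monomialTerm xs e) ≡ evalMonomial S (Vec.map (eval S ι v) xs) e
    eval-monomialTerm []       []       = ≡.refl
    eval-monomialTerm (x ∷ xs) (e ∷ es) = ≡.cong₂ _*_ (eval-powers x e) (eval-monomialTerm xs es)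

    eval-polynomialTerm : ∀ {l N} (xs : Vec (Term C ℒσ k) l) (P : DiffPoly C l N) →
      eval S ι v (polynomialTerm xs P) ≡
      evalPolynomial S (Vec.map (eval S ι v) xs) (coefficients P)
    eval-polynomialTerm xs []            = ≡.refl
    eval-polynomialTerm xs ((c , e) ∷ P) = ≡.cong₂ _+_
      (≡.cong₂ _*_ (eval-wk v c) (eval-monomialTerm xs e)) (eval-polynomialTerm xs P)

    eval-at : ∀ {l N} (i : Vec (Fin k) l) (P : DiffPoly C l N) →
      eval S ι v (polynomialTerm (Vec.map var i) P) ≡
      evalPolynomial S (Vec.map (lookup v) i) (coefficients P)
    eval-at i P = ≡.trans (eval-polynomialTerm (Vec.map var i) P)
      (≡.cong (λ a → evalPolynomial S a (coefficients P)) (≡.sym (Vecₚ.map-∘ (eval S ι v) var i)))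

-- All axioms are first-order, which lets them pass to ultraproducts and elementary extensions.
-- Multiplicativity of σ makes it preserve nonzero elements and act on fractions.
record IsDifferenceField (S : Structure ℒσ) : Set where
  open Structure S hiding (Carrier)
  field
    isCommutativeRing : IsCommutativeRing _≈_ _+_ _*_ -_ 0# 1#
    0≉1               : ¬ (0# ≈ 1#)
    0⊎invertible      : ∀ x → (x ≈ 0#) ⊎ (∃[ y ] ((x * y) ≈ 1#))
    unary-cong        : ∀ {x y} → x ≈ y → unary x ≈ unary y
    unary-*           : ∀ x y → unary (x * y) ≈ (unary x * unary y)
    unary-1           : unary 1# ≈ 1#

module DifferenceField {S : Structure ℒσ} (isDF : IsDifferenceField S) where
  open IsDifferenceField isDF public
  ring : CommutativeRing 0ℓ 0ℓ
  ring = record { isCommutativeRing = isCommutativeRing }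
  open CommutativeRing ring public hiding (isCommutativeRing; ring; zero)
  open Structure S public using (unary; _^_)
  open SetoidReasoning setoid
  open SemiringSolver commutativeSemiring using (solve; _:+_; _:*_; _:=_)

  *-≉0 : ∀ {x y} → ¬ (x ≈ 0#) → ¬ (y ≈ 0#) → ¬ (x * y ≈ 0#)
  *-≉0 {x} {y} x≉0 y≉0 xy≈0 with 0⊎invertible x
  ... | inj₁ x≈0       = x≉0 x≈0
  ... | inj₂ (z , xz≈1) = y≉0 (begin
    y            ≈⟨ *-identityˡ y ⟨
    1# * y       ≈⟨ *-congʳ xz≈1 ⟨
    (x * z) * y  ≈⟨ solve 3 (λ x y z → (x :* z) :* y := z :* (x :* y)) refl x y z ⟩
    z * (x * y)  ≈⟨ *-congˡ xy≈0 ⟩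
    z * 0#       ≈⟨ zeroʳ z ⟩
    0#           ∎)

  unary-≉0 : ∀ {x} → ¬ (x ≈ 0#) → ¬ (unary x ≈ 0#)
  unary-≉0 {x} x≉0 σx≈0 with 0⊎invertible x
  ... | inj₁ x≈0       = x≉0 x≈0
  ... | inj₂ (y , xy≈1) = 0≉1 (begin
    0#                 ≈⟨ zeroˡ _ ⟨
    0# * unary y       ≈⟨ *-congʳ σx≈0 ⟨
    unary x * unary y  ≈⟨ unary-* x y ⟨
    unary (x * y)      ≈⟨ unary-cong xy≈1 ⟩
    unary 1#           ≈⟨ unary-1 ⟩
    1#                 ∎)

  open import Algebra.Properties.CommutativeSemiring.Exp commutativeSemiring using (^-congˡ)

  module _ {C : Set} (ι : C → Dom S) where
    eval-cong : ∀ {n} {v w : Vec (Dom S) n} → Pointwise _≈_ v w →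
      ∀ t → eval S ι v t ≈ eval S ι w t
    eval-cong v≈w (var i) = Pointwise.lookup v≈w i
    eval-cong v≈w (con c) = refl
    eval-cong v≈w 𝟘       = refl
    eval-cong v≈w 𝟙       = refl
    eval-cong v≈w (s ⊕ t) = +-cong (eval-cong v≈w s) (eval-cong v≈w t)
    eval-cong v≈w (s ⊗ t) = *-cong (eval-cong v≈w s) (eval-cong v≈w t)
    eval-cong v≈w (⊝ t)   = -‿cong (eval-cong v≈w t)
    eval-cong v≈w (σ t)   = unary-cong (eval-cong v≈w t)

    Sat-cong : ∀ {n} φ {v w : Vec (Dom S) n} → Pointwise _≈_ v w → Sat S ι φ v → Sat S ι φ w
    Sat-cong (s ≐ t) v≈w s≈t = trans (sym (eval-cong v≈w s)) (trans s≈t (eval-cong v≈w t))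
    Sat-cong (neg φ) v≈w ¬φ = ¬φ ∘ Sat-cong φ (Pointwise.sym sym v≈w)
    Sat-cong (φ ∧ ψ) v≈w (φv , ψv) = Sat-cong φ v≈w φv , Sat-cong ψ v≈w ψv
    Sat-cong (φ ∨ ψ) v≈w (inj₁ φv) = inj₁ (Sat-cong φ v≈w φv)
    Sat-cong (φ ∨ ψ) v≈w (inj₂ ψv) = inj₂ (Sat-cong ψ v≈w ψv)
    Sat-cong (ex φ)  v≈w (a , φav) = a , Sat-cong φ (refl ∷ v≈w) φav
    Sat-cong (all φ) v≈w φv a = Sat-cong φ (refl ∷ v≈w) (φv a)

  module Fractions {C : Set} (ι : C → Dom S) where
    open Evaluation S ι

    value₀-Generated : ∀ t → Generated S ι (value₀ t)
    value₀-Generated (con c) = gen c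
    value₀-Generated 𝟘       = zero
    value₀-Generated 𝟙       = one
    value₀-Generated (s ⊕ t) = add (value₀-Generated s) (value₀-Generated t)
    value₀-Generated (s ⊗ t) = mul (value₀-Generated s) (value₀-Generated t)
    value₀-Generated (⊝ t)   = neg (value₀-Generated t)
    value₀-Generated (σ t)   = app (value₀-Generated t)

    -- Values of closed terms form a difference ring, and its fractions are closed under all
    -- operations: an inverse swaps numerator and denominator, σ is applied to both.
    fraction : ∀ {c} → Generated S ι c →
      ∃[ s ] ∃[ t ] (¬ (value₀ s ≈ 0#) × value₀ s * c ≈ value₀ t)
    fraction (gen x) = 𝟙 , con x , 0≉1 ∘ sym , *-identityˡ _
    fraction zero    = 𝟙 , 𝟘 , 0≉1 ∘ sym , *-identityˡ _
    fraction one     = 𝟙 , 𝟙 , 0≉1 ∘ sym , *-identityˡ _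
    fraction (add {a} {b} g h) with fraction g | fraction h
    ... | s , t , s≉0 , sa≈t | s′ , t′ , s′≉0 , s′b≈t′ =
      s ⊗ s′ , (s′ ⊗ t) ⊕ (s ⊗ t′) , *-≉0 s≉0 s′≉0 , trans
        (solve 4 (λ s s′ a b → (s :* s′) :* (a :+ b) := s′ :* (s :* a) :+ s :* (s′ :* b)) refl _ _ a b)
        (+-cong (*-congˡ sa≈t) (*-congˡ s′b≈t′))
    fraction (mul {a} {b} g h) with fraction g | fraction h
    ... | s , t , s≉0 , sa≈t | s′ , t′ , s′≉0 , s′b≈t′ =
      s ⊗ s′ , t ⊗ t′ , *-≉0 s≉0 s′≉0 , trans
        (solve 4 (λ s s′ a b → (s :* s′) :* (a :* b) := (s :* a) :* (s′ :* b)) refl _ _ a b)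
        (*-cong sa≈t s′b≈t′)
    fraction (neg g) with fraction g
    ... | s , t , s≉0 , sa≈t =
      s , ⊝ t , s≉0 , trans (sym (Ringₚ.-‿distribʳ-* (CommutativeRing.ring ring) _ _)) (-‿cong sa≈t)
    fraction (inv {a} {b} g ab≈1) with fraction g
    ... | s , t , s≉0 , sa≈t = t , s , (λ t≈0 → s≉0 (trans (sym tb≈s) (trans (*-congʳ t≈0) (zeroˡ b)))) , tb≈s
      where
      tb≈s : value₀ t * b ≈ value₀ s
      tb≈s = begin
        value₀ t * b        ≈⟨ *-congʳ sa≈t ⟨
        (value₀ s * a) * b  ≈⟨ *-assoc _ a b ⟩
        value₀ s * (a * b)  ≈⟨ *-congˡ ab≈1 ⟩
        value₀ s * 1#       ≈⟨ *-identityʳ _ ⟩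
        value₀ s            ∎
    fraction (app g) with fraction g
    ... | s , t , s≉0 , sa≈t = σ s , σ t , unary-≉0 s≉0 , trans (sym (unary-* _ _)) (unary-cong sa≈t)
    fraction (resp g a≈b) with fraction g
    ... | s , t , s≉0 , sa≈t = s , t , s≉0 , trans (*-congˡ (sym a≈b)) sa≈t

    scale : ∀ {l N} → Term C ℒσ 0 → DiffPoly C l N → DiffPoly C l N
    scale u = List.map (map₁ (u ⊗_))

    scale-eval : ∀ {l N} u (P : DiffPoly C l N) a →
      evalPolynomial S a (coefficients (scale u P)) ≈ value₀ u * evalPolynomial S a (coefficients P)
    scale-eval u []            a = sym (zeroʳ _)
    scale-eval u ((c , e) ∷ P) a = trans (+-congˡ (scale-eval u P a))
      (solve 4 (λ u c m s → (u :* c) :* m :+ u :* s := u :* (c :* m :+ s)) refl _ _ _ _)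

    Nonzero : ∀ {l N} → DiffPoly C l N → Set
    Nonzero P = Any (λ t → ¬ (value₀ (proj₁ t) ≈ 0#)) P

    scale-monomials : ∀ {l N} u (P : DiffPoly C l N) →
      List.map proj₂ (scale u P) ≡ List.map proj₂ P
    scale-monomials u []      = ≡.refl
    scale-monomials u (_ ∷ P) = ≡.cong (_ ∷_) (scale-monomials u P)

    scale-nonzero : ∀ {l N u} {P : DiffPoly C l N} → ¬ (value₀ u ≈ 0#) → Nonzero P → Nonzero (scale u P)
    scale-nonzero u≉0 = Anyₚ.map⁺ ∘ Any.map (*-≉0 u≉0)

    -- The common denominator is the product of those of the coefficients. Multiplying by this
    -- nonzero element changes neither the monomials nor which coefficients vanish, and makes every
    -- coefficient the value of a closed term.
    clearDenominators : ∀ {l N} (P : List (Dom S × Exponents l N)) → All (Generated S ι ∘ proj₁) P →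
      Σ[ s ∈ Term C ℒσ 0 ] Σ[ Q ∈ DiffPoly C l N ]
      (¬ (value₀ s ≈ 0#) × List.map proj₂ Q ≡ List.map proj₂ P ×
       (∀ a → value₀ s * evalPolynomial S a P ≈ evalPolynomial S a (coefficients Q)) ×
       (Any (λ t → ¬ (proj₁ t ≈ 0#)) P → Nonzero Q))
    clearDenominators [] [] = 𝟙 , [] , 0≉1 ∘ sym , ≡.refl , (λ a → zeroʳ _) , λ ()
    clearDenominators ((c , e) ∷ P) (g ∷ gs) with fraction g | clearDenominators P gs
    ... | s , t , s≉0 , sc≈t | s′ , Q , s′≉0 , monos , scaled , nonzero =
      s ⊗ s′ , (s′ ⊗ t , e) ∷ scale s Q , *-≉0 s≉0 s′≉0 ,
      ≡.cong (e ∷_) (≡.trans (scale-monomials s Q) monos) ,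
      (λ a → trans (solve 5 (λ s s′ c m q → (s :* s′) :* (c :* m :+ q) :=
                      (s′ :* (s :* c)) :* m :+ s :* (s′ :* q)) refl _ _ c _ _)
                   (+-cong (*-congʳ (*-congˡ sc≈t)) (trans (*-congˡ (scaled a)) (sym (scale-eval s Q a))))) ,
      λ { (here c≉0)  → here (*-≉0 s′≉0 λ t≈0 → *-≉0 s≉0 c≉0 (trans sc≈t t≈0))
        ; (there any) → there (scale-nonzero {P = Q} s≉0 (nonzero any)) }

monomials-map₁ : ∀ {X Y : Set} {l N} (h : X → Y) (P : List (X × Exponents l N)) →
  List.map proj₂ (List.map (map₁ h) P) ≡ List.map proj₂ P
monomials-map₁ h P = ≡.sym (Listₚ.map-∘ P)

module Dependence (em : LEM) {S : Structure ℒσ} (isDF : IsDifferenceField S) {C : Set} (ι : C → Dom S) where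
  open DifferenceField isDF
  open Fractions ι
  open Evaluation S ι
  open Classical em

  Independent : ∀ {l} → Vec (Dom S) l → Set
  Independent = TransformallyIndependent S (Generated S ι)

  -- The negation of `Independent` with denominators cleared: the coefficients are values of closed
  -- terms, so a dependence can be written as a formula.
  Dependent : ∀ {l} → Vec (Dom S) l → Set
  Dependent {l} a = Σ[ N ∈ ℕ ] Σ[ P ∈ DiffPoly C l N ]
    (Unique≡ (List.map proj₂ P) × Nonzero P × evalPolynomial S a (coefficients P) ≈ 0#)

  coefficients-≉0 : ∀ {l N} (a : Vec (Dom S) l) (P : DiffPoly C l N) → Independent a →
    Unique≡ (List.map proj₂ P) → Nonzero P → ¬ (evalPolynomial S a (coefficients P) ≈ 0#)
  coefficients-≉0 {N = N} a P ind u nonzero = ind N (coefficients P)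
    (≡.subst Unique≡ (≡.sym (monomials-map₁ value₀ P)) u)
    (Allₚ.map⁺ (All.universal (value₀-Generated ∘ proj₁) P)) (Anyₚ.map⁺ nonzero)

  Dependent⇒¬Independent : ∀ {l} (a : Vec (Dom S) l) → Dependent a → ¬ Independent a
  Dependent⇒¬Independent a (N , P , u , nonzero , Pa≈0) ind = coefficients-≉0 a P ind u nonzero Pa≈0

  ¬Independent⇒Dependent : ∀ {l} (a : Vec (Dom S) l) → ¬ Independent a → Dependent a
  ¬Independent⇒Dependent a ¬ind = byContradiction λ ¬dep →
    ¬ind λ N P u gens nonzero Pa≈0 →
      let s , Q , _ , monos , scaled , nonzero′ = clearDenominators P gens in
      ¬dep (N , Q , ≡.subst Unique≡ (≡.sym monos) u , nonzero′ nonzero ,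
            trans (sym (scaled a)) (trans (*-congˡ Pa≈0) (zeroʳ _)))

  -- In no variables there is one monomial, so a polynomial with distinct monomials has at most one
  -- term, a constant.
  independent-[] : Independent []
  independent-[] N [] u gens () 
  independent-[] N ((c , []) ∷ []) u gens (here c≉0) Pa≈0 =
    c≉0 (trans (sym (trans (+-identityʳ _) (*-identityʳ c))) Pa≈0)
  independent-[] N ((c , []) ∷ (d , []) ∷ _) ((≢ ∷ _) ∷ _) = ⊥-elim (≢ ≡.refl)

  -- Makes dependence visible to quantifier-free types: the formula is P = 0 together with c ≠ 0 for
  -- one coefficient c of P.
  dependenceFormula : ∀ {k l} (i : Vec (Fin k) l) v → Dependent (Vec.map (lookup v) i) →
    Σ[ θ ∈ Formula C ℒσ k ] (QuantifierFree θ × Sat S ι θ v ×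
      (∀ w → Sat S ι θ w → Dependent (Vec.map (lookup w) i)))
  dependenceFormula i v (N , P , u , nonzero , Pv≈0) with find nonzero
  ... | (c , e) , c∈P , c≉0 =
    ((polynomialTerm (Vec.map var i) P ≐ 𝟘) ∧ neg (wk c ≐ 𝟘)) , (tt , tt) ,
    (trans (reflexive (eval-at v i P)) Pv≈0 , λ c≈0 → c≉0 (trans (reflexive (≡.sym (eval-wk v c))) c≈0)) ,
    λ w (Pw≈0 , c≉0′) → N , P , u ,
      lose c∈P (λ c≈0 → c≉0′ (trans (reflexive (eval-wk w c)) c≈0)) ,
      trans (reflexive (≡.sym (eval-at w i P))) Pw≈0

-- The inequation keeps P( · , z_K) from vanishing identically, so the number of values of z_j is
-- bounded at every point of the formula and not only at realizations of a type.
fiberFormula : ∀ {C k l N} → Fin k → Vec (Fin k) l → DiffPoly C (suc l) N → Vec ℕ N → Formula C ℒσ k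
fiberFormula j K P f =
  (polynomialTerm (Vec.map var (j ∷ K)) P ≐ 𝟘) ∧ neg (polynomialTerm (Vec.map var K) (slice f P) ≐ 𝟘)

module _ (em : LEM) {S : Structure ℒσ} (isDF : IsDifferenceField S) {C : Set} (ι : C → Dom S) where
  open DifferenceField isDF
  open Evaluation S ι
  open Dependence em isDF ι

  -- Here f is the exponent row of X_j in some term with nonzero coefficient. Then `slice f P` is a
  -- nonzero difference polynomial, which cannot vanish at the independent tuple v_K.
  fiberFormula-exists : ∀ {k l} (j : Fin k) (K : Vec (Fin k) l) v →
    Independent (Vec.map (lookup v) K) → ¬ Independent (Vec.map (lookup v) (j ∷ K)) →
    Σ[ N ∈ ℕ ] Σ[ P ∈ DiffPoly C (suc l) N ] Σ[ f ∈ Vec ℕ N ] Sat S ι (fiberFormula j K P f) v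
  fiberFormula-exists j K v ind ¬ind with ¬Independent⇒Dependent (Vec.map (lookup v) (j ∷ K)) ¬ind
  ... | N , P , u , nonzero , Pv≈0 with find nonzero
  ... | (c , f ∷ e) , c∈P , c≉0 = N , P , f ,
    trans (reflexive (eval-at v (j ∷ K) P)) Pv≈0 ,
    λ Q≈0 → coefficients-≉0 (Vec.map (lookup v) K) (slice f P) ind (slice-unique P u) (lose (∈-slice c∈P) c≉0)
      (trans (reflexive (≡.sym (eval-at v K (slice f P)))) Q≈0)

  -- A complete quantifier-free type decides transformal dependence.
  module _ {S₀ : Structure ℒσ} {ι₀ : C → Dom S₀} {k} {r : PartialType C k}
           (complete : IsCompleteQFType S₀ ι₀ r) {v : Vec (Dom S) k} (v⊨r : _Realizes_ S ι v r) where

    true⇒∈type : ∀ θ → QuantifierFree θ → Sat S ι θ v → r θ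
    true⇒∈type θ qf θv with IsCompleteQFType.complete complete θ qf
    ... | inj₁ rθ  = rθ
    ... | inj₂ r¬θ = ⊥-elim (v⊨r (neg θ) r¬θ θv)

    independent-realization : ∀ {l} (i : Vec (Fin k) l) {w} → _Realizes_ S ι w r →
      Independent (Vec.map (lookup v) i) → Independent (Vec.map (lookup w) i)
    independent-realization i {w} w⊨r ind = Classical.byContradiction em λ ¬ind →
      let θ , qf , θw , dep = dependenceFormula i w (¬Independent⇒Dependent (Vec.map (lookup w) i) ¬ind) in
      Dependent⇒¬Independent (Vec.map (lookup v) i) (dep v (decide θ qf θw)) ind
      where
      decide : ∀ θ → QuantifierFree θ → Sat S ι θ w → Sat S ι θ v
      decide θ qf θw with IsCompleteQFType.complete complete θ qf
      ... | inj₁ rθ  = v⊨r θ rθ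
      ... | inj₂ r¬θ = ⊥-elim (w⊨r (neg θ) r¬θ θw)

-- Difference polynomials over fields with σ = Frob_p

-- The power of x that the product of the σ^j(x)^(e_j) becomes for σ = Frob_p, with the e_j as
-- base-p digits, lowest first.
baseExpansion : ℕ → ∀ {N} → Vec ℕ N → ℕ
baseExpansion p []       = 0
baseExpansion p (e ∷ es) = e ℕ.+ p ℕ.* baseExpansion p es

Below : ℕ → ∀ {N} → Vec ℕ N → Set
Below p = VecAll.All (ℕ._< p)

baseExpansion-< : ∀ {p N} {es : Vec ℕ N} → Below p es → baseExpansion p es ℕ.< p ℕ.^ N
baseExpansion-< []                    = s≤s z≤n
baseExpansion-< {p} {suc N} {e ∷ es} (e<p ∷ es<p) = begin-strict
  e ℕ.+ p ℕ.* x  <⟨ ℕₚ.+-monoˡ-< (p ℕ.* x) e<p ⟩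
  p ℕ.+ p ℕ.* x  ≡⟨ ℕₚ.*-suc p x ⟨
  p ℕ.* suc x    ≤⟨ ℕₚ.*-monoʳ-≤ p (baseExpansion-< es<p) ⟩
  p ℕ.^ suc N    ∎
  where
  open ℕₚ.≤-Reasoning
  x = baseExpansion p es

-- Residues modulo p give the lowest digit; cancelling it and p leaves the others.
baseExpansion-injective : ∀ {p N} {f g : Vec ℕ N} → Below p f → Below p g →
  baseExpansion p f ≡ baseExpansion p g → f ≡ g
baseExpansion-injective {f = []} {[]} _ _ _ = ≡.refl
baseExpansion-injective {p} {f = d ∷ f} {e ∷ g} (d<p ∷ f<p) (e<p ∷ g<p) eq =
  ≡.cong₂ _∷_ d≡e (baseExpansion-injective f<p g<p (ℕₚ.*-cancelˡ-≡ _ _ p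
    (ℕₚ.+-cancelˡ-≡ d _ _ (≡.trans eq (≡.cong (ℕ._+ p ℕ.* baseExpansion p g) (≡.sym d≡e))))))
  where
  instance
    p≢0 : NonZero p
    p≢0 = ℕ.>-nonZero (ℕₚ.≤-trans (s≤s z≤n) d<p)
  residue : ∀ a x → a ℕ.< p → (a ℕ.+ p ℕ.* x) DivMod.% p ≡ a
  residue a x a<p = ≡.trans (≡.cong (λ y → (a ℕ.+ y) DivMod.% p) (ℕₚ.*-comm p x))
    (≡.trans (DivMod.[m+kn]%n≡m%n a x p) (DivMod.m<n⇒m%n≡m a<p))
  d≡e : d ≡ e
  d≡e = ≡.trans (≡.sym (residue d _ d<p)) (≡.trans (≡.cong (DivMod._% p) eq) (residue e _ e<p))

-- The condition concerns the first variable, the one to be solved for; the others get specialized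
-- to field elements.
Bounded : ∀ {X : Set} {l N} → ℕ → List (X × Exponents (suc l) N) → Set
Bounded p = All (λ t → Below p (Vec.head (proj₂ t)))

below-bound : ∀ {N} (f : Vec ℕ N) → ∃[ b ] (∀ p → b ℕ.≤ p → Below p f)
below-bound []      = 0 , λ p _ → []
below-bound (e ∷ f) with below-bound f
... | b , below = suc e ℕ.⊔ b , λ p ≤p →
  ℕₚ.m⊔n≤o⇒m≤o (suc e) b ≤p ∷ below p (ℕₚ.m⊔n≤o⇒n≤o (suc e) b ≤p)

bounded-bound : ∀ {X : Set} {l N} (P : List (X × Exponents (suc l) N)) → ∃[ b ] (∀ p → b ℕ.≤ p → Bounded p P)
bounded-bound []            = 0 , λ p _ → []
bounded-bound ((c , e) ∷ P) with below-bound (Vec.head e) | bounded-bound P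
... | b , below | b′ , bounded = b ℕ.⊔ b′ , λ p ≤p →
  below p (ℕₚ.m⊔n≤o⇒m≤o b b′ ≤p) ∷ bounded p (ℕₚ.m⊔n≤o⇒n≤o b b′ ≤p)

module _ {S : Structure ℒσ} (isDF : IsDifferenceField S) where
  open DifferenceField isDF

  -- Reduced to `eval-cong` by writing P as a term with its coefficients as constant symbols.
  evalPolynomial-cong : ∀ {l N} {a b : Vec (Dom S) l} (P : List (Dom S × Exponents l N)) →
    Pointwise _≈_ a b → evalPolynomial S a P ≈ evalPolynomial S b P
  evalPolynomial-cong {l} {N} {a} {b} P a≈b = begin
    evalPolynomial S a P          ≡⟨ at a ⟨
    eval S id a (polynomialTerm xs Q)  ≈⟨ eval-cong id a≈b (polynomialTerm xs Q) ⟩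
    eval S id b (polynomialTerm xs Q)  ≡⟨ at b ⟩
    evalPolynomial S b P          ∎
    where
    open SetoidReasoning setoid
    open Evaluation S id
    xs = Vec.map var (Vec.allFin l)
    Q : DiffPoly (Dom S) l N
    Q = List.map (map₁ con) P
    coefficients-con : ∀ P → coefficients {l} {N} (List.map (map₁ con) P) ≡ P
    coefficients-con []      = ≡.refl
    coefficients-con (_ ∷ P) = ≡.cong (_ ∷_) (coefficients-con P)
    at : ∀ c → eval S id c (polynomialTerm xs Q) ≡ evalPolynomial S c P
    at c = ≡.trans (eval-at c (Vec.allFin l) Q)
      (≡.cong₂ (evalPolynomial S) (Vecₚ.map-lookup-allFin c) (coefficients-con P))

module FrobeniusField (em : LEM) (K : Field) (p : ℕ) where
  open Field K
  open import Algebra.Properties.CommutativeSemiring.Exp commutativeSemiring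
    using (^-congˡ; ^-distrib-*; ^-homo-*; ^-assocʳ)
  open SetoidReasoning setoid
  open RootBound K
  open SemiringSolver commutativeSemiring using (solve; _:+_; _:*_; _:=_)

  FS : Structure ℒσ
  FS = Frob p

  1^n≈1 : ∀ n → 1# ^ n ≈ 1#
  1^n≈1 zero    = refl
  1^n≈1 (suc n) = trans (*-identityˡ _) (1^n≈1 n)

  isDifferenceField : IsDifferenceField FS
  isDifferenceField = record
    { isCommutativeRing = isCommutativeRing
    ; 0≉1 = 0≉1
    ; 0⊎invertible = zero⊎invertible
    ; unary-cong = ^-congˡ p
    ; unary-* = λ x y → ^-distrib-* x y p
    ; unary-1 = 1^n≈1 p
    }
    where
    zero⊎invertible : ∀ x → (x ≈ 0#) ⊎ (∃[ y ] ((x * y) ≈ 1#))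
    zero⊎invertible x with em {x ≈ 0#}
    ... | yes x≈0 = inj₁ x≈0
    ... | no  x≉0 = inj₂ (inverse x x≉0)

  powers-baseExpansion : ∀ {N} x (f : Vec ℕ N) →
    Vec.foldr′ _*_ 1# (Vec.zipWith _^_ (Vec.iterate (_^ p) x N) f) ≈ x ^ baseExpansion p f
  powers-baseExpansion x []      = refl
  powers-baseExpansion x (e ∷ f) = begin
    x ^ e * _                               ≈⟨ *-congˡ (powers-baseExpansion (x ^ p) f) ⟩
    x ^ e * (x ^ p) ^ baseExpansion p f      ≈⟨ *-congˡ (^-assocʳ x p (baseExpansion p f)) ⟩
    x ^ e * x ^ (p ℕ.* baseExpansion p f)    ≈⟨ ^-homo-* x e (p ℕ.* baseExpansion p f) ⟨
    x ^ baseExpansion p (e ∷ f)              ∎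

  toSparse : ∀ {l N} → Vec Carrier l → List (Carrier × Exponents (suc l) N) → List (Carrier × ℕ)
  toSparse v = List.map λ { (c , f ∷ e) → c * evalMonomial FS v e , baseExpansion p f }

  sparse-toSparse : ∀ {l N} x (v : Vec Carrier l) (P : List (Carrier × Exponents (suc l) N)) →
    sparse (toSparse v P) x ≈ evalPolynomial FS (x ∷ v) P
  sparse-toSparse x v []                = refl
  sparse-toSparse x v ((c , f ∷ e) ∷ P) = +-cong
    (begin
      (c * m) * x ^ baseExpansion p f  ≈⟨ *-congˡ (powers-baseExpansion x f) ⟨
      (c * m) * _                      ≈⟨ solve 3 (λ c m y → (c :* m) :* y := c :* (y :* m)) refl c m _ ⟩
      c * evalMonomial FS (x ∷ v) (f ∷ e)  ∎)
    (sparse-toSparse x v P)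
    where m = evalMonomial FS v e

  -- By uniqueness of digits below p, the terms that contribute to this power of X are exactly those
  -- with exponent row f, which `slice f` selects.
  coefficient-toSparse : ∀ {l N} {f : Vec ℕ N} (v : Vec Carrier l) (P : List (Carrier × Exponents (suc l) N)) →
    Below p f → Bounded p P →
    coefficient (baseExpansion p f) (toSparse v P) ≈ evalPolynomial FS v (slice f P)
  coefficient-toSparse     v []                f<p _           = refl
  coefficient-toSparse {f = f} v ((c , g ∷ e) ∷ P) f<p (g<p ∷ bounded)
    with baseExpansion p g ℕₚ.≟ baseExpansion p f | Vecₚ.≡-dec ℕₚ._≟_ g f
  ... | yes _  | yes _      = +-congˡ (coefficient-toSparse v P f<p bounded)
  ... | yes eq | no  g≢f    = ⊥-elim (g≢f (baseExpansion-injective g<p f<p eq))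
  ... | no neq | yes ≡.refl = ⊥-elim (neq ≡.refl)
  ... | no _   | no  _      = coefficient-toSparse v P f<p bounded

  toSparse-< : ∀ {l N} (v : Vec Carrier l) {P : List (Carrier × Exponents (suc l) N)} →
    Bounded p P → All (λ t → proj₂ t ℕ.< p ℕ.^ N) (toSparse v P)
  toSparse-< v {[]}              []              = []
  toSparse-< v {(c , f ∷ e) ∷ P} (f<p ∷ bounded) = baseExpansion-< f<p ∷ toSparse-< v bounded

  polynomial-roots : ∀ {l N rs} {f : Vec ℕ N} (v : Vec Carrier l) (P : List (Carrier × Exponents (suc l) N)) →
    Below p f → Bounded p P → ¬ (evalPolynomial FS v (slice f P) ≈ 0#) →
    SetoidUnique.Unique setoid rs → All (λ t → evalPolynomial FS (t ∷ v) P ≈ 0#) rs →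
    length rs ℕ.≤ p ℕ.^ N
  polynomial-roots {f = f} v P f<p bounded Q≉0 u roots = sparse-roots (toSparse-< v bounded)
    (λ c≈0 → Q≉0 (trans (sym (coefficient-toSparse v P f<p bounded)) c≈0)) u
    (All.map (λ {t} → trans (sparse-toSparse t v P)) roots)

module _ (em : LEM) (K : FiniteField) (p : ℕ) where
  open FiniteField K
  open FrobeniusField em fld p
  open DifferenceField isDifferenceField using (Sat-cong)
  open FiniteSets em

  finite : Cover setoid (λ _ → ⊤) (FiniteField.q K)
  finite = HasCard⇒Cover {setoid} isSize

  finite-tuples : ∀ n → Cover (tuples n) (λ _ → ⊤) (FiniteField.q K ℕ.^ n)
  finite-tuples n = cover-⊆ {tuples n} (λ _ _ _ → tt) (cover-vec {setoid} n (λ _ → finite))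

  Sat-hasCard : ∀ {C : Set} {n} (ι : C → Carrier) (φ : Formula C ℒσ n) → ∃[ N ] HasCard (tuples n) (Sat FS ι φ) N
  Sat-hasCard {n = n} ι φ = hasCard {tuples n} (Sat-cong ι φ) (finite-tuples n)

  module _ {C : Set} (ι : C → Carrier) {k l} (I : Vec (Fin k) l) where

    Fiber : Formula C ℒσ k → Vec Carrier l → Fin k → Carrier → Set
    Fiber θ v j t = Σ[ z ∈ Vec Carrier k ]
      (Sat FS ι θ z × Pointwise _≈_ (Vec.map (lookup z) I) v × lookup z j ≈ t)

    -- Any point of the fiber shows, through the inequation, that P( · , v) has a nonvanishing
    -- coefficient; all points of the fiber are roots of it, and its degree is below p^N.
    fiber-cover : ∀ {N} (j : Fin k) (P : DiffPoly C (suc l) N) f →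
      Below p f → Bounded p P → ∀ v → Cover setoid (Fiber (fiberFormula j I P f) v j) (p ℕ.^ N)
    fiber-cover {N} j P f f<p bounded v = cover-byUnique {setoid} {A = FiniteField.q K}
      (λ t≈t′ (z , θz , zK≈v , zj≈t) → z , θz , zK≈v , trans zj≈t t≈t′) finite bound
      where
      open Evaluation FS ι
      PF = coefficients P
      root : ∀ {t} → Fiber (fiberFormula j I P f) v j t → evalPolynomial FS (t ∷ v) PF ≈ 0#
      root (z , (Pz≈0 , _) , zK≈v , zj≈t) =
        trans (sym (evalPolynomial-cong isDifferenceField PF (zj≈t ∷ zK≈v)))
          (trans (reflexive (≡.sym (eval-at z (j ∷ I) P))) Pz≈0)
      leading : ∀ {t} → Fiber (fiberFormula j I P f) v j t → ¬ (evalPolynomial FS v (slice f PF) ≈ 0#)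
      leading (z , (_ , Qz≉0) , zK≈v , _) Q≈0 = Qz≉0
        (trans (reflexive (≡.trans (eval-at z I (slice f P))
                 (≡.cong (evalPolynomial FS (Vec.map (lookup z) I)) (≡.sym (slice-map₁ value₀ f P)))))
          (trans (evalPolynomial-cong isDifferenceField (slice f PF) zK≈v) Q≈0))
      bound : ∀ ts → SetoidUnique.Unique setoid ts → All (Fiber (fiberFormula j I P f) v j) ts →
        length ts ℕ.≤ p ℕ.^ N
      bound [] _ _ = z≤n
      bound ts@(_ ∷ _) u fibers@(t∈ ∷ _) =
        polynomial-roots v PF f<p (Allₚ.map⁺ bounded) (leading t∈) u (All.map root fibers)

-- Parameters of formulas

termConstants : ∀ {C L n} → Term C L n → List C
termConstants (var i) = []
termConstants (con c) = List.[ c ]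
termConstants 𝟘       = []
termConstants 𝟙       = []
termConstants (s ⊕ t) = termConstants s List.++ termConstants t
termConstants (s ⊗ t) = termConstants s List.++ termConstants t
termConstants (⊝ t)   = termConstants t
termConstants (σ t)   = termConstants t

constants : ∀ {C L n} → Formula C L n → List C
constants (s ≐ t) = termConstants s List.++ termConstants t
constants (neg φ) = constants φ
constants (φ ∧ ψ) = constants φ List.++ constants ψ
constants (φ ∨ ψ) = constants φ List.++ constants ψ
constants (ex φ)  = constants φ
constants (all φ) = constants φ

module _ {C C′ : Set} (f : C → C′) where

  mapConTerm : ∀ {L n} → Term C L n → Term C′ L n
  mapConTerm (var i) = var i
  mapConTerm (con c) = con (f c)
  mapConTerm 𝟘       = 𝟘
  mapConTerm 𝟙       = 𝟙
  mapConTerm (s ⊕ t) = mapConTerm s ⊕ mapConTerm t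
  mapConTerm (s ⊗ t) = mapConTerm s ⊗ mapConTerm t
  mapConTerm (⊝ t)   = ⊝ mapConTerm t
  mapConTerm (σ t)   = σ (mapConTerm t)

  mapCon : ∀ {L n} → Formula C L n → Formula C′ L n
  mapCon (s ≐ t) = mapConTerm s ≐ mapConTerm t
  mapCon (neg φ) = neg (mapCon φ)
  mapCon (φ ∧ ψ) = mapCon φ ∧ mapCon ψ
  mapCon (φ ∨ ψ) = mapCon φ ∨ mapCon ψ
  mapCon (ex φ)  = ex (mapCon φ)
  mapCon (all φ) = all (mapCon φ)

  mapCon-QuantifierFree : ∀ {L n} (φ : Formula C L n) → QuantifierFree φ → QuantifierFree (mapCon φ)
  mapCon-QuantifierFree (s ≐ t) qf          = tt
  mapCon-QuantifierFree (neg φ) qf          = mapCon-QuantifierFree φ qf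
  mapCon-QuantifierFree (φ ∧ ψ) (qfφ , qfψ) = mapCon-QuantifierFree φ qfφ , mapCon-QuantifierFree ψ qfψ
  mapCon-QuantifierFree (φ ∨ ψ) (qfφ , qfψ) = mapCon-QuantifierFree φ qfφ , mapCon-QuantifierFree ψ qfψ

  mapCon-QuantifierFree⁻ : ∀ {L n} (φ : Formula C L n) → QuantifierFree (mapCon φ) → QuantifierFree φ
  mapCon-QuantifierFree⁻ (s ≐ t) qf          = tt
  mapCon-QuantifierFree⁻ (neg φ) qf          = mapCon-QuantifierFree⁻ φ qf
  mapCon-QuantifierFree⁻ (φ ∧ ψ) (qfφ , qfψ) = mapCon-QuantifierFree⁻ φ qfφ , mapCon-QuantifierFree⁻ ψ qfψ
  mapCon-QuantifierFree⁻ (φ ∨ ψ) (qfφ , qfψ) = mapCon-QuantifierFree⁻ φ qfφ , mapCon-QuantifierFree⁻ ψ qfψ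

  module _ {L} (S : Structure L) (ι : C′ → Dom S) where

    eval-mapCon : ∀ {n} (v : Vec (Dom S) n) t → eval S ι v (mapConTerm t) ≡ eval S (ι ∘ f) v t
    eval-mapCon v (var i) = ≡.refl
    eval-mapCon v (con c) = ≡.refl
    eval-mapCon v 𝟘       = ≡.refl
    eval-mapCon v 𝟙       = ≡.refl
    eval-mapCon v (s ⊕ t) = ≡.cong₂ (Structure._+_ S) (eval-mapCon v s) (eval-mapCon v t)
    eval-mapCon v (s ⊗ t) = ≡.cong₂ (Structure._*_ S) (eval-mapCon v s) (eval-mapCon v t)
    eval-mapCon v (⊝ t)   = ≡.cong (Structure.-_ S) (eval-mapCon v t)
    eval-mapCon v (σ t)   = ≡.cong (Structure.unary S) (eval-mapCon v t)

    Sat-mapCon : ∀ {n} φ (v : Vec (Dom S) n) → Sat S ι (mapCon φ) v ⇔ Sat S (ι ∘ f) φ v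
    Sat-mapCon (s ≐ t) v = mk⇔
      (≡.subst₂ (Structure._≈_ S) (eval-mapCon v s) (eval-mapCon v t))
      (≡.subst₂ (Structure._≈_ S) (≡.sym (eval-mapCon v s)) (≡.sym (eval-mapCon v t)))
    Sat-mapCon (neg φ) v = mk⇔ (_∘ from (Sat-mapCon φ v)) (_∘ to (Sat-mapCon φ v))
    Sat-mapCon (φ ∧ ψ) v = mk⇔
      (Product.map (to (Sat-mapCon φ v)) (to (Sat-mapCon ψ v)))
      (Product.map (from (Sat-mapCon φ v)) (from (Sat-mapCon ψ v)))
    Sat-mapCon (φ ∨ ψ) v = mk⇔
      (Sum.map (to (Sat-mapCon φ v)) (to (Sat-mapCon ψ v)))
      (Sum.map (from (Sat-mapCon φ v)) (from (Sat-mapCon ψ v)))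
    Sat-mapCon (ex φ)  v = mk⇔
      (λ (a , φa) → a , to (Sat-mapCon φ (a ∷ v)) φa) (λ (a , φa) → a , from (Sat-mapCon φ (a ∷ v)) φa)
    Sat-mapCon (all φ) v = mk⇔
      (λ φv a → to (Sat-mapCon φ (a ∷ v)) (φv a)) (λ φv a → from (Sat-mapCon φ (a ∷ v)) (φv a))

  private
    InRange : Pred C′ 0ℓ
    InRange c = ∃[ c₀ ] (f c₀ ≡ c)

  termPreimage : ∀ {L n} (t : Term C′ L n) → All InRange (termConstants t) → ∃[ s ] (mapConTerm s ≡ t)
  termPreimage (var i) _ = var i , ≡.refl
  termPreimage (con c) ((c₀ , eq) ∷ []) = con c₀ , ≡.cong con eq
  termPreimage 𝟘       _ = 𝟘 , ≡.refl
  termPreimage 𝟙       _ = 𝟙 , ≡.refl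
  termPreimage (s ⊕ t) range =
    let s′ , s≡ = termPreimage s (Allₚ.++⁻ˡ (termConstants s) range)
        t′ , t≡ = termPreimage t (Allₚ.++⁻ʳ (termConstants s) range) in s′ ⊕ t′ , ≡.cong₂ _⊕_ s≡ t≡
  termPreimage (s ⊗ t) range =
    let s′ , s≡ = termPreimage s (Allₚ.++⁻ˡ (termConstants s) range)
        t′ , t≡ = termPreimage t (Allₚ.++⁻ʳ (termConstants s) range) in s′ ⊗ t′ , ≡.cong₂ _⊗_ s≡ t≡
  termPreimage (⊝ t)   range = let t′ , t≡ = termPreimage t range in ⊝ t′ , ≡.cong ⊝_ t≡
  termPreimage (σ t)   range = let t′ , t≡ = termPreimage t range in σ t′ , ≡.cong σ t≡

  -- Serves to read a formula over A as one over the finitely many parameters that it mentions.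
  preimage : ∀ {L n} (φ : Formula C′ L n) → All InRange (constants φ) → ∃[ ψ ] (mapCon ψ ≡ φ)
  preimage (s ≐ t) range =
    let s′ , s≡ = termPreimage s (Allₚ.++⁻ˡ (termConstants s) range)
        t′ , t≡ = termPreimage t (Allₚ.++⁻ʳ (termConstants s) range) in (s′ ≐ t′) , ≡.cong₂ _≐_ s≡ t≡
  preimage (neg φ) range = let ψ , eq = preimage φ range in neg ψ , ≡.cong neg eq
  preimage (φ ∧ ψ) range =
    let φ′ , φ≡ = preimage φ (Allₚ.++⁻ˡ (constants φ) range)
        ψ′ , ψ≡ = preimage ψ (Allₚ.++⁻ʳ (constants φ) range) in φ′ ∧ ψ′ , ≡.cong₂ _∧_ φ≡ ψ≡
  preimage (φ ∨ ψ) range =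
    let φ′ , φ≡ = preimage φ (Allₚ.++⁻ˡ (constants φ) range)
        ψ′ , ψ≡ = preimage ψ (Allₚ.++⁻ʳ (constants φ) range) in φ′ ∨ ψ′ , ≡.cong₂ _∨_ φ≡ ψ≡
  preimage (ex φ)  range = let ψ , eq = preimage φ range in ex ψ , ≡.cong ex eq
  preimage (all φ) range = let ψ , eq = preimage φ range in all ψ , ≡.cong all eq

module _ {L : Language} (S : Structure L) {C : Set} (ι : C → Dom S) where

  Sat-⋀⁺ : ∀ {n} {v : Vec (Dom S) n} {Φ} → Structure._≈_ S (Structure.0# S) (Structure.0# S) →
    All (λ φ → Sat S ι φ v) Φ → Sat S ι (⋀ Φ) v
  Sat-⋀⁺ 0≈0 []         = 0≈0
  Sat-⋀⁺ 0≈0 (φv ∷ Φv) = φv , Sat-⋀⁺ 0≈0 Φv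

  Sat-⋀⁻ : ∀ {n} {v : Vec (Dom S) n} Φ → Sat S ι (⋀ Φ) v → All (λ φ → Sat S ι φ v) Φ
  Sat-⋀⁻ []      _          = []
  Sat-⋀⁻ (φ ∷ Φ) (φv , Φv) = φv ∷ Sat-⋀⁻ Φ Φv

  Sat-ex^⁺ : ∀ m {n} {v : Vec (Dom S) n} (φ : Formula C L (m ℕ.+ n)) (y : Vec (Dom S) m) →
    Sat S ι φ (y Vec.++ v) → Sat S ι (ex^ m φ) v
  Sat-ex^⁺ zero    φ []      φv = φv
  Sat-ex^⁺ (suc m) φ (a ∷ y) φv = Sat-ex^⁺ m (ex φ) y (a , φv)

  Sat-ex^⁻ : ∀ m {n} {v : Vec (Dom S) n} (φ : Formula C L (m ℕ.+ n)) →
    Sat S ι (ex^ m φ) v → ∃[ y ] Sat S ι φ (y Vec.++ v)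
  Sat-ex^⁻ zero    φ φv = [] , φv
  Sat-ex^⁻ (suc m) φ φv = let y , a , φayv = Sat-ex^⁻ m (ex φ) φv in a ∷ y , φayv

-- Łoś's theorem

module _ (U : NonPrincipalUltrafilter) where
  open NonPrincipalUltrafilter U

  large-everywhere : {P : Pred ℙ 0ℓ} → (∀ p → P p) → Large P
  large-everywhere Pp = large-⊆ (λ p _ → Pp p) large-⊤

  large-zipWith : {P Q R : Pred ℙ 0ℓ} → (∀ {p} → P p → Q p → R p) → Large P → Large Q → Large R
  large-zipWith f P Q = large-⊆ (λ p (Pp , Qp) → f Pp Qp) (large-∩ P Q)

  large-¬¬ : {P : Pred ℙ 0ℓ} → ¬ Large (∁ P) → Large P
  large-¬¬ {P} ¬∁P with ultra P
  ... | inj₁ largeP  = largeP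
  ... | inj₂ large∁P = ⊥-elim (¬∁P large∁P)

  module Łoś (em : LEM) (S : ℙ → Structure ℒσ) where
    open Classical em

    at : ∀ {n} → Vec (∀ p → Dom (S p)) n → ∀ p → Vec (Dom (S p)) n
    at v p = Vec.map (λ x → x p) v

    eval-at-index : ∀ {C : Set} {n} (ι : C → ∀ p → Dom (S p)) (v : Vec (∀ p → Dom (S p)) n) t p →
      eval (ultraproduct U S) ι v t p ≡ eval (S p) (λ c → ι c p) (at v p) t
    eval-at-index ι v (var i) p = ≡.sym (Vecₚ.lookup-map i (λ x → x p) v)
    eval-at-index ι v (con c) p = ≡.refl
    eval-at-index ι v 𝟘       p = ≡.refl
    eval-at-index ι v 𝟙       p = ≡.refl
    eval-at-index ι v (s ⊕ t) p = ≡.cong₂ (Structure._+_ (S p)) (eval-at-index ι v s p) (eval-at-index ι v t p)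
    eval-at-index ι v (s ⊗ t) p = ≡.cong₂ (Structure._*_ (S p)) (eval-at-index ι v s p) (eval-at-index ι v t p)
    eval-at-index ι v (⊝ t)   p = ≡.cong (Structure.-_ (S p)) (eval-at-index ι v t p)
    eval-at-index ι v (σ t)   p = ≡.cong (Structure.unary (S p)) (eval-at-index ι v t p)

    -- Where P p has no solution the value is junk.
    choice : {P : ∀ p → Dom (S p) → Set} → Σ[ a ∈ (∀ p → Dom (S p)) ] (∀ p → ∃ (P p) → P p (a p))
    choice {P} = (λ p → proj₁ (choose p)) , λ p → proj₂ (choose p)
      where
      choose : ∀ p → Σ[ a ∈ Dom (S p) ] (∃ (P p) → P p a)
      choose p with em {∃ (P p)}
      ... | yes (a , Pa) = a , λ _ → Pa
      ... | no ¬∃        = Structure.0# (S p) , λ ∃P → ⊥-elim (¬∃ ∃P)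

    łoś : ∀ {C : Set} {n} (ι : C → ∀ p → Dom (S p)) φ (v : Vec (∀ p → Dom (S p)) n) →
      Sat (ultraproduct U S) ι φ v ⇔ Large (λ p → Sat (S p) (λ c → ι c p) φ (at v p))
    łoś ι (s ≐ t) v = mk⇔
      (large-⊆ λ p → ≡.subst₂ (Structure._≈_ (S p)) (eval-at-index ι v s p) (eval-at-index ι v t p))
      (large-⊆ λ p → ≡.subst₂ (Structure._≈_ (S p)) (≡.sym (eval-at-index ι v s p)) (≡.sym (eval-at-index ι v t p)))
    łoś ι (neg φ) v = mk⇔ forth
      (λ large¬φ φv → large-⊥ (large-zipWith (λ ¬φ φ → ¬φ φ) large¬φ (to (łoś ι φ v) φv)))
      where
      forth : ¬ Sat (ultraproduct U S) ι φ v → Large (λ p → ¬ Sat (S p) (λ c → ι c p) φ (at v p))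
      forth ¬φv with ultra (λ p → Sat (S p) (λ c → ι c p) φ (at v p))
      ... | inj₁ largeφ  = ⊥-elim (¬φv (from (łoś ι φ v) largeφ))
      ... | inj₂ large¬φ = large¬φ
    łoś ι (φ ∧ ψ) v = mk⇔
      (λ (φv , ψv) → large-∩ (to (łoś ι φ v) φv) (to (łoś ι ψ v) ψv))
      (λ large → from (łoś ι φ v) (large-⊆ (λ _ → proj₁) large) , from (łoś ι ψ v) (large-⊆ (λ _ → proj₂) large))
    łoś ι (φ ∨ ψ) v = mk⇔
      (λ { (inj₁ φv) → large-⊆ (λ _ → inj₁) (to (łoś ι φ v) φv)
         ; (inj₂ ψv) → large-⊆ (λ _ → inj₂) (to (łoś ι ψ v) ψv) })
      back
      where
      back : Large (λ p → Sat (S p) (λ c → ι c p) (φ ∨ ψ) (at v p)) → Sat (ultraproduct U S) ι (φ ∨ ψ) v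
      back large with ultra (λ p → Sat (S p) (λ c → ι c p) φ (at v p))
      ... | inj₁ largeφ  = inj₁ (from (łoś ι φ v) largeφ)
      ... | inj₂ large¬φ = inj₂ (from (łoś ι ψ v) (large-zipWith
              (λ { ¬φ (inj₁ φ) → ⊥-elim (¬φ φ) ; _ (inj₂ ψ) → ψ }) large¬φ large))
    łoś ι (ex φ)  v = mk⇔
      (λ (a , φav) → large-⊆ (λ p φp → a p , φp) (to (łoś ι φ (a ∷ v)) φav))
      (λ large → let a , a-good = choice in a , from (łoś ι φ (a ∷ v)) (large-⊆ a-good large))
    łoś ι (all φ) v = mk⇔
      -- Counterexamples at almost all indices assemble into one element `a` of the ultraproduct,
      -- which contradicts φv.
      (λ φv → large-¬¬ λ large¬ →
        let a , a-good = choice {λ p a → ¬ Sat (S p) (λ c → ι c p) φ (a ∷ at v p)} in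
        large-⊥ (large-zipWith
          (λ {p} ¬all φa → a-good p (byContradiction λ ¬∃ → ¬all λ b → byContradiction λ ¬φb → ¬∃ (b , ¬φb)) φa)
          large¬ (to (łoś ι φ (a ∷ v)) (φv a))))
      (λ large a → from (łoś ι φ (a ∷ v)) (large-⊆ (λ p φp → φp (a p)) large))

-- Embeddings and elementary extensions of difference fields

record IsEmbedding (S T : Structure ℒσ) (h : Dom S → Dom T) : Set where
  private
    module S = Structure S
    module T = Structure T
  field
    ≈-cong      : ∀ {x y} → x S.≈ y → h x T.≈ h y
    ≈-injective : ∀ {x y} → h x T.≈ h y → x S.≈ y
    +-homo      : ∀ x y → h (x S.+ y) T.≈ (h x T.+ h y)
    *-homo      : ∀ x y → h (x S.* y) T.≈ (h x T.* h y)
    -‿homo      : ∀ x → h (S.- x) T.≈ (T.- h x)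
    0-homo      : h S.0# T.≈ T.0#
    1-homo      : h S.1# T.≈ T.1#
    unary-homo  : ∀ x → h (S.unary x) T.≈ T.unary (h x)

module Embedding {S T : Structure ℒσ} (isDF : IsDifferenceField T) {h : Dom S → Dom T}
                 (isEmb : IsEmbedding S T h) {C : Set} (ι : C → Dom S) where
  open IsEmbedding isEmb
  open DifferenceField isDF

  eval-homo : ∀ {n} (v : Vec (Dom S) n) t → h (eval S ι v t) ≈ eval T (h ∘ ι) (Vec.map h v) t
  eval-homo v (var i) = reflexive (≡.sym (Vecₚ.lookup-map i h v))
  eval-homo v (con c) = refl
  eval-homo v 𝟘       = 0-homo
  eval-homo v 𝟙       = 1-homo
  eval-homo v (s ⊕ t) = trans (+-homo _ _) (+-cong (eval-homo v s) (eval-homo v t))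
  eval-homo v (s ⊗ t) = trans (*-homo _ _) (*-cong (eval-homo v s) (eval-homo v t))
  eval-homo v (⊝ t)   = trans (-‿homo _) (-‿cong (eval-homo v t))
  eval-homo v (σ t)   = trans (unary-homo _) (unary-cong (eval-homo v t))

  Sat-embedding : ∀ {n} φ → QuantifierFree φ → (v : Vec (Dom S) n) →
    Sat S ι φ v ⇔ Sat T (h ∘ ι) φ (Vec.map h v)
  Sat-embedding (s ≐ t) _ v = mk⇔
    (λ s≈t → trans (sym (eval-homo v s)) (trans (≈-cong s≈t) (eval-homo v t)))
    (λ s≈t → ≈-injective (trans (eval-homo v s) (trans s≈t (sym (eval-homo v t)))))
  Sat-embedding (neg φ) qf v = mk⇔ (_∘ from (Sat-embedding φ qf v)) (_∘ to (Sat-embedding φ qf v))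
  Sat-embedding (φ ∧ ψ) (qfφ , qfψ) v = mk⇔
    (Product.map (to (Sat-embedding φ qfφ v)) (to (Sat-embedding ψ qfψ v)))
    (Product.map (from (Sat-embedding φ qfφ v)) (from (Sat-embedding ψ qfψ v)))
  Sat-embedding (φ ∨ ψ) (qfφ , qfψ) v = mk⇔
    (Sum.map (to (Sat-embedding φ qfφ v)) (to (Sat-embedding ψ qfψ v)))
    (Sum.map (from (Sat-embedding φ qfφ v)) (from (Sat-embedding ψ qfψ v)))

module _ (em : LEM) (U : NonPrincipalUltrafilter) {S : ℙ → Structure ℒσ}
         (isDF : ∀ p → IsDifferenceField (S p)) where
  open NonPrincipalUltrafilter U
  open Łoś U em S
  private
    module D p = DifferenceField (isDF p)

  ultraproduct-isDifferenceField : IsDifferenceField (ultraproduct U S)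
  ultraproduct-isDifferenceField = record
    { isCommutativeRing = record
      { isRing = record
        { +-isAbelianGroup = record
          { isGroup = record
            { isMonoid = record
              { isSemigroup = record
                { isMagma = record
                  { isEquivalence = record
                    { refl  = everywhere λ p → D.refl p
                    ; sym   = large-⊆ λ p → D.sym p
                    ; trans = large-zipWith U λ {p} → D.trans p
                    }
                  ; ∙-cong = large-zipWith U λ {p} → D.+-cong p
                  }
                ; assoc = λ x y z → everywhere λ p → D.+-assoc p (x p) (y p) (z p)
                }
              ; identity = (λ x → everywhere λ p → D.+-identityˡ p (x p)) ,
                           (λ x → everywhere λ p → D.+-identityʳ p (x p))
              }
            ; inverse = (λ x → everywhere λ p → D.-‿inverseˡ p (x p)) ,
                        (λ x → everywhere λ p → D.-‿inverseʳ p (x p))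
            ; ⁻¹-cong = large-⊆ λ p → D.-‿cong p
            }
          ; comm = λ x y → everywhere λ p → D.+-comm p (x p) (y p)
          }
        ; *-cong = large-zipWith U λ {p} → D.*-cong p
        ; *-assoc = λ x y z → everywhere λ p → D.*-assoc p (x p) (y p) (z p)
        ; *-identity = (λ x → everywhere λ p → D.*-identityˡ p (x p)) ,
                       (λ x → everywhere λ p → D.*-identityʳ p (x p))
        ; distrib = (λ x y z → everywhere λ p → D.distribˡ p (x p) (y p) (z p)) ,
                    (λ x y z → everywhere λ p → D.distribʳ p (x p) (y p) (z p))
        }
      ; *-comm = λ x y → everywhere λ p → D.*-comm p (x p) (y p)
      }
    ; 0≉1 = λ large → large-⊥ (large-⊆ (λ p → D.0≉1 p) large)
    ; 0⊎invertible = zero⊎invertible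
    ; unary-cong = large-⊆ λ p → D.unary-cong p
    ; unary-* = λ x y → everywhere λ p → D.unary-* p (x p) (y p)
    ; unary-1 = everywhere λ p → D.unary-1 p
    }
    where
    everywhere : {P : Pred ℙ 0ℓ} → (∀ p → P p) → Large P
    everywhere = large-everywhere U
    open Structure (ultraproduct U S) using (_≈_; _*_; 0#; 1#)
    zero⊎invertible : ∀ x → (x ≈ 0#) ⊎ (∃[ y ] ((x * y) ≈ 1#))
    zero⊎invertible x with ultra (λ p → Structure._≈_ (S p) (x p) (Structure.0# (S p)))
    ... | inj₁ x≈0 = inj₁ x≈0
    ... | inj₂ x≉0 = let y , y-good = choice in
      inj₂ (y , large-⊆ (λ p xp≉0 → y-good p (invertible p (D.0⊎invertible p (x p)) xp≉0)) x≉0)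
      where
      invertible : ∀ p → _ ⊎ _ → ¬ _ → _
      invertible p (inj₁ x≈0) x≉0 = ⊥-elim (x≉0 x≈0)
      invertible p (inj₂ x⁻¹) _   = x⁻¹

module _ (em : LEM) {S : Structure ℒσ} (E : SaturatedExtension S) (isDF : IsDifferenceField S) where
  open SaturatedExtension E
  private
    module S = DifferenceField isDF

    infixr 3 _⇒_
    _⇒_ : ∀ {n} → Formula ⊥ ℒσ n → Formula ⊥ ℒσ n → Formula ⊥ ℒσ n
    φ ⇒ ψ = neg φ ∨ ψ

    implication : {P Q : Set} → (P → Q) → ¬ P ⊎ Q
    implication {P} f with em {P}
    ... | yes p = inj₂ (f p)
    ... | no ¬p = inj₁ ¬p

    modusPonens : {P Q : Set} → ¬ P ⊎ Q → P → Q
    modusPonens (inj₁ ¬p) p = ⊥-elim (¬p p)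
    modusPonens (inj₂ q)  _ = q

    transfer : ∀ (φ : Formula ⊥ ℒσ 0) → Sat S noParams φ [] → Sat M noParams φ []
    transfer φ = to (elementary φ [])

    x : ∀ {n} → Term ⊥ ℒσ (suc n)
    x = var zero
    y : ∀ {n} → Term ⊥ ℒσ (suc (suc n))
    y = var (suc zero)
    z : ∀ {n} → Term ⊥ ℒσ (suc (suc (suc n)))
    z = var (suc (suc zero))
    w : ∀ {n} → Term ⊥ ℒσ (suc (suc (suc (suc n))))
    w = var (suc (suc (suc zero)))

  -- Equality of M comes without axioms, so even its being a congruence is written as sentences and
  -- transferred by elementarity.
  extension-isDifferenceField : IsDifferenceField M
  extension-isDifferenceField = record
    { isCommutativeRing = record
      { isRing = record
        { +-isAbelianGroup = record
          { isGroup = record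
            { isMonoid = record
              { isSemigroup = record
                { isMagma = record
                  { isEquivalence = record
                    { refl  = λ {a} → transfer (all (x ≐ x)) (λ a → S.refl) a
                    ; sym   = λ {a} {b} → modusPonens (transfer (all (all (y ≐ x ⇒ x ≐ y)))
                                (λ a b → implication S.sym) a b)
                    ; trans = λ {a} {b} {c} a≈b → modusPonens (modusPonens
                                (transfer (all (all (all (z ≐ y ⇒ y ≐ x ⇒ z ≐ x))))
                                  (λ a b c → implication λ a≈b → implication (S.trans a≈b)) a b c) a≈b)
                    }
                  ; ∙-cong = λ {a} {b} {c} {d} a≈b → modusPonens (modusPonens
                      (transfer (all (all (all (all (z ≐ w ⇒ x ≐ y ⇒ z ⊕ x ≐ w ⊕ y)))))
                        (λ b a d c → implication λ a≈b → implication (S.+-cong a≈b)) b a d c) a≈b)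
                  }
                ; assoc = transfer (all (all (all ((z ⊕ y) ⊕ x ≐ z ⊕ (y ⊕ x))))) S.+-assoc
                }
              ; identity = transfer (all (𝟘 ⊕ x ≐ x)) S.+-identityˡ , transfer (all (x ⊕ 𝟘 ≐ x)) S.+-identityʳ
              }
            ; inverse = transfer (all (⊝ x ⊕ x ≐ 𝟘)) S.-‿inverseˡ , transfer (all (x ⊕ ⊝ x ≐ 𝟘)) S.-‿inverseʳ
            ; ⁻¹-cong = λ {a} {b} → modusPonens (transfer (all (all (y ≐ x ⇒ ⊝ y ≐ ⊝ x)))
                                (λ a b → implication S.-‿cong) a b)
            }
          ; comm = transfer (all (all (y ⊕ x ≐ x ⊕ y))) S.+-comm
          }
        ; *-cong = λ {a} {b} {c} {d} a≈b → modusPonens (modusPonens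
            (transfer (all (all (all (all (z ≐ w ⇒ x ≐ y ⇒ z ⊗ x ≐ w ⊗ y)))))
              (λ b a d c → implication λ a≈b → implication (S.*-cong a≈b)) b a d c) a≈b)
        ; *-assoc = transfer (all (all (all ((z ⊗ y) ⊗ x ≐ z ⊗ (y ⊗ x))))) S.*-assoc
        ; *-identity = transfer (all (𝟙 ⊗ x ≐ x)) S.*-identityˡ , transfer (all (x ⊗ 𝟙 ≐ x)) S.*-identityʳ
        ; distrib = transfer (all (all (all (z ⊗ (y ⊕ x) ≐ z ⊗ y ⊕ z ⊗ x)))) S.distribˡ ,
                    transfer (all (all (all ((y ⊕ x) ⊗ z ≐ y ⊗ z ⊕ x ⊗ z)))) S.distribʳ
        }
      ; *-comm = transfer (all (all (y ⊗ x ≐ x ⊗ y))) S.*-comm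
      }
    ; 0≉1 = transfer (neg (𝟘 ≐ 𝟙)) S.0≉1
    ; 0⊎invertible = transfer (all ((x ≐ 𝟘) ∨ ex (y ⊗ x ≐ 𝟙))) S.0⊎invertible
    ; unary-cong = λ {a} {b} → modusPonens (transfer (all (all (y ≐ x ⇒ σ y ≐ σ x)))
                     (λ a b → implication S.unary-cong) a b)
    ; unary-* = transfer (all (all (σ (y ⊗ x) ≐ σ y ⊗ σ x))) S.unary-*
    ; unary-1 = transfer (σ 𝟙 ≐ 𝟙) S.unary-1
    }

  private module M = DifferenceField extension-isDifferenceField

  extension-isEmbedding : IsEmbedding S M j
  extension-isEmbedding = record
    { ≈-cong      = λ {a} {b} → to (elementary (x ≐ y) (a ∷ b ∷ []))
    ; ≈-injective = λ {a} {b} → from (elementary (x ≐ y) (a ∷ b ∷ []))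
    ; +-homo      = λ a b → to (elementary (x ≐ y ⊕ z) (a S.+ b ∷ a ∷ b ∷ [])) S.refl
    ; *-homo      = λ a b → to (elementary (x ≐ y ⊗ z) (a S.* b ∷ a ∷ b ∷ [])) S.refl
    ; -‿homo      = λ a → to (elementary (x ≐ ⊝ y) (S.- a ∷ a ∷ [])) S.refl
    ; 0-homo      = to (elementary (x ≐ 𝟘) (S.0# ∷ [])) S.refl
    ; 1-homo      = to (elementary (x ≐ 𝟙) (S.1# ∷ [])) S.refl
    ; unary-homo  = λ a → to (elementary (x ≐ σ y) (S.unary a ∷ a ∷ [])) S.refl
    }

  -- Saturation is stated for types with constants in S, so r is first renamed along f.
  realization : {C : Set} (f : C → Dom S) → ∀ {n} (r : PartialType C n) →
    FinitelySatisfiable M (j ∘ f) r → ∃[ v ] (_Realizes_ M (j ∘ f) v r)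
  realization {C} f {n} r sat with saturated j renamed renamed-sat
    where
    renamed : PartialType (Dom S) n
    renamed φ = ∃[ ψ ] (r ψ × φ ≡ mapCon f ψ)
    originals : ∀ Φ → All renamed Φ → Σ[ Ψ ∈ List _ ] (All r Ψ × (∀ v →
      All (λ ψ → Sat M (j ∘ f) ψ v) Ψ → All (λ φ → Sat M j φ v) Φ))
    originals [] [] = [] , [] , λ v _ → []
    originals (φ ∷ Φ) ((ψ , rψ , ≡.refl) ∷ rs) = let Ψ , rΨ , entail = originals Φ rs in
      ψ ∷ Ψ , rψ ∷ rΨ , λ { v (ψv ∷ Ψv) → from (Sat-mapCon f M j ψ v) ψv ∷ entail v Ψv }
    renamed-sat : FinitelySatisfiable M j renamed
    renamed-sat Φ rs = let Ψ , rΨ , entail = originals Φ rs ; v , Ψv = sat Ψ rΨ in v , entail v Ψv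
  ... | v , v⊨ = v , λ φ rφ → to (Sat-mapCon f M j φ v) (v⊨ (mapCon f φ) (φ , rφ , ≡.refl))

-- Real numbers

module RealLemmas (em : LEM) (𝓡 : Reals) where
  open Reals 𝓡
  open IsTotalOrder isTotalOrder public using (total; antisym; isPartialOrder)
    renaming (refl to ≤-refl; trans to ≤-trans; reflexive to ≤-reflexive)
  open SemiringSolver commutativeSemiring using (solve; _:+_; _:*_; _:=_)
  open Ringₚ ring using (-‿distribˡ-*; -‿distribʳ-*; -‿involutive; -‿+-comm)

  ℝ-poset : Poset 0ℓ 0ℓ 0ℓ
  ℝ-poset = record { isPartialOrder = isPartialOrder }
  open PosetReasoning ℝ-poset

  ≰⇒≥ : ∀ {x y} → ¬ (x ≤ y) → y ≤ x
  ≰⇒≥ {x} {y} x≰y with total x y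
  ... | inj₁ x≤y = ⊥-elim (x≰y x≤y)
  ... | inj₂ y≤x = y≤x

  ≰⇒> : ∀ {x y} → ¬ (x ≤ y) → y < x
  ≰⇒> x≰y = ≰⇒≥ x≰y , λ y≈x → x≰y (≤-reflexive (sym y≈x))

  <⇒≱ : ∀ {x y} → x < y → ¬ (y ≤ x)
  <⇒≱ (x≤y , x≉y) y≤x = x≉y (antisym x≤y y≤x)

  <-≤-trans : ∀ {x y z} → x < y → y ≤ z → x < z
  <-≤-trans x<y y≤z = ≤-trans (proj₁ x<y) y≤z , λ x≈z → <⇒≱ x<y (≤-trans y≤z (≤-reflexive (sym x≈z)))

  ≤-<-trans : ∀ {x y z} → x ≤ y → y < z → x < z
  ≤-<-trans x≤y y<z = ≤-trans x≤y (proj₁ y<z) , λ x≈z → <⇒≱ y<z (≤-trans (≤-reflexive (sym x≈z)) x≤y)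

  +-mono₂-≤ : ∀ {x y u v} → x ≤ y → u ≤ v → x + u ≤ y + v
  +-mono₂-≤ {x} {y} {u} {v} x≤y u≤v = begin
    x + u  ≤⟨ +-mono-≤ u x≤y ⟩
    y + u  ≈⟨ +-comm y u ⟩
    u + y  ≤⟨ +-mono-≤ y u≤v ⟩
    v + y  ≈⟨ +-comm v y ⟩
    y + v  ∎

  +-cancelʳ-≤ : ∀ {x y} z → x + z ≤ y + z → x ≤ y
  +-cancelʳ-≤ {x} {y} z x+z≤y+z = begin
    x              ≈⟨ cancel x ⟨
    (x + z) + - z  ≤⟨ +-mono-≤ (- z) x+z≤y+z ⟩
    (y + z) + - z  ≈⟨ cancel y ⟩
    y              ∎
    where
    cancel : ∀ u → (u + z) + - z ≈ u
    cancel u = trans (+-assoc u z (- z)) (trans (+-congˡ (-‿inverseʳ z)) (+-identityʳ u))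

  x-y+y≈x : ∀ x y → (x - y) + y ≈ x
  x-y+y≈x x y = trans (+-assoc x (- y) y) (trans (+-congˡ (-‿inverseˡ y)) (+-identityʳ x))

  x≤y+z⇒x-y≤z : ∀ {x y z} → x ≤ y + z → x - y ≤ z
  x≤y+z⇒x-y≤z {x} {y} {z} le = +-cancelʳ-≤ y (begin
    (x - y) + y  ≈⟨ x-y+y≈x x y ⟩
    x            ≤⟨ le ⟩
    y + z        ≈⟨ +-comm y z ⟩
    z + y        ∎)

  x-y≤z⇒x≤y+z : ∀ {x y z} → x - y ≤ z → x ≤ y + z
  x-y≤z⇒x≤y+z {x} {y} {z} le = begin
    x            ≈⟨ x-y+y≈x x y ⟨
    (x - y) + y  ≤⟨ +-mono-≤ y le ⟩
    z + y        ≈⟨ +-comm z y ⟩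
    y + z        ∎

  -[x-y]≈y-x : ∀ x y → - (x - y) ≈ y - x
  -[x-y]≈y-x x y = trans (sym (-‿+-comm x (- y))) (trans (+-congˡ (-‿involutive y)) (+-comm (- x) y))

  ∣-∣≤⁺ : ∀ {x r ε} → x ≤ r + ε → r ≤ x + ε → ∣ x - r ∣≤ ε
  ∣-∣≤⁺ {x} {r} x≤ r≤ = x≤y+z⇒x-y≤z x≤ , ≤-trans (≤-reflexive (-[x-y]≈y-x x r)) (x≤y+z⇒x-y≤z r≤)

  ∣-∣≤⁻¹ : ∀ {x r ε} → ∣ x - r ∣≤ ε → x ≤ r + ε
  ∣-∣≤⁻¹ = x-y≤z⇒x≤y+z ∘ proj₁

  ∣-∣≤⁻² : ∀ {x r ε} → ∣ x - r ∣≤ ε → r ≤ x + ε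
  ∣-∣≤⁻² {x} {r} (_ , le) = x-y≤z⇒x≤y+z (≤-trans (≤-reflexive (sym (-[x-y]≈y-x x r))) le)

  *-monoˡ-≤ : ∀ {x y c} → 0# ≤ c → x ≤ y → c * x ≤ c * y
  *-monoˡ-≤ {x} {y} {c} 0≤c x≤y = begin
    c * x                        ≈⟨ +-identityˡ _ ⟨
    0# + c * x                   ≤⟨ +-mono-≤ (c * x) (*-nonneg 0≤c 0≤y-x) ⟩
    c * (y - x) + c * x          ≈⟨ distribˡ c (y - x) x ⟨
    c * ((y - x) + x)            ≈⟨ *-congˡ (x-y+y≈x y x) ⟩
    c * y                        ∎
    where
    0≤y-x : 0# ≤ y - x
    0≤y-x = begin
      0#     ≈⟨ -‿inverseʳ x ⟨
      x - x  ≤⟨ +-mono-≤ (- x) x≤y ⟩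
      y - x  ∎

  *-monoʳ-≤ : ∀ {x y c} → 0# ≤ c → x ≤ y → x * c ≤ y * c
  *-monoʳ-≤ {x} {y} {c} 0≤c x≤y = begin
    x * c  ≈⟨ *-comm x c ⟩
    c * x  ≤⟨ *-monoˡ-≤ 0≤c x≤y ⟩
    c * y  ≈⟨ *-comm c y ⟩
    y * c  ∎

  0≤1 : 0# ≤ 1#
  0≤1 with total 0# 1#
  ... | inj₁ 0≤1 = 0≤1
  ... | inj₂ 1≤0 = begin
    0#           ≤⟨ *-nonneg 0≤-1 0≤-1 ⟩
    - 1# * - 1#  ≈⟨ trans (sym (-‿distribˡ-* 1# (- 1#))) (trans (-‿cong (*-identityˡ _)) (-‿involutive 1#)) ⟩
    1#           ∎
    where
    0≤-1 : 0# ≤ - 1#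
    0≤-1 = begin
      0#         ≈⟨ -‿inverseʳ 1# ⟨
      1# + - 1#  ≤⟨ +-mono-≤ (- 1#) 1≤0 ⟩
      0# + - 1#  ≈⟨ +-identityˡ _ ⟩
      - 1#       ∎

  0<1 : 0# < 1#
  0<1 = 0≤1 , 0≉1

  x≤x+y : ∀ {x y} → 0# ≤ y → x ≤ x + y
  x≤x+y {x} {y} 0≤y = begin
    x       ≈⟨ +-identityʳ x ⟨
    x + 0#  ≤⟨ +-mono₂-≤ ≤-refl 0≤y ⟩
    x + y   ∎

  >⇒≉ : ∀ {x} → 0# < x → ¬ (x ≈ 0#)
  >⇒≉ (_ , 0≉x) x≈0 = 0≉x (sym x≈0)

  ÷-inverse : ∀ {x y} → 0# < y → (x * y ⁻¹) * y ≈ x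
  ÷-inverse {x} {y} 0<y = trans (solve 3 (λ x y z → (x :* z) :* y := x :* (y :* z)) refl x y (y ⁻¹))
    (trans (*-congˡ (⁻¹-inverse (>⇒≉ 0<y))) (*-identityʳ x))

  ⁻¹-nonneg : ∀ {x} → 0# < x → 0# ≤ x ⁻¹
  ⁻¹-nonneg {x} 0<x with total 0# (x ⁻¹)
  ... | inj₁ le = le
  ... | inj₂ x⁻¹≤0 = ⊥-elim (<⇒≱ 0<1 (begin
    1#        ≈⟨ ⁻¹-inverse (>⇒≉ 0<x) ⟨
    x * x ⁻¹  ≤⟨ *-monoˡ-≤ (proj₁ 0<x) x⁻¹≤0 ⟩
    x * 0#    ≈⟨ zeroʳ x ⟩
    0#        ∎))

  *-pos : ∀ {x y} → 0# < x → 0# < y → 0# < x * y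
  *-pos {x} {y} 0<x 0<y = *-nonneg (proj₁ 0<x) (proj₁ 0<y) , λ 0≈xy → proj₂ 0<x (begin-equality
    0#              ≈⟨ zeroˡ _ ⟨
    0# * y ⁻¹       ≈⟨ *-congʳ 0≈xy ⟩
    x * y * y ⁻¹    ≈⟨ *-assoc x y (y ⁻¹) ⟩
    x * (y * y ⁻¹)  ≈⟨ *-congˡ (⁻¹-inverse (>⇒≉ 0<y)) ⟩
    x * 1#          ≈⟨ *-identityʳ x ⟩
    x               ∎)

  ⁻¹-pos : ∀ {x} → 0# < x → 0# < x ⁻¹
  ⁻¹-pos {x} 0<x = ⁻¹-nonneg 0<x , λ 0≈x⁻¹ → 0≉1 (begin-equality
    0#        ≈⟨ zeroʳ x ⟨
    x * 0#    ≈⟨ *-congˡ 0≈x⁻¹ ⟩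
    x * x ⁻¹  ≈⟨ ⁻¹-inverse (>⇒≉ 0<x) ⟩
    1#        ∎)

  *-cancelʳ-≤ : ∀ {x y c} → 0# < c → x * c ≤ y * c → x ≤ y
  *-cancelʳ-≤ {x} {y} {c} 0<c le = begin
    x               ≈⟨ cancel x ⟨
    (x * c) * c ⁻¹  ≤⟨ *-monoʳ-≤ (⁻¹-nonneg 0<c) le ⟩
    (y * c) * c ⁻¹  ≈⟨ cancel y ⟩
    y               ∎
    where
    cancel : ∀ x → (x * c) * c ⁻¹ ≈ x
    cancel x = trans (*-assoc x c (c ⁻¹)) (trans (*-congˡ (⁻¹-inverse (>⇒≉ 0<c))) (*-identityʳ x))

  open Multₚ semiring using (×-homo-+; ×1-homo-*)

  fromℕ-nonneg : ∀ n → 0# ≤ fromℕ n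
  fromℕ-nonneg zero    = ≤-refl
  fromℕ-nonneg (suc n) = ≤-trans 0≤1 (x≤x+y (fromℕ-nonneg n))

  fromℕ-pos : ∀ {n} → 0 ℕ.< n → 0# < fromℕ n
  fromℕ-pos {suc n} _ = <-≤-trans 0<1 (x≤x+y (fromℕ-nonneg n))

  fromℕ-mono-≤ : ∀ {m n} → m ℕ.≤ n → fromℕ m ≤ fromℕ n
  fromℕ-mono-≤ {n = n} z≤n = fromℕ-nonneg n
  fromℕ-mono-≤ (s≤s m≤n)   = +-mono₂-≤ ≤-refl (fromℕ-mono-≤ m≤n)

  x<1+x : ∀ x → x < 1# + x
  x<1+x x = (begin
      x       ≈⟨ +-identityˡ x ⟨
      0# + x  ≤⟨ +-mono-≤ x 0≤1 ⟩
      1# + x  ∎) ,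
    λ x≈1+x → <⇒≱ 0<1 (+-cancelʳ-≤ x (≤-reflexive (sym (trans (+-identityˡ x) x≈1+x))))

  fromℕ-cancel-≤ : ∀ {m n} → fromℕ m ≤ fromℕ n → m ℕ.≤ n
  fromℕ-cancel-≤ {m} {n} le with m ℕₚ.≤? n
  ... | yes m≤n = m≤n
  ... | no  m≰n = ⊥-elim (<⇒≱ (x<1+x (fromℕ n)) (≤-trans (fromℕ-mono-≤ (ℕₚ.≰⇒> m≰n)) le))

  fromℕ-* : ∀ m n → fromℕ (m ℕ.* n) ≈ fromℕ m * fromℕ n
  fromℕ-* = ×1-homo-*

  -- Otherwise the natural numbers have a supremum s, and s - 1 is an upper bound too.
  archimedean : ∀ x → ∃[ n ] (x ≤ fromℕ n)
  archimedean x = Classical.byContradiction em λ unbounded →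
    let bounded : ∀ y → ∃[ n ] (y ≈ fromℕ n) → y ≤ x
        bounded = λ { y (n , y≈n) → ≤-trans (≤-reflexive y≈n) (≰⇒≥ λ x≤n → unbounded (n , x≤n)) }
        s , upper , least = sup (λ y → ∃[ n ] (y ≈ fromℕ n)) (0# , 0 , refl) (x , bounded)
        s-1-upper : ∀ y → ∃[ n ] (y ≈ fromℕ n) → y ≤ s - 1#
        s-1-upper = λ { y (n , y≈n) → +-cancelʳ-≤ 1# (begin
          y + 1#          ≈⟨ trans (+-congʳ y≈n) (+-comm _ 1#) ⟩
          fromℕ (suc n)   ≤⟨ upper _ (suc n , refl) ⟩
          s               ≈⟨ x-y+y≈x s 1# ⟨
          (s - 1#) + 1#   ∎) }
    in <⇒≱ (x<1+x s) (begin
      1# + s         ≤⟨ +-mono₂-≤ ≤-refl (least (s - 1#) s-1-upper) ⟩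
      1# + (s - 1#)  ≈⟨ trans (+-comm 1# (s - 1#)) (x-y+y≈x s 1#) ⟩
      s              ∎)

  third : ∀ {ε} → 0# < ε → ∃[ t ] (0# < t × t + t + t ≈ ε)
  third {ε} 0<ε = ε * 3⁻¹ , *-pos 0<ε (⁻¹-pos 0<3) , (begin-equality
    ε * 3⁻¹ + ε * 3⁻¹ + ε * 3⁻¹     ≈⟨ solve 3 (λ ε t o → ε :* t :+ ε :* t :+ ε :* t :=
                                         ε :* t :+ (ε :* t :+ (ε :* t))) refl ε 3⁻¹ 0# ⟩
    ε * 3⁻¹ + (ε * 3⁻¹ + ε * 3⁻¹)   ≈⟨ +-cong one≈ (+-cong one≈ one≈) ⟩
    1# * y + (1# * y + 1# * y)        ≈⟨ solve 3 (λ a y o → a :* y :+ (a :* y :+ a :* y) :=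
                                          (a :+ (a :+ a)) :* y) refl 1# y 0# ⟩
    (1# + (1# + 1#)) * y              ≈⟨ *-congʳ (+-congˡ (+-congˡ (+-identityʳ 1#))) ⟨
    fromℕ 3 * y                       ≈⟨ *-comm _ y ⟩
    y * fromℕ 3                       ≈⟨ ÷-inverse 0<3 ⟩
    ε                                 ∎)
    where
    0<3 = fromℕ-pos {3} (s≤s z≤n)
    3⁻¹ = fromℕ 3 ⁻¹
    y = ε * 3⁻¹
    one≈ : y ≈ 1# * y
    one≈ = sym (*-identityˡ y)

  ≤-byApproximation : ∀ {x y} → (∀ ε → 0# < ε → x ≤ y + (ε + ε)) → x ≤ y
  ≤-byApproximation {x} {y} approx = Classical.byContradiction em λ x≰y →
    let 0<x-y : 0# < x - y
        0<x-y = ≰⇒> λ x-y≤0 → x≰y (≤-trans (x-y≤z⇒x≤y+z x-y≤0) (≤-reflexive (+-identityʳ y)))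
        t , 0<t , 3t≈x-y = third 0<x-y
    -- With 3t = x - y, the hypothesis for t says 3t ≤ 2t.
    in <⇒≱ 0<t (+-cancelʳ-≤ (t + t) (begin
      t + (t + t)    ≈⟨ trans (sym (+-assoc t t t)) 3t≈x-y ⟩
      x - y          ≤⟨ x≤y+z⇒x-y≤z (approx t 0<t) ⟩
      t + t          ≈⟨ +-identityˡ _ ⟨
      0# + (t + t)   ∎))

  log-mono-≤ : ∀ {x y} → 0# < x → x ≤ y → log x ≤ log y
  log-mono-≤ {x} {y} 0<x x≤y with em {x ≈ y}
  ... | yes x≈y = ≤-reflexive (log-cong x≈y)
  ... | no  x≉y = proj₁ (log-mono 0<x (x≤y , x≉y))

  log-1 : log 1# ≈ 0#
  log-1 = Ringₚ.+-cancelʳ ring (log 1#) (log 1#) 0# (begin-equality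
    log 1# + log 1#  ≈⟨ log-* 0<1 0<1 ⟨
    log (1# * 1#)    ≈⟨ log-cong (*-identityʳ 1#) ⟩
    log 1#           ≈⟨ +-identityˡ _ ⟨
    0# + log 1#      ∎)

  logℕ : ℕ → ℝ
  logℕ n = log (fromℕ n)

  logℕ-mono-≤ : ∀ {m n} → 0 ℕ.< m → m ℕ.≤ n → logℕ m ≤ logℕ n
  logℕ-mono-≤ 0<m m≤n = log-mono-≤ (fromℕ-pos 0<m) (fromℕ-mono-≤ m≤n)

  logℕ-1 : logℕ 1 ≈ 0#
  logℕ-1 = trans (log-cong (+-identityʳ 1#)) log-1

  logℕ-* : ∀ {m n} → 0 ℕ.< m → 0 ℕ.< n → logℕ (m ℕ.* n) ≈ logℕ m + logℕ n
  logℕ-* {m} {n} 0<m 0<n = trans (log-cong (fromℕ-* m n)) (log-* (fromℕ-pos 0<m) (fromℕ-pos 0<n))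

  ^-pos : ∀ {n} → 0 ℕ.< n → ∀ k → 0 ℕ.< n ℕ.^ k
  ^-pos {n} 0<n zero    = s≤s z≤n
  ^-pos {n} 0<n (suc k) = ℕₚ.*-mono-< 0<n (^-pos 0<n k)

  logℕ-^ : ∀ {n} → 0 ℕ.< n → ∀ k → logℕ (n ℕ.^ k) ≈ fromℕ k * logℕ n
  logℕ-^ {n} 0<n zero    = trans logℕ-1 (sym (zeroˡ _))
  logℕ-^ {n} 0<n (suc k) = begin-equality
    logℕ (n ℕ.* n ℕ.^ k)          ≈⟨ logℕ-* 0<n (^-pos 0<n k) ⟩
    logℕ n + logℕ (n ℕ.^ k)       ≈⟨ +-cong (sym (*-identityˡ _)) (logℕ-^ 0<n k) ⟩
    1# * logℕ n + fromℕ k * logℕ n ≈⟨ distribʳ _ 1# (fromℕ k) ⟨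
    fromℕ (suc k) * logℕ n        ∎

  logℕ-nonneg : ∀ {n} → 0 ℕ.< n → 0# ≤ logℕ n
  logℕ-nonneg 0<n = ≤-trans (≤-reflexive (sym logℕ-1)) (logℕ-mono-≤ (s≤s z≤n) 0<n)

  logℕ-pos : ∀ {n} → 1 ℕ.< n → 0# < logℕ n
  logℕ-pos {n} 1<n = ≤-<-trans (≤-reflexive (sym logℕ-1)) (log-mono (fromℕ-pos {1} (s≤s z≤n))
    (fromℕ-mono-≤ {1} (ℕₚ.<⇒≤ 1<n) , λ 1≈n → ℕₚ.<⇒≱ 1<n (fromℕ-cancel-≤ {n} {1} (≤-reflexive (sym 1≈n)))))

-- Growth of k_p and standard parts

module _ (U : NonPrincipalUltrafilter) where
  open NonPrincipalUltrafilter U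

  large-const : LEM → {P : Set} → Large (λ _ → P) → P
  large-const em large = Classical.byContradiction em λ ¬p → large-⊥ (large-⊆ (λ _ → ¬p) large)

  large-∃ : LEM → {P : Pred ℙ 0ℓ} → Large P → ∃ P
  large-∃ em large = large-const em (large-⊆ (λ p Pp → p , Pp) large)

  -- Each number is the value of at most one index, and non-principality discards that index.
  large-≥ : LEM → ∀ n → Large (λ p → n ℕ.≤ value p)
  large-≥ em zero    = large-everywhere U λ _ → z≤n
  large-≥ em (suc n) with ultra (λ p → value p ≡ n)
  ... | inj₂ p≢n = large-zipWith U (λ n≤p p≢n → ℕₚ.≤∧≢⇒< n≤p (p≢n ∘ ≡.sym)) (large-≥ em n) p≢n
  ... | inj₁ p≡n with large-∃ em p≡n
  ... | p₀ , p₀≡n = ⊥-elim (nonPrincipal p₀ (large-⊆ (λ p p≡n → point (≡.trans p≡n (≡.sym p₀≡n))) p≡n))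
    where
    point : ∀ {p : ℙ} → value p ≡ value p₀ → p ≡ p₀
    point = value-injective

oneOf : ∀ {L k} → Fin k → List (Fin k) → Formula ⊥ L k
oneOf i = List.foldr (λ j φ → (var i ≐ var j) ∨ φ) (neg (𝟘 ≐ 𝟘))

-- Without σ the translation to rings is the identity, so the counting constants of this formula are
-- the same for all p.
oneOf-⟨⟩ : ∀ {k} (i : Fin k) js p → oneOf i js ⟨ p ⟩ ≡ oneOf i js
oneOf-⟨⟩ i []       p = ≡.refl
oneOf-⟨⟩ i (j ∷ js) p = ≡.cong ((var i ≐ var j) ∨_) (oneOf-⟨⟩ i js p)

module _ (K : Field) where
  open Field K

  oneOf⁻ : ∀ {k} {v : Vec Carrier k} i js → Sat ringStructure noParams (oneOf i js) v →
    Any (λ j → lookup v i ≈ lookup v j) js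
  oneOf⁻ i []       0≉0       = ⊥-elim (0≉0 refl)
  oneOf⁻ i (j ∷ js) (inj₁ eq) = here eq
  oneOf⁻ i (j ∷ js) (inj₂ φv) = there (oneOf⁻ i js φv)

  oneOf⁺ : ∀ {k} {v : Vec Carrier k} {i js} → Any (λ j → lookup v i ≈ lookup v j) js →
    Sat ringStructure noParams (oneOf i js) v
  oneOf⁺ (here eq)   = inj₁ eq
  oneOf⁺ (there any) = inj₂ (oneOf⁺ any)

-- x ∈ {a₁, …, aₙ}, with x the first variable.
membershipFormula : ∀ {L} n → Formula ⊥ L (1 ℕ.+ n)
membershipFormula n = oneOf zero (List.tabulate suc)

membership-hasCard : (K : Field) → ∀ {n} (a : Vec (Field.Carrier K) n) →
  (∀ {i j} → Field._≈_ K (lookup a i) (lookup a j) → i ≡ j) →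
  HasCard (Field.tuples K 1) (λ v → Sat (Field.ringStructure K) noParams (membershipFormula n) (v ++ a)) n
membership-hasCard K {n} a distinct =
  List.tabulate (λ i → lookup a i ∷ []) , Listₚ.length-tabulate _ ,
  Uniqueₚ.tabulate⁺ (Field.tuples K 1) (λ { (eq ∷ []) → distinct eq }) ,
  Allₚ.tabulate⁺ (λ i → oneOf⁺ K (Anyₚ.tabulate⁺ i refl)) ,
  λ { (x ∷ []) φx → let i , eq = Anyₚ.tabulate⁻ (oneOf⁻ K zero (List.tabulate suc) φx) in
        Anyₚ.tabulate⁺ i (eq ∷ []) }
  where open Field K hiding (zero)

distinctElements : (K : FiniteField) → ∀ {n} → n ℕ.≤ FiniteField.q K →
  Σ[ a ∈ Vec (FiniteField.Carrier K) n ] (∀ {i j} → FiniteField._≈_ K (lookup a i) (lookup a j) → i ≡ j)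
distinctElements K {n} n≤q with FiniteField.isSize K
... | xs , ≡.refl , u , _ = Vec.tabulate f , λ {i} {j} eq → Finₚ.inject≤-injective n≤q n≤q i j
    (Listings.Unique-lookup-injective setoid u (Fin.inject≤ i n≤q) (Fin.inject≤ j n≤q)
      (trans (reflexive (≡.sym (Vecₚ.lookup∘tabulate f i))) (trans eq (reflexive (Vecₚ.lookup∘tabulate f j)))))
  where
  open FiniteField K
  f : Fin n → Carrier
  f i = List.lookup xs (Fin.inject≤ i n≤q)

1<q : (K : FiniteField) → 1 ℕ.< FiniteField.q K
1<q K with FiniteField.isSize K
... | xs , ≡.refl , _ , _ , listed = Listings.Unique∧⊆⇒length≤ setoid {0# ∷ 1# ∷ []}
    ((0≉1 ∷ []) ∷ [] ∷ []) (listed 0# tt ∷ listed 1# tt ∷ [])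
  where open FiniteField K

module _ (em : LEM) {𝓡 : Reals} {cdm : CountingConstants 𝓡} (𝓕 : 𝒮 𝓡 cdm) where
  open Reals 𝓡 hiding (zero)
  open RealLemmas em 𝓡
  open CountingConstants cdm using (C-pos; D-pos; estimate)
  open 𝒮 𝓕
  open PosetReasoning ℝ-poset
  open SemiringSolver commutativeSemiring using (solve; _:+_; _:*_; _:=_)

  q : ℙ → ℕ
  q p = FiniteField.q (𝔽 p)

  1<p^k : ∀ p → 1 ℕ.< value p ℕ.^ k p
  1<p^k p = ≡.subst (1 ℕ.<_) (size𝔽 p) (1<q (𝔽 p))

  -- The primality proof in `ℙ` is irrelevant, so the bound is read off from p^k = q > 1.
  1<p : ∀ p → 1 ℕ.< value p
  1<p p with 1 ℕₚ.<? value p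
  ... | yes 1<p = 1<p
  ... | no  1≮p = ⊥-elim (ℕₚ.<⇒≱ (1<p^k p)
    (ℕₚ.≤-trans (ℕₚ.^-monoˡ-≤ (k p) (ℕₚ.≮⇒≥ 1≮p)) (ℕₚ.≤-reflexive (ℕₚ.^-zeroˡ (k p)))))

  p≤q : ∀ p → value p ℕ.≤ q p
  p≤q p with k p | size𝔽 p | 1<p^k p
  ... | zero  | _  | s≤s ()
  ... | suc k | eq | _ = ≡.subst (value p ℕ.≤_) (≡.sym eq)
    (ℕₚ.m≤m*n (value p) (value p ℕ.^ k) ⦃ ℕₚ.m^n≢0 (value p) k ⦃ ℕ.>-nonZero (ℕₚ.<-trans (s≤s z≤n) (1<p p)) ⦄ ⦄)

  0<q : ∀ p → 0 ℕ.< q p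
  0<q p = ℕₚ.<-trans (s≤s z≤n) (1<q (𝔽 p))

  large-q : ∀ n → Large (λ p → n ℕ.≤ q p)
  large-q n = large-⊆ (λ p n≤p → ℕₚ.≤-trans n≤p (p≤q p)) (large-≥ U em n)

  large-√q : ∀ x → Large (λ p → x ≤ √ fromℕ (q p))
  large-√q x with archimedean (x * x)
  ... | n , x²≤n = large-⊆ bound (large-q (suc n))
    where
    bound : ∀ p → suc n ℕ.≤ q p → x ≤ √ fromℕ (q p)
    bound p n<q = Classical.byContradiction em λ x≰s →
      let s≤x = ≰⇒≥ x≰s ; 0≤x = ≤-trans 0≤s s≤x in
      <⇒≱ (x<1+x (fromℕ n)) (begin
        fromℕ (suc n)  ≤⟨ fromℕ-mono-≤ n<q ⟩
        fromℕ (q p)    ≈⟨ √-square (fromℕ-nonneg (q p)) ⟨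
        s * s          ≤⟨ *-monoˡ-≤ 0≤s s≤x ⟩
        s * x          ≤⟨ *-monoʳ-≤ 0≤x s≤x ⟩
        x * x          ≤⟨ x²≤n ⟩
        fromℕ n        ∎)
      where
      s = √ fromℕ (q p)
      0≤s : 0# ≤ s
      0≤s = √-nonneg (fromℕ-nonneg (q p))

  -- A set with n elements in every 𝔽_q forces, for large q, a measure μ ≥ n - 1 to occur
  -- in dimension 0: in dimension 1 the error term √q could not make up for μ q - n.
  measure-bound : ∀ n {Q C} → 0# < Q → 0# < C → let s = √ Q in 1# ≤ s → C ≤ s →
    (d : Fin 2) (μ : ℝ) → 0# < μ → (fromℕ n + C + 1#) * μ ⁻¹ ≤ s →
    ∣ fromℕ n - μ * Q ^ toℕ d ∣≤ (C * (Q ^ toℕ d ÷ s)) → fromℕ n ≤ μ + 1#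
  measure-bound n {Q} {C} 0<Q 0<C 1≤s C≤s zero μ 0<μ _ estimate≤ = begin
    fromℕ n                      ≤⟨ ∣-∣≤⁻¹ estimate≤ ⟩
    μ * 1# + C * (1# * s ⁻¹)     ≤⟨ +-mono₂-≤ (≤-reflexive (*-identityʳ μ)) C/s≤1 ⟩
    μ + 1#                       ∎
    where
    s = √ Q
    0<s = <-≤-trans 0<1 1≤s
    C/s≤1 : C * (1# * s ⁻¹) ≤ 1#
    -- The error term C/√Q is the 1 lost in μ ≥ n - 1.
    C/s≤1 = *-cancelʳ-≤ 0<s (begin
      C * (1# * s ⁻¹) * s  ≈⟨ *-congʳ (*-congˡ (*-identityˡ _)) ⟩
      C * s ⁻¹ * s         ≈⟨ ÷-inverse 0<s ⟩
      C                    ≤⟨ C≤s ⟩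
      s                    ≈⟨ *-identityˡ s ⟨
      1# * s               ∎)
  -- Here (n + C + 1)√Q ≤ μQ ≤ n + C√Q, which is absurd for √Q ≥ 1.
  measure-bound n {Q} {C} 0<Q 0<C 1≤s C≤s (suc zero) μ 0<μ μ-small estimate≤ =
    ⊥-elim (<⇒≱ 0<s (+-cancelʳ-≤ (n′ * s + C * s) (begin
      s + (n′ * s + C * s)        ≈⟨ trans (+-congʳ (sym (*-identityˡ s))) (solve 4 (λ o s n c →
                                       o :* s :+ (n :* s :+ c :* s) := (n :+ c :+ o) :* s) refl 1# s n′ C) ⟩
      (n′ + C + 1#) * s           ≤⟨ *-monoʳ-≤ (proj₁ 0<s) n+C+1≤μs ⟩
      (s * μ) * s                 ≈⟨ solve 2 (λ s μ → (s :* μ) :* s := μ :* (s :* s)) refl s μ ⟩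
      μ * (s * s)                 ≈⟨ *-congˡ (trans s*s≈Q (sym (*-identityʳ Q))) ⟩
      μ * Q ^ 1                   ≤⟨ ∣-∣≤⁻² estimate≤ ⟩
      n′ + C * (Q ^ 1 * s ⁻¹)     ≈⟨ +-congˡ (*-congˡ Q/s≈s) ⟩
      n′ + C * s                  ≤⟨ +-mono-≤ (C * s) (≤-trans (≤-reflexive (sym (*-identityʳ n′)))
                                       (*-monoˡ-≤ (fromℕ-nonneg n) 1≤s)) ⟩
      n′ * s + C * s              ≈⟨ +-identityˡ _ ⟨
      0# + (n′ * s + C * s)       ∎)))
    where
    s = √ Q
    n′ = fromℕ n
    0<s = <-≤-trans 0<1 1≤s
    s*s≈Q : s * s ≈ Q
    s*s≈Q = √-square (proj₁ 0<Q)
    Q/s≈s : Q ^ 1 * s ⁻¹ ≈ s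
    Q/s≈s = begin-equality
      Q * 1# * s ⁻¹     ≈⟨ *-congʳ (trans (*-identityʳ Q) (sym s*s≈Q)) ⟩
      s * s * s ⁻¹      ≈⟨ solve 2 (λ s t → s :* s :* t := s :* t :* s) refl s (s ⁻¹) ⟩
      s * s ⁻¹ * s      ≈⟨ ÷-inverse 0<s ⟩
      s                 ∎
    n+C+1≤μs : n′ + C + 1# ≤ s * μ
    n+C+1≤μs = begin
      n′ + C + 1#              ≈⟨ ÷-inverse 0<μ ⟨
      (n′ + C + 1#) * μ ⁻¹ * μ ≤⟨ *-monoʳ-≤ (proj₁ 0<μ) μ-small ⟩
      s * μ                    ∎

  large-All : {X : Set} {P : X → Pred ℙ 0ℓ} (xs : List X) → (∀ x → Large (P x)) →
    Large (λ p → All (λ x → P x p) xs)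
  large-All []       largeP = large-everywhere U λ _ → []
  large-All (x ∷ xs) largeP = large-zipWith U _∷_ (largeP x) (large-All xs largeP)

  -- Applied to n distinct elements of 𝔽_q, the membership formula has a measure μ ≥ n - 1, and k_p
  -- ≥ f(p,p) ≥ μ once p is at least its length. Which pair (d , μ) occurs may depend on p; since D
  -- is finite, q can be taken large enough for all its pairs at once.
  large-k : ∀ n → Large (λ p → n ℕ.≤ suc (k p))
  large-k n = large-zipWith U (λ {p} → bound p)
    (large-∩ (large-q n) (large-≥ U em (len 1 n φ)))
    (large-∩ (large-∩ (large-√q 1#) (large-√q C))
             (large-All D λ (d , μ) → large-√q ((fromℕ n + C + 1#) * μ ⁻¹)))
    where
    φ : Formula ⊥ ℒσ (1 ℕ.+ n)
    φ = membershipFormula n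
    ψ : Formula ⊥ ℒ-ring (1 ℕ.+ n)
    ψ = membershipFormula n
    C = CountingConstants.C cdm 1 n ψ
    D = CountingConstants.D cdm 1 n ψ
    bound : ∀ p → n ℕ.≤ q p × len 1 n φ ℕ.≤ value p →
      (1# ≤ √ fromℕ (q p) × C ≤ √ fromℕ (q p)) ×
      All (λ (d , μ) → (fromℕ n + C + 1#) * μ ⁻¹ ≤ √ fromℕ (q p)) D → n ℕ.≤ suc (k p)
    bound p (n≤q , len≤p) ((1≤s , C≤s) , μ-small) with n ℕₚ.≟ 0
    ... | yes ≡.refl = z≤n
    ... | no  n≢0 with distinctElements (𝔽 p) n≤q
    ... | a , distinct with estimate 1 n ψ (𝔽 p) a n (membership-hasCard (FiniteField.fld (𝔽 p)) a distinct) n≢0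
    ... | d , μ , dμ∈D , estimate≤ = fromℕ-cancel-≤ (begin
      fromℕ n              ≤⟨ measure-bound n (fromℕ-pos (0<q p)) (C-pos 1 n ψ) 1≤s C≤s d μ
                                (D-pos 1 n ψ dμ∈D) (All.lookup μ-small dμ∈D) estimate≤ ⟩
      μ + 1#               ≤⟨ +-mono-≤ 1# (proj₁ (k-large p 1 n φ len≤p
                                (≡.subst (λ ψ → (d , μ) ∈ CountingConstants.D cdm 1 n ψ)
                                  (≡.sym (oneOf-⟨⟩ zero (List.tabulate suc) (value p))) dμ∈D))) ⟩
      fromℕ (k p) + 1#     ≈⟨ +-comm _ 1# ⟩
      fromℕ (suc (k p))    ∎)

  -- Since q = p^k_p, this is the statement that p^M ≤ q^ε.
  largeMultiple : ∀ M {ε} → 0# < ε → Large (λ p → fromℕ M ≤ ε * fromℕ (k p))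
  largeMultiple M {ε} 0<ε with archimedean (fromℕ M * ε ⁻¹)
  ... | n , M/ε≤n = large-⊆ (λ p n<k → begin
    fromℕ M               ≈⟨ ÷-inverse 0<ε ⟨
    fromℕ M * ε ⁻¹ * ε    ≤⟨ *-monoʳ-≤ (proj₁ 0<ε) (≤-trans M/ε≤n (fromℕ-mono-≤ (ℕ.s≤s⁻¹ n<k))) ⟩
    fromℕ (k p) * ε       ≈⟨ *-comm _ ε ⟩
    ε * fromℕ (k p)       ∎) (large-k (suc n))

  -- Comparing cardinalities up to factors q^o(1)

  ratio : (ℙ → ℕ) → ℙ → ℝ
  ratio N p = logℕ (N p) ÷ logℕ (q p)

  0<log-q : ∀ p → 0# < logℕ (q p)
  0<log-q p = logℕ-pos (1<q (𝔽 p))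

  log-q : ∀ p → logℕ (q p) ≈ fromℕ (k p) * logℕ (value p)
  log-q p = ≡.subst (λ n → logℕ n ≈ fromℕ (k p) * logℕ (value p)) (≡.sym (size𝔽 p))
    (logℕ-^ (ℕₚ.<-trans (s≤s z≤n) (1<p p)) (k p))

  ratio-≤ : ∀ {N N′ e M ε} p → N p ≢ 0 → N p ℕ.≤ N′ p ℕ.* (q p ℕ.^ e ℕ.* value p ℕ.^ M) →
    fromℕ M ≤ ε * fromℕ (k p) → ratio N p ≤ ratio N′ p + (fromℕ e + ε)
  ratio-≤ {N} {N′} {e} {M} {ε} p N≢0 N≤ M≤εk = *-cancelʳ-≤ (0<log-q p) (begin
    ratio N p * L
      ≈⟨ ÷-inverse (0<log-q p) ⟩
    logℕ (N p)
      ≤⟨ logℕ-mono-≤ (ℕₚ.n≢0⇒n>0 N≢0) N≤ ⟩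
    logℕ (N′ p ℕ.* (q p ℕ.^ e ℕ.* value p ℕ.^ M))
      ≈⟨ trans (logℕ-* 0<N′ (ℕₚ.*-mono-< (^-pos (0<q p) e) (^-pos 0<p M)))
           (+-congˡ (trans (logℕ-* (^-pos (0<q p) e) (^-pos 0<p M)) (+-cong (logℕ-^ (0<q p) e) (logℕ-^ 0<p M)))) ⟩
    logℕ (N′ p) + (fromℕ e * L + fromℕ M * ℓ)
      ≤⟨ +-mono₂-≤ ≤-refl (+-mono₂-≤ ≤-refl (*-monoʳ-≤ (logℕ-nonneg 0<p) M≤εk)) ⟩
    logℕ (N′ p) + (fromℕ e * L + ε * fromℕ (k p) * ℓ)
      ≈⟨ +-congˡ (+-congˡ (trans (*-assoc ε _ ℓ) (*-congˡ (sym (log-q p))))) ⟩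
    logℕ (N′ p) + (fromℕ e * L + ε * L)
      ≈⟨ +-cong (sym (÷-inverse (0<log-q p))) (sym (distribʳ L _ ε)) ⟩
    ratio N′ p * L + (fromℕ e + ε) * L
      ≈⟨ distribʳ L _ _ ⟨
    (ratio N′ p + (fromℕ e + ε)) * L  ∎)
    where
    L = logℕ (q p)
    ℓ = logℕ (value p)
    0<p = ℕₚ.<-trans (s≤s z≤n) (1<p p)
    0<N′ : 0 ℕ.< N′ p
    0<N′ = ℕₚ.n≢0⇒n>0 λ N′≡0 → N≢0 (ℕₚ.n≤0⇒n≡0 (≡.subst
      (λ n → N p ℕ.≤ n ℕ.* (q p ℕ.^ e ℕ.* value p ℕ.^ M)) N′≡0 N≤))

  -- On the scale of log q the factor q^e counts e, while p^M counts M/k_p and vanishes in the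
  -- standard part. Three errors ε arise: from p^M and from the two standard parts.
  standardPart-≤ : ∀ {N N′ : ℙ → ℕ} e M {s t} → Large (λ p → N p ≢ 0) →
    IsStandardPart (ratio N) s → IsStandardPart (ratio N′) t →
    Large (λ p → N p ℕ.≤ N′ p ℕ.* (q p ℕ.^ e ℕ.* value p ℕ.^ M)) → s ≤ t + fromℕ e
  standardPart-≤ {N} {N′} e M {s} {t} N≢0 st-s st-t N≤ = ≤-byApproximation λ ε 0<ε →
    let r , 0<r , 3r≈ε = third 0<ε in
    ≤-trans (step r 0<r) (+-mono₂-≤ ≤-refl (≤-trans (≤-reflexive 3r≈ε) (x≤x+y (proj₁ 0<ε))))
    where
    step : ∀ ε → 0# < ε → s ≤ (t + fromℕ e) + (ε + ε + ε)
    step ε 0<ε = large-const U em (large-zipWith U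
      (λ {p} (N≢0 , N≤) (M≤εk , s-near , t-near) → begin
        s                                         ≤⟨ ∣-∣≤⁻² s-near ⟩
        ratio N p + ε                             ≤⟨ +-mono-≤ ε (ratio-≤ {N} {N′} {e} {M} p N≢0 N≤ M≤εk) ⟩
        ratio N′ p + (fromℕ e + ε) + ε            ≤⟨ +-mono-≤ ε (+-mono-≤ (fromℕ e + ε) (∣-∣≤⁻¹ t-near)) ⟩
        (t + ε) + (fromℕ e + ε) + ε               ≈⟨ solve 3 (λ t ε e → (t :+ ε) :+ (e :+ ε) :+ ε :=
                                                       (t :+ e) :+ (ε :+ ε :+ ε)) refl t ε (fromℕ e) ⟩
        (t + fromℕ e) + (ε + ε + ε)               ∎)
      (large-∩ N≢0 N≤)
      (large-∩ (largeMultiple M 0<ε) (large-∩ (st-s ε 0<ε) (st-t ε 0<ε))))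

  standardPart-one : IsStandardPart (ratio (λ _ → 1)) 0#
  standardPart-one ε 0<ε = large-everywhere U λ p →
    let ratio≈0 = trans (*-congʳ logℕ-1) (zeroˡ _) in
    ∣-∣≤⁺ (≤-trans (≤-reflexive ratio≈0) (x≤x+y (proj₁ 0<ε)))
          (≤-trans (≤-reflexive (sym ratio≈0)) (x≤x+y (proj₁ 0<ε)))

  -- The standard part is the supremum of the reals that lie below x_p for almost all p.
  standardPart-exists : ∀ x B → Large (λ p → 0# ≤ x p) → Large (λ p → x p ≤ B) → ∃ (IsStandardPart x)
  standardPart-exists x B 0≤x x≤B = s , λ ε 0<ε →
    large-zipWith U (λ x≤s+ε (s≤x+ε) → ∣-∣≤⁺ x≤s+ε s≤x+ε) (above ε 0<ε) (below ε 0<ε)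
    where
    below-x : ℝ → Set
    below-x t = Large (λ p → t ≤ x p)
    lub = sup below-x (0# , 0≤x) (B , λ t t≤x → large-const U em (large-zipWith U ≤-trans t≤x x≤B))
    s = proj₁ lub
    upper = proj₁ (proj₂ lub)
    least = proj₂ (proj₂ lub)
    above : ∀ ε → 0# < ε → Large (λ p → x p ≤ s + ε)
    above ε 0<ε with ultra (λ p → s + ε ≤ x p)
    ... | inj₁ s+ε≤x = ⊥-elim (<⇒≱ 0<ε (+-cancelʳ-≤ s (≤-trans (≤-reflexive (+-comm ε s))
                         (≤-trans (upper (s + ε) s+ε≤x) (≤-reflexive (sym (+-identityˡ s)))))))
    ... | inj₂ s+ε≰x = large-⊆ (λ p → ≰⇒≥) s+ε≰x
    below : ∀ ε → 0# < ε → Large (λ p → s ≤ x p + ε)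
    below ε 0<ε with em {∃[ t ] (below-x t × s ≤ t + ε)}
    ... | yes (t , t≤x , s≤t+ε) = large-⊆ (λ p t≤x → ≤-trans s≤t+ε (+-mono-≤ ε t≤x)) t≤x
    ... | no ¬∃ = ⊥-elim (<⇒≱ 0<ε (+-cancelʳ-≤ s (begin
      ε + s            ≤⟨ +-mono₂-≤ ≤-refl (least (s - ε) λ t t≤x →
                            +-cancelʳ-≤ ε (≤-trans (≰⇒≥ λ s≤t+ε → ¬∃ (t , t≤x , s≤t+ε))
                                                 (≤-reflexive (sym (x-y+y≈x s ε))))) ⟩
      ε + (s - ε)      ≈⟨ trans (+-comm ε _) (x-y+y≈x s ε) ⟩
      s                ≈⟨ +-identityˡ s ⟨
      0# + s           ∎)))

  nonstandardCard : ∀ {n} (φ : Formula (Dom F) ℒσ n) → ∃ (HasNonstandardCard φ)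
  nonstandardCard φ = (λ p → proj₁ (card p)) , λ p → proj₂ (card p)
    where
    card : ∀ p → _
    card p = Sat-hasCard em (𝔽 p) (value p) (λ c → c p) φ

  -- The ultrafilter decides whether φ is empty; otherwise 1 ≤ N_p ≤ q^n keeps the ratio between 0
  -- and n.
  δ-exists : ∀ {n} (φ : Formula (Dom F) ℒσ n) → ∃ (IsδFormula φ)
  δ-exists {n} φ with nonstandardCard φ
  ... | N , isCard with ultra (λ p → N p ≡ 0)
  ... | inj₁ N≡0 = -∞ , N , isCard , N≡0
  ... | inj₂ N≢0 = let r , st = standardPart-exists (ratio N) (fromℕ n) lower upper in
      fin r , N , isCard , N≢0 , st
    where
    tuples : ∀ p → Setoid 0ℓ 0ℓ
    tuples p = FiniteField.tuples (𝔽 p) n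
    lower : Large (λ p → 0# ≤ ratio N p)
    lower = large-⊆ (λ p N≢0 → *-nonneg (logℕ-nonneg (ℕₚ.n≢0⇒n>0 N≢0)) (⁻¹-nonneg (0<log-q p))) N≢0
    upper : Large (λ p → ratio N p ≤ fromℕ n)
    upper = large-⊆ (λ p N≢0 → *-cancelʳ-≤ (0<log-q p) (begin
      ratio N p * logℕ (q p)  ≈⟨ ÷-inverse (0<log-q p) ⟩
      logℕ (N p)              ≤⟨ logℕ-mono-≤ (ℕₚ.n≢0⇒n>0 N≢0) (card≤cover {tuples p} (isCard p)
                                   (cover-⊆ {tuples p} (λ _ _ → tt) (finite-tuples em (𝔽 p) (value p) n))) ⟩
      logℕ (q p ℕ.^ n)        ≈⟨ logℕ-^ (0<q p) n ⟩
      fromℕ n * logℕ (q p)    ∎)) N≢0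

-- Fibers of quantifier-free types

map-lookup-↑ʳ : ∀ {X : Set} {m n l} (y : Vec X m) (x : Vec X n) (i : Vec (Fin n) l) →
  Vec.map (lookup (y ++ x)) (Vec.map (m ↑ʳ_) i) ≡ Vec.map (lookup x) i
map-lookup-↑ʳ y x i = ≡.trans (≡.sym (Vecₚ.map-∘ _ _ i)) (Vecₚ.map-cong (Vecₚ.lookup-++ʳ y x) i)

map-lookup-↑ˡ : ∀ {X : Set} {m n l} (y : Vec X m) (x : Vec X n) (i : Vec (Fin m) l) →
  Vec.map (lookup (y ++ x)) (Vec.map (_↑ˡ n) i) ≡ Vec.map (lookup y) i
map-lookup-↑ˡ y x i = ≡.trans (≡.sym (Vecₚ.map-∘ _ _ i)) (Vecₚ.map-cong (Vecₚ.lookup-++ˡ y x) i)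

Generated-mono : ∀ {S : Structure ℒσ} {X Y : Set} (f : X → Y) (g : Y → Dom S) {c} →
  Generated S (g ∘ f) c → Generated S g c
Generated-mono f g (gen x)   = gen (f x)
Generated-mono f g zero      = zero
Generated-mono f g one       = one
Generated-mono f g (add a b) = add (Generated-mono f g a) (Generated-mono f g b)
Generated-mono f g (mul a b) = mul (Generated-mono f g a) (Generated-mono f g b)
Generated-mono f g (neg a)   = neg (Generated-mono f g a)
Generated-mono f g (inv a e) = inv (Generated-mono f g a) e
Generated-mono f g (app a)   = app (Generated-mono f g a)
Generated-mono f g (resp a e) = resp (Generated-mono f g a) e

⋀-QuantifierFree : ∀ {L C n} {Φ : List (Formula C L n)} → All QuantifierFree Φ → QuantifierFree (⋀ Φ)
⋀-QuantifierFree []         = tt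
⋀-QuantifierFree (qf ∷ qfs) = qf , ⋀-QuantifierFree qfs

module Ambient (em : LEM) {𝓡 : Reals} {cdm : CountingConstants 𝓡} (𝓕 : 𝒮 𝓡 cdm) where
  open 𝒮 𝓕

  F̃-isDifferenceField : IsDifferenceField F̃
  F̃-isDifferenceField = ultraproduct-isDifferenceField em U λ p →
    FrobeniusField.isDifferenceField em (AlgebraicClosureOf𝔽.fld (𝔽̃ p)) (value p)

  inclusion-isEmbedding : IsEmbedding F F̃ inclusion
  inclusion-isEmbedding = record
    { ≈-cong      = large-⊆ λ p → IsRingMonomorphism.⟦⟧-cong (emb-mono p)
    ; ≈-injective = large-⊆ λ p → IsRingMonomorphism.injective (emb-mono p)
    ; +-homo      = λ x y → everywhere λ p → IsRingMonomorphism.+-homo (emb-mono p) (x p) (y p)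
    ; *-homo      = λ x y → everywhere λ p → IsRingMonomorphism.*-homo (emb-mono p) (x p) (y p)
    ; -‿homo      = λ x → everywhere λ p → IsRingMonomorphism.-‿homo (emb-mono p) (x p)
    ; 0-homo      = everywhere λ p → IsRingMonomorphism.0#-homo (emb-mono p)
    ; 1-homo      = everywhere λ p → IsRingMonomorphism.1#-homo (emb-mono p)
    ; unary-homo  = λ x → everywhere λ p → ^-homo p (x p) (value p)
    }
    where
    everywhere : {P : Pred ℙ 0ℓ} → (∀ p → P p) → Large P
    everywhere = large-everywhere U
    ^-homo : ∀ p x n → AlgebraicClosureOf𝔽._≈_ (𝔽̃ p)
      (emb p (FiniteField._^_ (𝔽 p) x n)) (AlgebraicClosureOf𝔽._^_ (𝔽̃ p) (emb p x) n)
    ^-homo p x zero    = IsRingMonomorphism.1#-homo (emb-mono p)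
    ^-homo p x (suc n) = 𝔽̃ₚ.trans (IsRingMonomorphism.*-homo (emb-mono p) _ _) (𝔽̃ₚ.*-congˡ (^-homo p x n))
      where module 𝔽̃ₚ = AlgebraicClosureOf𝔽 (𝔽̃ p)

  module _ (E : SaturatedExtension F̃) where
    open SaturatedExtension E

    M-isDifferenceField : IsDifferenceField M
    M-isDifferenceField = extension-isDifferenceField em E F̃-isDifferenceField

    -- The embedding of F into F̃ need not be elementary, but it preserves quantifier-free formulas
    -- and so carries finite satisfiability of r over.
    qfType-realization : ∀ {C : Set} (ι : C → Dom F) {k} {r : PartialType C k} → IsCompleteQFType F ι r →
      ∃[ v ] (_Realizes_ M (j ∘ inclusion ∘ ι) v r)
    qfType-realization ι {r = r} complete = realization em E F̃-isDifferenceField (inclusion ∘ ι) r λ Φ rΦ →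
      let v , Φv = IsCompleteQFType.consistent complete Φ rΦ in
      Vec.map j (Vec.map inclusion v) ,
      All.zipWith (λ { {φ} (rφ , φv) → let qf = IsCompleteQFType.quantifierFree complete φ rφ in
        to (Embedding.Sat-embedding M-isDifferenceField (extension-isEmbedding em E F̃-isDifferenceField)
              (inclusion ∘ ι) φ qf (Vec.map inclusion v))
          (to (Embedding.Sat-embedding F̃-isDifferenceField inclusion-isEmbedding ι φ qf v) φv) })
        (rΦ , Φv)

  factorTuples : ℙ → ℕ → Setoid 0ℓ 0ℓ
  factorTuples p n = FiniteField.tuples (𝔽 p) n

  at-index : ∀ {C : Set} → (C → Dom F) → ∀ p → C → Dom (factor p)
  at-index ι p c = ι c p

  -- Entailment in F reaches almost all factors, where points are counted: failures at almost all
  -- indices would combine into a tuple X of F violating it.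
  entailment-at-indices : ∀ {C : Set} (ι : C → Dom F) {n} (Φ : List (Formula C ℒσ n)) (φ : Formula (Dom F) ℒσ n) →
    (∀ v → All (λ θ → Sat F ι θ v) Φ → Sat F id φ v) →
    Large (λ p → ∀ x → All (λ θ → Sat (factor p) (at-index ι p) θ x) Φ → Sat (factor p) (λ c → c p) φ x)
  entailment-at-indices {C} ι {n} Φ φ entail = large-¬¬ U λ fails →
    let Φ-holds = large-⊆ (λ p fail → ≡.subst (λ x → All (λ θ → Sat (factor p) (at-index ι p) θ x) Φ)
                    (≡.sym (at-X p)) (proj₁ (counter p fail))) fails
        φX = to (łoś id φ X) (entail X (fromFactors Φ Φ-holds))
    in large-⊥ (large-zipWith U (λ {p} fail φXp → proj₂ (counter p fail)
         (≡.subst (Sat (factor p) (λ c → c p) φ) (at-X p) φXp)) fails φX)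
    where
    open Łoś U em factor
    Counterexample : ∀ p → Vec (Dom (factor p)) n → Set
    Counterexample p x = All (λ θ → Sat (factor p) (at-index ι p) θ x) Φ × ¬ Sat (factor p) (λ c → c p) φ x
    choose : ∀ p → Σ[ x ∈ Vec (Dom (factor p)) n ] (∃ (Counterexample p) → Counterexample p x)
    choose p with em {∃ (Counterexample p)}
    ... | yes (x , Cx) = x , λ _ → Cx
    ... | no ¬∃        = Vec.replicate n (Structure.0# (factor p)) , λ ∃C → ⊥-elim (¬∃ ∃C)
    X : Vec (Dom F) n
    X = Vec.tabulate λ i p → lookup (proj₁ (choose p)) i
    at-X : ∀ p → at X p ≡ proj₁ (choose p)
    at-X p = ≡.trans (≡.sym (Vecₚ.tabulate-∘ (λ x → x p) _)) (Vecₚ.tabulate∘lookup _)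
    counter : ∀ p → ¬ (∀ x → All (λ θ → Sat (factor p) (at-index ι p) θ x) Φ → Sat (factor p) (λ c → c p) φ x) →
      Counterexample p (proj₁ (choose p))
    counter p fail = proj₂ (choose p) (Classical.byContradiction em λ ¬∃ → fail λ x Φx →
      Classical.byContradiction em λ ¬φx → ¬∃ (x , Φx , ¬φx))
    fromFactors : ∀ Φ → Large (λ p → All (λ θ → Sat (factor p) (at-index ι p) θ (at X p)) Φ) →
      All (λ θ → Sat F ι θ X) Φ
    fromFactors []      _     = []
    fromFactors (θ ∷ Φ) large = from (łoś ι θ X) (large-⊆ (λ p → All.head) large) ∷
      fromFactors Φ (large-⊆ (λ p → All.tail) large)

  FiberOf : ∀ {C : Set} (ι : C → Dom F) {k l} → Vec (Fin k) l → List (Formula C ℒσ k) →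
    ∀ p → Vec (Dom (factor p)) l → Fin k → Dom (factor p) → Set
  FiberOf ι {k} K Θ p v j t = Σ[ z ∈ Vec (Dom (factor p)) k ]
    (All (λ θ → Sat (factor p) (at-index ι p) θ z) Θ ×
     Pointwise (FiniteField._≈_ (𝔽 p)) (Vec.map (lookup z) K) v × FiniteField._≈_ (𝔽 p) (lookup z j) t)

  -- A coordinate z_j that is transformally algebraic over z_K satisfies P(z_j , z_K) = 0 for a
  -- difference polynomial some coefficient of which, as a polynomial in X_j, does not vanish at
  -- z_K.  This is part of r, and in 𝔽_q it is an equation of degree < p^N for z_j.
  module _ {C : Set} (ι : C → Dom F) {k} {r : PartialType C k} (complete : IsCompleteQFType F ι r)
           (E : SaturatedExtension F̃) where
    open SaturatedExtension E
    open Dependence em (M-isDifferenceField E) (j ∘ inclusion ∘ ι) using (Independent)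

    module _ {z : Vec (Dom M) k} (z⊨r : _Realizes_ M (j ∘ inclusion ∘ ι) z r)
             {l} (K : Vec (Fin k) l) (independent : Independent (Vec.map (lookup z) K)) where

      fibers-small : ∀ c (J : Fin c → Fin k) → (∀ i → ¬ Independent (Vec.map (lookup z) (J i ∷ K))) →
        Σ[ Θ ∈ List (Formula C ℒσ k) ] Σ[ N ∈ ℕ ] (All r Θ × Large (λ p → ∀ i v →
          Cover (FiniteField.setoid (𝔽 p)) (FiberOf ι K Θ p v (J i)) (value p ℕ.^ N)))
      fibers-small zero    J dependent = [] , 0 , [] , large-everywhere U λ { p () }
      fibers-small (suc c) J dependent
        with fiberFormula-exists em (M-isDifferenceField E) _ (J zero) K z independent (dependent zero)
           | fibers-small c (J ∘ suc) (dependent ∘ suc)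
      ... | N , P , f , θz | Θ , N′ , rΘ , small =
        θ ∷ Θ , N ℕ.⊔ N′ ,
        true⇒∈type em (M-isDifferenceField E) _ complete z⊨r θ (tt , tt) θz ∷ rΘ ,
        large-zipWith U (λ {p} bounds small → covers p bounds small)
          -- From here on p exceeds every exponent of X_j in P and every entry of f, as the digit
          -- argument requires.
          (large-≥ U em (proj₁ (below-bound f) ℕ.⊔ proj₁ (bounded-bound P))) small
        where
        θ = fiberFormula (J zero) K P f
        covers : ∀ p → proj₁ (below-bound f) ℕ.⊔ proj₁ (bounded-bound P) ℕ.≤ value p →
          (∀ i v → Cover (FiniteField.setoid (𝔽 p)) (FiberOf ι K Θ p v (J (suc i))) (value p ℕ.^ N′)) →
          ∀ i v → Cover (FiniteField.setoid (𝔽 p)) (FiberOf ι K (θ ∷ Θ) p v (J i)) (value p ℕ.^ (N ℕ.⊔ N′))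
        covers p bounds small i v = split i
          where
          Sₚ = FiniteField.setoid (𝔽 p)
          instance
            p≢0 : ℕ.NonZero (value p)
            p≢0 = ℕ.>-nonZero (ℕₚ.<-trans (s≤s z≤n) (1<p em 𝓕 p))
          split : ∀ i → Cover Sₚ (FiberOf ι K (θ ∷ Θ) p v (J i)) (value p ℕ.^ (N ℕ.⊔ N′))
          split zero = cover-≤ {Sₚ} (ℕₚ.^-monoʳ-≤ (value p) (ℕₚ.m≤m⊔n N N′))
            (cover-⊆ {Sₚ} (λ { t (z , θz ∷ _ , zK≈v , zj≈t) → z , θz , zK≈v , zj≈t })
              (fiber-cover em (𝔽 p) (value p) (at-index ι p) K (J zero) P f
                (proj₂ (below-bound f) (value p) (ℕₚ.m⊔n≤o⇒m≤o (proj₁ (below-bound f)) _ bounds))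
                (proj₂ (bounded-bound P) (value p) (ℕₚ.m⊔n≤o⇒n≤o (proj₁ (below-bound f)) _ bounds)) v))
          split (suc i) = cover-≤ {Sₚ} (ℕₚ.^-monoʳ-≤ (value p) (ℕₚ.m≤n⊔m N N′))
            (cover-⊆ {Sₚ} (λ { t (z , _ ∷ Θz , zK≈v , zj≈t) → z , Θz , zK≈v , zj≈t }) (small i v))

-- Restriction of a type to finitely many parameters

module Restriction {𝓡 : Reals} {cdm : CountingConstants 𝓡} (𝓕 : 𝒮 𝓡 cdm) (A : Subset 𝓕) (L : List (∃ A)) where
  open 𝒮 𝓕

  -- The proof of `A x` is kept, so that `include` returns the very constant listed in L.
  A↾ : Subset 𝓕
  A↾ x = Σ[ a ∈ A x ] ((x , a) ∈ L)

  include : ∃ A↾ → ∃ A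
  include (x , a , _) = x , a

  A↾-countable : Countable 𝓕 A↾
  A↾-countable = nth L , λ { x (a , x∈L) → let i , eq = listed L x∈L in
    i , large-everywhere U λ p → FiniteField.reflexive (𝔽 p) (≡.cong (λ y → y p) eq) }
    where
    nth : List (∃ A) → ℕ → Dom F
    -- Padding with 0 is allowed, because an enumeration may take values outside the set.
    nth []            _       = Structure.0# F
    nth ((x , _) ∷ _) zero    = x
    nth (_ ∷ L)       (suc i) = nth L i
    listed : ∀ L {c} → c ∈ L → ∃[ i ] (nth L i ≡ proj₁ c)
    listed (_ ∷ _) (here ≡.refl) = 0 , ≡.refl
    listed (_ ∷ L) (there c∈L)   = let i , eq = listed L c∈L in suc i , eq

  _↾ : ∀ {k} → TypeOver 𝓕 A k → TypeOver 𝓕 A↾ k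
  (r ↾) φ = r (mapCon include φ)

  ↾-complete : ∀ {k} {r : TypeOver 𝓕 A k} → IsCompleteQFTypeOver 𝓕 A r → IsCompleteQFTypeOver 𝓕 A↾ (r ↾)
  ↾-complete {r = r} complete = record
    { quantifierFree = λ φ rφ → mapCon-QuantifierFree⁻ include φ (C.quantifierFree _ rφ)
    ; complete       = λ φ qf → C.complete (mapCon include φ) (mapCon-QuantifierFree include φ qf)
    ; consistent     = λ Φ rΦ → let v , Φv = C.consistent (List.map (mapCon include) Φ) (Allₚ.map⁺ rΦ) in
        v , All.map (λ {φ} → to (Sat-mapCon include F proj₁ φ v)) (Allₚ.map⁻ Φv)
    }
    where module C = IsCompleteQFType complete

-- Rank and counting dimension of the projection

module Main (em : LEM) {𝓡 : Reals} {cdm : CountingConstants 𝓡} (𝓕 : 𝒮 𝓡 cdm) (A : Subset 𝓕)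
  {m n : ℕ} {r : TypeOver 𝓕 A (m ℕ.+ n)} (complete : IsCompleteQFTypeOver 𝓕 A r)
  (conjecture : (A′ : Subset 𝓕) → Countable 𝓕 A′ → (l : ℕ) (p : TypeOver 𝓕 A′ l) →
     IsCompleteQFTypeOver 𝓕 A′ p → δ≡dimRk 𝓕 A′ p)
  (E : SaturatedExtension (𝒮.F̃ 𝓕)) where
  open 𝒮 𝓕
  open SaturatedExtension E
  open Ambient em 𝓕
  open Reals 𝓡 using (ℝ₋∞; fromℕ; -∞; fin; _≤₋∞_)
  open RealLemmas em 𝓡 using (≤-trans; ≤-reflexive; +-cancelʳ-≤; fromℕ-mono-≤)
  private module R = Reals 𝓡

  ι : ∃ A → Dom M
  ι c = j (inclusion (proj₁ c))

  isDF : IsDifferenceField M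
  isDF = M-isDifferenceField E

  open Dependence em isDF ι

  ιₚ : ∀ p → ∃ A → Dom (factor p)
  ιₚ = at-index proj₁

  module OverFinite (L : List (∃ A)) where
    open Restriction 𝓕 A L public

    δ-and-dim = conjecture A↾ A↾-countable (m ℕ.+ n) (r ↾) (↾-complete complete) E
    D = proj₁ δ-and-dim
    isDim = proj₁ (proj₂ δ-and-dim)
    isδ = proj₂ (proj₂ δ-and-dim)

    -- Independence over A implies independence over the finite part, and by completeness of the
    -- restricted type it passes from z to a realization of rank D.
    length≤D : ∀ {z} → _Realizes_ M ι z r → ∀ {l} (i : Vec (Fin (m ℕ.+ n)) l) →
      Independent (Vec.map (lookup z) i) → l ℕ.≤ D
    length≤D {z} z⊨r {l} i independent =
      let w , w⊨r↾ , trdeg = proj₁ isDim in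
      proj₂ trdeg l i (independent-realization em isDF (ι ∘ include) (↾-complete complete)
        (λ φ rφ → to (Sat-mapCon include M ι φ z) (z⊨r (mapCon include φ) rφ)) i w⊨r↾
        (λ N P u gens → independent N P u (All.map (Generated-mono include ι) gens)))

  xs : ∀ {l} → Vec (Fin n) l → Vec (Fin (m ℕ.+ n)) l
  xs = Vec.map (m ↑ʳ_)

  ys : ∀ {l} → Vec (Fin m) l → Vec (Fin (m ℕ.+ n)) l
  ys = Vec.map (_↑ˡ n)

  SmallFibers : ∀ {l c} → Vec (Fin (m ℕ.+ n)) l → (Fin c → Fin (m ℕ.+ n)) → Set
  SmallFibers K J = Σ[ Θ ∈ List (Formula (∃ A) ℒσ (m ℕ.+ n)) ] Σ[ N ∈ ℕ ] (All r Θ × Large (λ p → ∀ i v →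
    Cover (FiniteField.setoid (𝔽 p)) (FiberOf proj₁ K Θ p v (J i)) (value p ℕ.^ N)))

  -- The formulas of a finite part of ∃y r may have different witnesses y. Uniting the finite parts
  -- of r behind them gives a condition on a single y that implies them all.
  Witnesses : List (Formula (∃ A) ℒσ n) → Set
  Witnesses Φ = Σ[ Ψ ∈ List (Formula (∃ A) ℒσ (m ℕ.+ n)) ] (All r Ψ ×
    (∀ p y x → All (λ ψ → Sat (factor p) (ιₚ p) ψ (y ++ x)) Ψ → All (λ φ → Sat (factor p) (ιₚ p) φ x) Φ))

  witnesses : ∀ Φ → All (∃y m r) Φ → Witnesses Φ
  witnesses []      []                        = [] , [] , λ p y x _ → []
  witnesses (_ ∷ Φ) ((Θ , rΘ , ≡.refl) ∷ rΦ) = let Ψ , rΨ , entail = witnesses Φ rΦ in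
    Θ List.++ Ψ , Allₚ.++⁺ rΘ rΨ , λ p y x ΘΨ →
      Sat-ex^⁺ (factor p) (ιₚ p) m (⋀ Θ) y (Sat-⋀⁺ (factor p) (ιₚ p) (FiniteField.refl (𝔽 p)) (Allₚ.++⁻ˡ Θ ΘΨ)) ∷
      entail p y x (Allₚ.++⁻ʳ Θ ΘΨ)

  -- That K and I cannot be extended is all that is used: the exchange property of transformal
  -- independence is not needed, because e + d only has to be a lower bound for dim_rk r.
  module Bases (b : Vec (Dom M) m) (a : Vec (Dom M) n) (z⊨r : _Realizes_ M ι (b ++ a) r)
    {d} (K : Vec (Fin n) d) (K-independent : Independent (Vec.map (lookup (b ++ a)) (xs K)))
    (K-maximal : ∀ l → Σ[ K ∈ Vec (Fin n) l ] Independent (Vec.map (lookup (b ++ a)) (xs K)) → l ℕ.≤ d)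
    {e} (I : Vec (Fin m) e) (I-independent : Independent (Vec.map (lookup (b ++ a)) (ys I ++ xs K)))
    (I-maximal : ∀ l → Σ[ I ∈ Vec (Fin m) l ] Independent (Vec.map (lookup (b ++ a)) (ys I ++ xs K)) → l ℕ.≤ e) where
    z = b ++ a

    -- Includes i in K, since K is maximal among index vectors with possible repetitions. All n
    -- coordinates can thus be counted alike.
    x-dependent : ∀ i → ¬ Independent (Vec.map (lookup z) ((m ↑ʳ i) ∷ xs K))
    x-dependent i ind = ℕₚ.1+n≰n (K-maximal (suc d) (i ∷ K , ind))

    y-dependent : ∀ i → ¬ Independent (Vec.map (lookup z) ((i ↑ˡ n) ∷ ys I ++ xs K))
    y-dependent i ind = ℕₚ.1+n≰n (I-maximal (suc e) (i ∷ I , ind))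

    isDimRk : IsDimRk M ι (∃y m r) d
    isDimRk = (a , a⊨ , (K , ≡.subst Independent (map-lookup-↑ʳ b a K) K-independent) ,
               λ l i ind → K-maximal l (i , ≡.subst Independent (≡.sym (map-lookup-↑ʳ b a i)) ind)) ,
      -- If a_i were dependent, a formula θ in r would say so, and ∃y θ holds at a′. The dependence
      -- involves only coordinates of x, so whichever y is found, a′_i is dependent.
      λ { a′ d′ a′⊨ ((i , ind) , _) → K-maximal d′ (i , Classical.byContradiction em λ ¬ind →
          let θ , qf , θz , dep = dependenceFormula (xs i) z
                (¬Independent⇒Dependent (Vec.map (lookup z) (xs i)) ¬ind)
              rθ = true⇒∈type em isDF ι complete z⊨r θ qf θz
              y , θy = Sat-ex^⁻ M ι m (⋀ (θ ∷ [])) (a′⊨ _ (θ ∷ [] , rθ ∷ [] , ≡.refl))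
          in Dependent⇒¬Independent (Vec.map (lookup (y ++ a′)) (xs i)) (dep (y ++ a′) (proj₁ θy))
               (≡.subst Independent (≡.sym (map-lookup-↑ʳ y a′ i)) ind)) }
      where
      a⊨ : _Realizes_ M ι a (∃y m r)
      a⊨ _ (Φ , rΦ , ≡.refl) = Sat-ex^⁺ M ι m (⋀ Φ) b
        (Sat-⋀⁺ M ι (DifferenceField.refl isDF) (All.map (λ {φ} → z⊨r φ) rΦ))

    -- ∃y Θ has at most q^d p^c points, where Θ bounds the fibers over x_K.
    upper : SmallFibers (xs K) (m ↑ʳ_) →
      ∃[ φ ] (_⊫_ F proj₁ (∃y m r) φ × ∃[ v ] (IsδFormula φ v × v ≤₋∞ fin (fromℕ d)))
    upper (Θ , N , rΘ , small) = φ ,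
      (ex^ m (⋀ Θ) ∷ [] , (Θ , rΘ , ≡.refl) ∷ [] ,
       λ { v (φv ∷ []) → from (Sat-mapCon proj₁ F id (ex^ m (⋀ Θ)) v) φv }) ,
      proj₁ (δ-exists em 𝓕 φ) , proj₂ (δ-exists em 𝓕 φ) , δ≤ (proj₁ (δ-exists em 𝓕 φ)) (proj₂ (δ-exists em 𝓕 φ))
      where
      φ : Formula (Dom F) ℒσ n
      φ = mapCon proj₁ (ex^ m (⋀ Θ))

      module _ (p : ℙ) (small : ∀ i v → Cover (FiniteField.setoid (𝔽 p))
                 (FiberOf proj₁ (xs K) Θ p v (m ↑ʳ i)) (value p ℕ.^ N)) where
        open FiniteField (𝔽 p) using (_≈_; refl)

        φ-cover : Cover (factorTuples p n) (Sat (factor p) (λ c → c p) φ)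
          (q em 𝓕 p ℕ.^ d ℕ.* (value p ℕ.^ N) ℕ.^ n)
        φ-cover = cover-fibers {factorTuples p d} {factorTuples p n}
          {P = λ v x → ∀ i → FiberOf proj₁ (xs K) Θ p v (m ↑ʳ i) (lookup x i)}
          (finite-tuples em (𝔽 p) (value p) d) (λ v → cover-vec {FiniteField.setoid (𝔽 p)} n (λ i → small i v))
          λ x φx →
            let y , Θyx = Sat-ex^⁻ (factor p) (ιₚ p) m (⋀ Θ)
                  (to (Sat-mapCon proj₁ (factor p) (λ c → c p) (ex^ m (⋀ Θ)) x) φx) in
            Vec.map (lookup x) K , tt , λ v x_K≈v i → y ++ x , Sat-⋀⁻ (factor p) (ιₚ p) Θ Θyx ,
              ≡.subst (λ w → Pointwise _≈_ w v) (≡.sym (map-lookup-↑ʳ y x K)) x_K≈v ,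
              FiniteField.reflexive (𝔽 p) (Vecₚ.lookup-++ʳ y x i)

      δ≤ : ∀ v → IsδFormula φ v → v ≤₋∞ fin (fromℕ d)
      δ≤ -∞      _ = tt
      δ≤ (fin t) (Nφ , isCard , Nφ≢0 , st) = ≤-trans
        -- An absolute bound is a comparison with a one-point set, whose standard part is 0.
        (standardPart-≤ em 𝓕 {Nφ} {λ _ → 1} d (N ℕ.* n) Nφ≢0 st (standardPart-one em 𝓕)
          (large-⊆ (λ p small → ≡.subst (Nφ p ℕ.≤_)
             (≡.trans (≡.cong (q em 𝓕 p ℕ.^ d ℕ.*_) (ℕₚ.^-*-assoc (value p) N n)) (≡.sym (ℕₚ.*-identityˡ _)))
             (card≤cover {factorTuples p n} (isCard p) (φ-cover p small))) small))
        (≤-reflexive (R.+-identityˡ _))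

    -- A formula T of r that implies φ and bounds the fibers over (y_I , x): since T has at
    -- least q^(d+e-ε) points, at most q^e p^c of them over each x, φ has at least q^(d-ε).
    module Lower (φ : Formula (Dom F) ℒσ n) (Φ : List (Formula (∃ A) ℒσ n))
      (entail : ∀ v → All (λ θ → Sat F proj₁ θ v) Φ → Sat F id φ v) where
      lower : Witnesses Φ → SmallFibers (ys I ++ xs K) (_↑ˡ n) → ∀ v → IsδFormula φ v → fin (fromℕ d) ≤₋∞ v
      lower (Ψ , rΨ , Ψ⇒Φ) (Θ , N , rΘ , small) = conclude (proj₁ δT) (proj₂ δT) T-lower
        where
        T : Formula (∃ A) ℒσ (m ℕ.+ n)
        T = ⋀ (Ψ List.++ Θ)
        open OverFinite (constants T)

        rΨΘ : All r (Ψ List.++ Θ)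
        rΨΘ = Allₚ.++⁺ rΨ rΘ

        rT : r T
        rT = true⇒∈type em isDF ι complete z⊨r T
          (⋀-QuantifierFree (All.map (λ {φ} → IsCompleteQFType.quantifierFree complete φ) rΨΘ))
          (Sat-⋀⁺ M ι (DifferenceField.refl isDF) (All.map (λ {φ} → z⊨r φ) rΨΘ))

        T↾ : ∃[ χ ] (mapCon include χ ≡ T)
        T↾ = preimage include T (All.tabulate λ {c} c∈ → (proj₁ c , proj₂ c , c∈) , ≡.refl)

        φT : Formula (Dom F) ℒσ (m ℕ.+ n)
        φT = mapCon proj₁ T

        r↾⊫φT : _⊫_ F proj₁ (r ↾) φT
        r↾⊫φT = proj₁ T↾ ∷ [] , ≡.subst r (≡.sym (proj₂ T↾)) rT ∷ [] ,
          λ { v (χv ∷ []) → from (Sat-mapCon proj₁ F id T v)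
                (≡.subst (λ T → Sat F proj₁ T v) (proj₂ T↾) (from (Sat-mapCon include F proj₁ (proj₁ T↾) v) χv)) }

        δT : ∃ (IsδFormula φT)
        δT = δ-exists em 𝓕 φT

        T-lower : fin (fromℕ D) ≤₋∞ proj₁ δT
        T-lower = proj₁ isδ (proj₁ δT) (φT , r↾⊫φT , proj₂ δT)

        e+d≤D : e ℕ.+ d ℕ.≤ D
        e+d≤D = length≤D z⊨r (ys I ++ xs K) I-independent

        φ-true : Large (λ p → ∀ x → All (λ θ → Sat (factor p) (ιₚ p) θ x) Φ → Sat (factor p) (λ c → c p) φ x)
        φ-true = entailment-at-indices proj₁ Φ φ entail

        T-small : ∀ {Nφ NT} → HasNonstandardCard φ Nφ → HasNonstandardCard φT NT →
          Large (λ p → NT p ℕ.≤ Nφ p ℕ.* (q em 𝓕 p ℕ.^ e ℕ.* value p ℕ.^ (N ℕ.* m)))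
        T-small {Nφ} {NT} cardφ cardT = large-zipWith U (λ {p} φ-true small → bound-at p φ-true small) φ-true small
          where
          module _ (p : ℙ)
            (φ-true : ∀ x → All (λ θ → Sat (factor p) (ιₚ p) θ x) Φ → Sat (factor p) (λ c → c p) φ x)
            (small : ∀ i v → Cover (FiniteField.setoid (𝔽 p))
              (FiberOf proj₁ (ys I ++ xs K) Θ p v (i ↑ˡ n)) (value p ℕ.^ N)) where
            open FiniteField (𝔽 p) using (_≈_; refl; setoid)
            Z = factorTuples p (m ℕ.+ n)

            ≋-refl : ∀ {l} {v : Vec (Dom (factor p)) l} → Pointwise _≈_ v v
            ≋-refl = Pointwise.refl refl

            -- The points of the second part of T over x, with x′ ≈ x because x runs through a list
            -- of representatives.
            Above : Vec (Dom (factor p)) n → Vec (Dom (factor p)) (m ℕ.+ n) → Set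
            Above x z′ = Σ[ y ∈ Vec (Dom (factor p)) m ] Σ[ x′ ∈ Vec (Dom (factor p)) n ]
              (z′ ≡ y ++ x′ × Pointwise _≈_ x′ x × All (λ θ → Sat (factor p) (ιₚ p) θ (y ++ x′)) Θ)

            Fiber-y : Vec (Dom (factor p)) n → Vec (Dom (factor p)) e → Vec (Dom (factor p)) m → Set
            Fiber-y x v y = ∀ i → FiberOf proj₁ (ys I ++ xs K) Θ p
              (v ++ Vec.map (lookup x) K) (i ↑ˡ n) (lookup y i)

            -- There are q^e choices for y_I; given y_I and x_K, each of the m coordinates of y has
            -- at most p^N values.
            above-cover : ∀ x → Cover Z (Above x) (q em 𝓕 p ℕ.^ e ℕ.* (value p ℕ.^ N) ℕ.^ m)
            above-cover x = cover-fibers {factorTuples p e} {Z}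
              {P = λ v z′ → ∃[ y ] (Fiber-y x v y × Pointwise _≈_ z′ (y ++ x))}
              (finite-tuples em (𝔽 p) (value p) e)
              (λ v → cover-map {factorTuples p m} {Z} {P = Fiber-y x v} (_++ x) (λ y≈y′ → Pointwise.++⁺ y≈y′ ≋-refl)
                (cover-vec {setoid} m (λ i → small i (v ++ Vec.map (lookup x) K))))
              λ { _ (y , x′ , ≡.refl , x′≈x , Θz) → Vec.map (lookup y) I , tt , λ v y_I≈v →
                    y , (λ i → y ++ x′ , Θz ,
                      ≡.subst (λ w → Pointwise _≈_ w (v ++ Vec.map (lookup x) K))
                        (≡.sym (≡.trans (Vecₚ.map-++ (lookup (y ++ x′)) (ys I) (xs K))
                          (≡.cong₂ _++_ (map-lookup-↑ˡ y x′ I) (map-lookup-↑ʳ y x′ K))))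
                        (Pointwise.++⁺ y_I≈v (lookup-cong x′≈x K)) ,
                      FiniteField.reflexive (𝔽 p) (Vecₚ.lookup-++ˡ y x′ i)) ,
                    Pointwise.++⁺ ≋-refl x′≈x }
              where
              lookup-cong : ∀ {l} {x x′ : Vec (Dom (factor p)) n} → Pointwise _≈_ x x′ → (K : Vec (Fin n) l) →
                Pointwise _≈_ (Vec.map (lookup x) K) (Vec.map (lookup x′) K)
              lookup-cong x≈x′ []      = []
              lookup-cong x≈x′ (i ∷ K) = Pointwise.lookup x≈x′ i ∷ lookup-cong x≈x′ K

            T-cover : Cover Z (Sat (factor p) (λ c → c p) φT)
              (Nφ p ℕ.* (q em 𝓕 p ℕ.^ e ℕ.* (value p ℕ.^ N) ℕ.^ m))
            T-cover = cover-fibers {factorTuples p n} {Z} {P = Above}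
              (HasCard⇒Cover {factorTuples p n} (cardφ p)) above-cover over
              where
              over : ∀ z′ → Sat (factor p) (λ c → c p) φT z′ → ∃[ x ] (Sat (factor p) (λ c → c p) φ x ×
                (∀ x′ → Pointwise _≈_ x x′ → Above x′ z′))
              over z′ Tz′ with Vec.splitAt m z′
              ... | y , x , ≡.refl =
                let ΨΘ = Sat-⋀⁻ (factor p) (ιₚ p) (Ψ List.++ Θ)
                      (to (Sat-mapCon proj₁ (factor p) (λ c → c p) T (y ++ x)) Tz′) in
                x , φ-true x (Ψ⇒Φ p y x (Allₚ.++⁻ˡ Ψ ΨΘ)) ,
                λ x′ x≈x′ → y , x , ≡.refl , x≈x′ , Allₚ.++⁻ʳ Ψ ΨΘ

            bound-at : NT p ℕ.≤ Nφ p ℕ.* (q em 𝓕 p ℕ.^ e ℕ.* value p ℕ.^ (N ℕ.* m))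
            bound-at = ≡.subst (NT p ℕ.≤_)
              (≡.cong (λ c → Nφ p ℕ.* (q em 𝓕 p ℕ.^ e ℕ.* c)) (ℕₚ.^-*-assoc (value p) N m))
              (card≤cover {Z} (cardT p) T-cover)

        conclude : ∀ u → IsδFormula φT u → fin (fromℕ D) ≤₋∞ u → ∀ v → IsδFormula φ v → fin (fromℕ d) ≤₋∞ v
        -- An empty φ would make T empty. That T itself has value -∞ is already excluded by its
        -- lower bound D.
        conclude (fin s) (NT , cardT , NT≢0 , _) _ -∞ (Nφ , cardφ , Nφ≡0) =
          ⊥-elim (large-⊥ (large-zipWith U
            (λ {p} NT≤ (NT≢0 , Nφ≡0) → NT≢0 (ℕₚ.n≤0⇒n≡0 (≡.subst
              (λ c → NT p ℕ.≤ c ℕ.* (q em 𝓕 p ℕ.^ e ℕ.* value p ℕ.^ (N ℕ.* m))) Nφ≡0 NT≤)))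
            (T-small cardφ cardT) (large-∩ NT≢0 Nφ≡0)))
        -- Here d + e ≤ D ≤ s ≤ t + e, and e cancels.
        conclude (fin s) (NT , cardT , NT≢0 , st-s) D≤s (fin t) (Nφ , cardφ , _ , st-t) =
          +-cancelʳ-≤ (fromℕ e) (≤-trans (≤-reflexive d+e≈) (≤-trans (fromℕ-mono-≤ e+d≤D) (≤-trans D≤s
            (standardPart-≤ em 𝓕 {NT} {Nφ} e (N ℕ.* m) NT≢0 st-s st-t (T-small cardφ cardT)))))
          where
          d+e≈ : fromℕ d R.+ fromℕ e R.≈ fromℕ (e ℕ.+ d)
          d+e≈ = R.trans (R.+-comm _ _) (R.sym (Multₚ.×-homo-+ R.semiring R.1# e d))

    isδ : Isδ proj₁ (∃y m r) (fin (fromℕ d))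
    isδ = (λ { v (φ , (Φ , rΦ , entail) , δφ) → Lower.lower φ Φ entail (witnesses Φ rΦ)
        (fibers-small proj₁ complete E z⊨r (ys I ++ xs K) I-independent m (_↑ˡ n) y-dependent) v δφ }) ,
      -- The infimum is attained up to ≤ by the formula from `upper`, so every lower bound h is at
      -- most d.
      λ h h-lower →
        let φ , ⊫φ , v , δφ , v≤d =
              upper (fibers-small proj₁ complete E z⊨r (xs K) K-independent n (m ↑ʳ_) x-dependent)
        in ≤₋∞-trans {h} {v} {fin (fromℕ d)} (h-lower v (φ , ⊫φ , δφ)) v≤d
      where
      ≤₋∞-trans : ∀ {x y z : ℝ₋∞} → x ≤₋∞ y → y ≤₋∞ z → x ≤₋∞ z
      ≤₋∞-trans { -∞}                      _   _   = tt
      ≤₋∞-trans {fin _} {fin _} {fin _}    x≤y y≤z = ≤-trans x≤y y≤z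

  Result : Set
  Result = ∃[ d ] (IsDimRk M ι (∃y m r) d × Isδ proj₁ (∃y m r) (fin (fromℕ d)))

  module _ (b : Vec (Dom M) m) (a : Vec (Dom M) n) (z⊨r : _Realizes_ M ι (b ++ a) r) where

    XIndependent : ℕ → Set
    XIndependent l = Σ[ K ∈ Vec (Fin n) l ] Independent (Vec.map (lookup (b ++ a)) (xs K))

    YIndependent : ∀ {d} → Vec (Fin n) d → ℕ → Set
    YIndependent K l = Σ[ I ∈ Vec (Fin m) l ] Independent (Vec.map (lookup (b ++ a)) (ys I ++ xs K))

    fromYBasis : ∀ {d} (K : XIndependent d) → (∀ l → XIndependent l → l ℕ.≤ d) →
      ∃[ e ] (YIndependent (proj₁ K) e × (∀ l → YIndependent (proj₁ K) l → l ℕ.≤ e)) → Result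
    fromYBasis {d} (K , K-ind) K-max (e , (I , I-ind) , I-max) = d , isDimRk , isδ
      where open Bases b a z⊨r K K-ind K-max I I-ind I-max

    fromXBasis : ∃[ d ] (XIndependent d × (∀ l → XIndependent l → l ℕ.≤ d)) → Result
    fromXBasis (d , (K , K-ind) , K-max) = fromYBasis (K , K-ind) K-max
      -- Index vectors may repeat entries, so a bound on their length is taken from the rank over
      -- the empty parameter set. Extending K, chosen first among the x alone, makes d the rank of a
      -- itself.
      (Classical.maximum em (YIndependent K) ([] , K-ind) (OverFinite.D []) λ l (I , I-ind) →
        ℕₚ.≤-trans (ℕₚ.m≤m+n l d) (OverFinite.length≤D [] z⊨r (ys I ++ xs K) I-ind))

    fromRealization : Result
    fromRealization = fromXBasis (Classical.maximum em XIndependent ([] , independent-[]) (OverFinite.D [])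
      λ l (K , K-ind) → OverFinite.length≤D [] z⊨r (xs K) K-ind)

  result : Result
  result = split (qfType-realization E proj₁ complete)
    where
    split : ∃[ z ] (_Realizes_ M ι z r) → Result
    split (z , z⊨r) with Vec.splitAt m z
    ... | b , a , ≡.refl = fromRealization b a z⊨r

theorem3p5 : ExcludedMiddle (lsuc 0ℓ) →
    (𝓡 : Reals) (cdm : CountingConstants 𝓡) →
    (𝓕 : 𝒮 𝓡 cdm) (A : Subset 𝓕) (n m : ℕ) (r : TypeOver 𝓕 A (m ℕ.+ n)) →
    IsCompleteQFTypeOver 𝓕 A r →
    ((𝓕′ : 𝒮 𝓡 cdm) (A′ : Subset 𝓕′) → Countable 𝓕′ A′ →
    (l : ℕ) (p : TypeOver 𝓕′ A′ l) → IsCompleteQFTypeOver 𝓕′ A′ p →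
    δ≡dimRk 𝓕′ A′ p) →
    δ≡dimRk 𝓕 A (∃y m r)
theorem3p5 em 𝓡 cdm 𝓕 A n m r complete conjecture E =
  Main.result (lowerLEM em) 𝓕 A complete (conjecture 𝓕) E
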